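{- Let $G$ and $H$ be finite simple graphs. Then the symmetric edge polytopes $\mathcal{P}_G$ and $\mathcal{P}_H$ are unimodularly equivalent if and only if the graphic matroids $\mathcal{M}_G$ and $\mathcal{M}_H$ are isomorphic.
   Context: For a finite simple graph $G$ on vertex set $[m]$, its symmetric edge polytope is $\mathcal{P}_G=\mathrm{conv}\{\pm(\mathbf{e}_i-\mathbf{e}_j) : \{i,j\}\in E(G)\}\subseteq\mathbb{R}^{m}$, where $\mathbf{e}_i$ are standard basis vectors. The graphic matroid $\mathcal{M}_G$ has ground set $E(G)$, with a set of edges independent iff it contains no cycle. Two lattice polytopes (possibly in different ambient spaces $\mathbb{R}^a,\mathbb{R}^b$ and not full-dimensional) are unimodularly equivalent if there is an affine bijection between their affine hulls that maps the lattice points of one affine hull bijectively onto the lattice points of the other and maps one polytope onto the other (for full-dimensional polytopes in $\mathbb{R}^r$: $Q=F(P)+\mathbf{v}$ with $F\in\mathrm{GL}_r(\mathbb{Z})$, $\mathbf{v}\in\mathbb{Z}^r$).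
   Formalization: The symmetric edge polytopes, their affine hulls and the affine bijection between them are taken over the rational numbers (rational points, rational coefficients) instead of the reals. -}

module Defs where

open import Data.Nat using (ℕ; zero; suc)
open import Data.Fin using (Fin; zero; suc; inject₁; fromℕ; _≟_) renaming (_<_ to _<ᶠ_)
open import Data.Fin.Subset using (Subset; _∈_)
open import Data.Bool using (Bool; true; false; if_then_else_)
open import Data.Product using (Σ; ∃; _×_; _,_; proj₁; proj₂)
open import Data.Sum using (_⊎_)
open import Data.Vec using (tabulate; lookup)
open import Data.Rational using (ℚ; 0ℚ; 1ℚ; _+_; _*_; _-_; -_; _≤_)
import Data.Rational as ℚ
open import Relation.Nullary using (¬_; Dec; does)
open import Relation.Binary.PropositionalEquality using (_≡_)
open import Function using (_↔_; Inverse)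
open import Function.Bundles using (_⇔_)

-- Finite simple graphs on vertex set Fin n (= [n]) with edge set indexed
-- by Fin e.  Edge k has endpoints (u , v) with u < v (no loops, a fixed
-- orientation), and distinct edge indices have distinct endpoint pairs
-- (no multi-edges).

record Graph : Set where
  field
    n     : ℕ
    e     : ℕ
    ends  : Fin e → Fin n × Fin n
    ordered : ∀ k → proj₁ (ends k) <ᶠ proj₂ (ends k)
    simple  : ∀ k l → ends k ≡ ends l → k ≡ l
open Graph public

JoinedIn : (G : Graph) → Subset (e G) → Fin (n G) → Fin (n G) → Set
JoinedIn G F u v = Σ (Fin (e G)) λ k → k ∈ F × ((ends G k ≡ (u , v)) ⊎ (ends G k ≡ (v , u)))

record CycleIn (G : Graph) (F : Subset (e G)) : Set where
  field
    j       : ℕ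
    w       : Fin (suc (suc (suc j))) → Fin (n G)
    distinct : ∀ a b → w a ≡ w b → a ≡ b
    steps   : ∀ (i : Fin (suc (suc j))) → JoinedIn G F (w (inject₁ i)) (w (suc i))
    closing : JoinedIn G F (w (fromℕ (suc (suc j)))) (w zero)

Independent : (G : Graph) → Subset (e G) → Set
Independent G F = ¬ CycleIn G F

MatroidIso : Graph → Graph → Set
MatroidIso G H =
  Σ (Fin (e G) ↔ Fin (e H)) λ σ →
    ∀ (F : Subset (e G)) →
      Independent G F ⇔ Independent H (tabulate (λ k → lookup F (Inverse.from σ k)))

Vecℚ : ℕ → Set
Vecℚ m = Fin m → ℚ

_≋_ : ∀ {m} → Vecℚ m → Vecℚ m → Set
x ≋ y = ∀ i → x i ≡ y i

sumF : ∀ {k} → (Fin k → ℚ) → ℚ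
sumF {zero}  f = 0ℚ
sumF {suc k} f = f zero + sumF (λ i → f (suc i))

unit : ∀ {m} → Fin m → Vecℚ m
unit u i = if does (u ≟ i) then 1ℚ else 0ℚ

Gen : Graph → Set
Gen G = Fin (e G) × Bool

gen : (G : Graph) → Gen G → Vecℚ (n G)
gen G (k , true)  i = unit (proj₁ (ends G k)) i - unit (proj₂ (ends G k)) i
gen G (k , false) i = unit (proj₂ (ends G k)) i - unit (proj₁ (ends G k)) i

sumGen : (G : Graph) → (Gen G → ℚ) → ℚ
sumGen G h = sumF (λ k → h (k , true) + h (k , false))

comb : (G : Graph) → (Gen G → ℚ) → Vecℚ (n G)
comb G c i = sumGen G (λ g → c g * gen G g i)

-- (rational points of) the symmetric edge polytope: convex hull of the generators
InP : (G : Graph) → Vecℚ (n G) → Set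
InP G x = Σ (Gen G → ℚ) λ c → (∀ g → 0ℚ ≤ c g) × (sumGen G c ≡ 1ℚ) × (x ≋ comb G c)

-- (rational points of) the affine hull of P_G
InAff : (G : Graph) → Vecℚ (n G) → Set
InAff G x = Σ (Gen G → ℚ) λ c → (sumGen G c ≡ 1ℚ) × (x ≋ comb G c)

IsInt : ℚ → Set
IsInt q = ℚ.denominatorℕ q ≡ 1

IsLattice : ∀ {m} → Vecℚ m → Set
IsLattice x = ∀ i → IsInt (x i)

affComb : ∀ {m} → ℚ → Vecℚ m → Vecℚ m → Vecℚ m
affComb t x y i = t * x i + (1ℚ - t) * y i

UnimodEquiv : Graph → Graph → Set
UnimodEquiv G H =
  Σ (Vecℚ (n G) → Vecℚ (n H)) λ f →
    (∀ x → InAff G x → InAff H (f x)) ×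
    (∀ x y t → InAff G x → InAff G y → f (affComb t x y) ≋ affComb t (f x) (f y)) ×
    (∀ x y → InAff G x → InAff G y → f x ≋ f y → x ≋ y) ×
    (∀ y → InAff H y → Σ (Vecℚ (n G)) λ x → InAff G x × (f x ≋ y)) ×
    -- lattice points correspond to lattice points (bijectively, given the above)
    (∀ x → InAff G x → (IsLattice x ⇔ IsLattice (f x))) ×
    (∀ x → InP G x → InP H (f x)) ×
    (∀ y → InP H y → Σ (Vecℚ (n G)) λ x → InP G x × (f x ≋ y))

{-# OPTIONS --safe #-}
module Submission where

-- Write Z_G for the space of rational flows on the edges of G, the linear relations among
-- the vectors e_i - e_j.  A set of edges contains a cycle iff it supports a nonzero flow, and
-- then it supports one with entries 0, 1, -1: Z_G is a regular chain group whose dependent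
-- sets are those of the graphic matroid.
--
-- From polytopes to matroids: the vertices of P_G are the vectors ±(e_i - e_j), so an affine
-- equivalence permutes them; it fixes the origin because the coordinates of the vertices lie
-- in [-1,1].  Hence it is linear, induces a bijection of the edges up to sign, and carries
-- Z_G to Z_H.
--
-- From matroids to polytopes: regular chain groups with the same dependent sets differ only
-- by the signs of the coordinates.  Relative to a common basis both are graphs of
-- {0, 1, -1}-matrices of the same support, and such matrices agree up to signs of rows and
-- columns since in a chordless cycle of the bipartite incidence graph the product of the signs
-- is forced (an entry 2 would appear otherwise).  With Z_H a signed copy of Z_G, the edge map
-- extends linearly, and integrally because every vector of the span of the edges is recovered
-- from its coordinates by integral functionals.

open import Defs
open import Function.Bundles using (_⇔_)
open import Algebra.Properties.CommutativeMonoid.Sum using (sum; sum-permute)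
import Data.Bool as Bool
open import Data.Bool using (Bool; true; false; not; if_then_else_)
open import Data.Empty using (⊥; ⊥-elim)
open import Data.Fin using (Fin; zero; suc; toℕ; fromℕ; fromℕ<; inject₁)
import Data.Fin.Properties as Fin
open import Data.Fin.Subset using (Subset; _∈_)
open import Data.Fin.Subset.Properties using (anySubset?)
import Data.Integer as ℤ
open import Data.Nat using (ℕ; zero; suc; s≤s; z≤n)
import Data.Nat as ℕ
import Data.Nat.Coprimality as Coprime
import Data.Nat.Properties as ℕ
open import Data.Product using (Σ; ∃; _×_; _,_; proj₁; proj₂)
open import Data.Product.Properties using (≡-dec)
open import Data.Rational using (ℚ; mkℚ; 0ℚ; 1ℚ; ½; _+_; _*_; _-_; -_; _/_; 1/_; _≤_; ≢-nonZero; nonNegative)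
import Data.Rational.Properties as ℚ
open import Data.Sum using (_⊎_; inj₁; inj₂)
open import Data.Unit using (⊤; tt)
open import Data.Vec using (tabulate; lookup)
import Data.Vec.Properties as Vec
open import Function using (_↔_; Inverse; _∘_; id; mk↔ₛ′)
open import Function.Bundles using (Equivalence; mk⇔)
open import Function.Properties.Inverse using (↔-sym)
open import Level using (0ℓ)
open import Relation.Binary using (tri<; tri≈; tri>)
open import Relation.Binary.PropositionalEquality using (_≡_; _≢_; refl; sym; trans; cong; cong₂; subst; subst₂; module ≡-Reasoning)
open import Relation.Nullary using (¬_; Dec; yes; no; does; contradiction)
open import Relation.Nullary.Decidable using (dec⇒maybe; ¬¬-excluded-middle; _×-dec_; _⊎-dec_; ¬?; decidable-stable; from-yes; from-no)
open import Tactic.RingSolver using (solve-∀)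
open import Tactic.RingSolver.Core.AlmostCommutativeRing using (AlmostCommutativeRing; fromCommutativeRing)

-- `Independent` is a negation and membership in a chain group is an arbitrary predicate, so bases,
-- reachability and the signing itself are first obtained under double negation. Finiteness removes
-- it: a sign vector is a `Subset`, and whether it carries flows to flows can be tested on finitely
-- many generating flows, so a signing is found by search.
--
-- The integral functionals come from merging the ends of the edges one edge at a time. Each vertex
-- is written as a representative of its class plus an integral combination of edges, and the
-- coefficients give functionals on all of ℚⁿ.
--
-- In the other direction vectors are functions, and f is not assumed to respect their pointwise
-- equality; this has to be extracted from the lattice condition. The affine hull is the linear span
-- only if there is an edge; without edges it is empty, a case treated apart.

ringℚ : AlmostCommutativeRing 0ℓ 0ℓ
ringℚ = fromCommutativeRing ℚ.+-*-commutativeRing (λ x → dec⇒maybe (0ℚ ℚ.≟ x))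

-- Rational arithmetic and finite sums

2ℚ : ℚ
2ℚ = 1ℚ + 1ℚ

*-cancel-0 : ∀ {p q} → p ≢ 0ℚ → p * q ≡ 0ℚ → q ≡ 0ℚ
*-cancel-0 {p} {q} p≢0 pq≡0 = begin
  q                ≡⟨ ℚ.*-identityˡ q ⟨
  1ℚ * q           ≡⟨ cong (_* q) (ℚ.*-inverseˡ p) ⟨
  (1/ p) * p * q   ≡⟨ ℚ.*-assoc (1/ p) p q ⟩
  (1/ p) * (p * q) ≡⟨ cong ((1/ p) *_) pq≡0 ⟩
  (1/ p) * 0ℚ      ≡⟨ ℚ.*-zeroʳ (1/ p) ⟩
  0ℚ               ∎
  where
  open ≡-Reasoning
  instance _ = ≢-nonZero p≢0

p-q≡0⇒p≡q : ∀ {p q} → p - q ≡ 0ℚ → p ≡ q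
p-q≡0⇒p≡q {p} {q} eq = trans (lemma p q) (trans (cong (_+ q) eq) (ℚ.+-identityˡ q))
  where
  lemma : ∀ p q → p ≡ (p - q) + q
  lemma = solve-∀ ringℚ

p≡q⇒p-q≡0 : ∀ {p q} → p ≡ q → p - q ≡ 0ℚ
p≡q⇒p-q≡0 {p} refl = ℚ.+-inverseʳ p

sum-cong : ∀ {m} {f g : Fin m → ℚ} → (∀ i → f i ≡ g i) → sumF f ≡ sumF g
sum-cong {zero}  f≗g = refl
sum-cong {suc m} f≗g = cong₂ _+_ (f≗g zero) (sum-cong (f≗g ∘ suc))

sum-zero : ∀ {m} {f : Fin m → ℚ} → (∀ i → f i ≡ 0ℚ) → sumF f ≡ 0ℚ
sum-zero {zero}  f≗0 = refl
sum-zero {suc m} f≗0 = trans (cong₂ _+_ (f≗0 zero) (sum-zero (f≗0 ∘ suc))) (ℚ.+-identityˡ 0ℚ)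

sum-+ : ∀ {m} (f g : Fin m → ℚ) → sumF (λ i → f i + g i) ≡ sumF f + sumF g
sum-+ {zero}  f g = refl
sum-+ {suc m} f g = trans (cong (f zero + g zero +_) (sum-+ (f ∘ suc) (g ∘ suc))) (interchange (f zero) (g zero) (sumF (f ∘ suc)) (sumF (g ∘ suc)))
  where
  interchange : ∀ a b c d → (a + b) + (c + d) ≡ (a + c) + (b + d)
  interchange = solve-∀ ringℚ

sum-*ˡ : ∀ {m} (a : ℚ) (f : Fin m → ℚ) → sumF (λ i → a * f i) ≡ a * sumF f
sum-*ˡ {zero}  a f = sym (ℚ.*-zeroʳ a)
sum-*ˡ {suc m} a f = trans (cong (a * f zero +_) (sum-*ˡ a (f ∘ suc))) (sym (ℚ.*-distribˡ-+ a _ _))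

sum-*ʳ : ∀ {m} (a : ℚ) (f : Fin m → ℚ) → sumF (λ i → f i * a) ≡ sumF f * a
sum-*ʳ a f = trans (sum-cong (λ i → ℚ.*-comm (f i) a)) (trans (sum-*ˡ a f) (ℚ.*-comm a _))

sum-neg : ∀ {m} (f : Fin m → ℚ) → sumF (λ i → - f i) ≡ - sumF f
sum-neg {zero}  f = refl
sum-neg {suc m} f = trans (cong (- f zero +_) (sum-neg (f ∘ suc))) (sym (ℚ.neg-distrib-+ (f zero) (sumF (f ∘ suc))))

sum-- : ∀ {m} (f g : Fin m → ℚ) → sumF (λ i → f i - g i) ≡ sumF f - sumF g
sum-- f g = trans (sum-+ f (λ i → - g i)) (cong (sumF f +_) (sum-neg g))

sum-swap : ∀ {m n} (f : Fin m → Fin n → ℚ) →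
           sumF (λ i → sumF (λ j → f i j)) ≡ sumF (λ j → sumF (λ i → f i j))
sum-swap {zero} {n} f = sym (sum-zero {n} (λ _ → refl))
sum-swap {suc m} f = trans (cong (sumF (f zero) +_) (sum-swap (f ∘ suc))) (sym (sum-+ (f zero) _))

sum-single : ∀ {m} {f : Fin m → ℚ} (i : Fin m) → (∀ j → j ≢ i → f j ≡ 0ℚ) → sumF f ≡ f i
sum-single {f = f} zero others =
  trans (cong (f zero +_) (sum-zero (λ j → others (suc j) λ ()))) (ℚ.+-identityʳ _)
sum-single {f = f} (suc i) others =
  trans (cong₂ _+_ (others zero λ ()) (sum-single i (λ j j≢i → others (suc j) (j≢i ∘ Fin.suc-injective))))
        (ℚ.+-identityˡ _)

sum-reindex : ∀ {m n} (π : Fin m ↔ Fin n) (f : Fin n → ℚ) → sumF f ≡ sumF (λ i → f (Inverse.to π i))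
sum-reindex π f = trans (sumF≡sum f) (trans (sum-permute ℚ.+-0-commutativeMonoid f π) (sym (sumF≡sum (λ i → f (Inverse.to π i)))))
  where
  sumF≡sum : ∀ {m} (f : Fin m → ℚ) → sumF f ≡ sum ℚ.+-0-commutativeMonoid f
  sumF≡sum {zero}  f = refl
  sumF≡sum {suc m} f = cong (f zero +_) (sumF≡sum (f ∘ suc))

unit-same : ∀ {m} (u : Fin m) → unit u u ≡ 1ℚ
unit-same u with u Fin.≟ u
... | yes _  = refl
... | no u≢u = contradiction refl u≢u

unit-other : ∀ {m} {u i : Fin m} → u ≢ i → unit u i ≡ 0ℚ
unit-other {u = u} {i} u≢i with u Fin.≟ i
... | yes u≡i = contradiction u≡i u≢i
... | no _    = refl

sum-unitʳ : ∀ {m} (f : Fin m → ℚ) (u : Fin m) → sumF (λ i → f i * unit u i) ≡ f u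
sum-unitʳ f u = trans
  (sum-single u (λ j j≢u → trans (cong (f j *_) (unit-other (j≢u ∘ sym))) (ℚ.*-zeroʳ (f j))))
  (trans (cong (f u *_) (unit-same u)) (ℚ.*-identityʳ (f u)))

0≢1 : 0ℚ ≢ 1ℚ
0≢1 ()

Ternary : ℚ → Set
Ternary q = q ≡ 0ℚ ⊎ q ≡ 1ℚ ⊎ q ≡ - 1ℚ

ternary-* : ∀ {p q} → Ternary p → Ternary q → Ternary (p * q)
ternary-* {q = q} (inj₁ refl) _ = inj₁ (ℚ.*-zeroˡ q)
ternary-* {q = q} (inj₂ (inj₁ refl)) t = subst Ternary (sym (ℚ.*-identityˡ q)) t
ternary-* (inj₂ (inj₂ refl)) (inj₁ refl)        = inj₁ refl
ternary-* (inj₂ (inj₂ refl)) (inj₂ (inj₁ refl)) = inj₂ (inj₂ refl)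
ternary-* (inj₂ (inj₂ refl)) (inj₂ (inj₂ refl)) = inj₂ (inj₁ refl)

ternary-square : ∀ {q} → Ternary q → q ≢ 0ℚ → q * q ≡ 1ℚ
ternary-square (inj₁ refl)        q≢0 = contradiction refl q≢0
ternary-square (inj₂ (inj₁ refl)) q≢0 = refl
ternary-square (inj₂ (inj₂ refl)) q≢0 = refl

unit-ternary : ∀ {m} (u i : Fin m) → Ternary (unit u i)
unit-ternary u i with u Fin.≟ i
... | yes _ = inj₂ (inj₁ refl)
... | no _  = inj₁ refl

ternary-neg : ∀ {q} → Ternary q → Ternary (- q)
ternary-neg (inj₁ refl)        = inj₁ refl
ternary-neg (inj₂ (inj₁ refl)) = inj₂ (inj₂ refl)
ternary-neg (inj₂ (inj₂ refl)) = inj₂ (inj₁ refl)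

sgn : Bool → ℚ
sgn true  = 1ℚ
sgn false = - 1ℚ

sgn-square : ∀ b → sgn b * sgn b ≡ 1ℚ
sgn-square true  = refl
sgn-square false = refl

sgn-cancel : ∀ b q → sgn b * (sgn b * q) ≡ q
sgn-cancel b q = trans (sym (ℚ.*-assoc (sgn b) (sgn b) q))
                       (trans (cong (_* q) (sgn-square b)) (ℚ.*-identityˡ q))

-- Double-negation shift, valid since the index set is finite: what is known under double negation
-- at each index is collected into one function.
¬¬-∀ : ∀ {m} {P : Fin m → Set} → (∀ i → ¬ ¬ P i) → ¬ ¬ (∀ i → P i)
¬¬-∀ {zero}  ¬¬P k = k λ ()
¬¬-∀ {suc m} ¬¬P k = ¬¬P zero λ p → ¬¬-∀ (¬¬P ∘ suc) λ ps → k (Fin.∀-cons p ps)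

-- Signings of regular matrices

Matrix : ℕ → ℕ → Set
Matrix r s = Fin r → Fin s → ℚ

_·ᵛ_ : ∀ {r s} → Matrix r s → (Fin s → ℚ) → Fin r → ℚ
(D ·ᵛ ζ) b = sumF (λ c → D b c * ζ c)

·ᵛ-linear : ∀ {r s} (D : Matrix r s) (u v : Fin s → ℚ) t b →
            (D ·ᵛ (λ c → u c + t * v c)) b ≡ (D ·ᵛ u) b + t * (D ·ᵛ v) b
·ᵛ-linear D u v t b = begin
  sumF (λ c → D b c * (u c + t * v c))
    ≡⟨ sum-cong (λ c → rearrange (D b c) (u c) t (v c)) ⟩
  sumF (λ c → D b c * u c + t * (D b c * v c))
    ≡⟨ sum-+ (λ c → D b c * u c) (λ c → t * (D b c * v c)) ⟩
  (D ·ᵛ u) b + sumF (λ c → t * (D b c * v c))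
    ≡⟨ cong ((D ·ᵛ u) b +_) (sum-*ˡ t (λ c → D b c * v c)) ⟩
  (D ·ᵛ u) b + t * (D ·ᵛ v) b ∎
  where
  open ≡-Reasoning
  rearrange : ∀ d u t v → d * (u + t * v) ≡ d * u + t * (d * v)
  rearrange = solve-∀ ringℚ

·ᵛ-unit : ∀ {r s} (D : Matrix r s) c b → (D ·ᵛ unit c) b ≡ D b c
·ᵛ-unit D c b = sum-unitʳ (D b) c

record Circuit {r s} (D : Matrix r s) (ζ : Fin s → ℚ) : Set where
  field
    η         : Fin s → ℚ
    nonzero   : ∃ λ c → η c ≢ 0ℚ
    support   : ∀ c → ζ c ≡ 0ℚ → η c ≡ 0ℚ
    image     : ∀ b → (D ·ᵛ ζ) b ≡ 0ℚ → (D ·ᵛ η) b ≡ 0ℚ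
    ternary   : ∀ c → Ternary (η c)
    ternary·ᵛ : ∀ b → Ternary ((D ·ᵛ η) b)

-- A form of total unimodularity: the chain group of all pairs (ζ , D ·ᵛ ζ) is regular.
Regular : ∀ {r s} → Matrix r s → Set
Regular {r} {s} D = ∀ (ζ : Fin s → ℚ) → (∃ λ c → ζ c ≢ 0ℚ) → Circuit D ζ

_⊙_ : Bool → Bool → Bool
true  ⊙ b = b
false ⊙ b = not b

sgn-⊙ : ∀ a b → sgn (a ⊙ b) ≡ sgn a * sgn b
sgn-⊙ true  true  = refl
sgn-⊙ true  false = refl
sgn-⊙ false true  = refl
sgn-⊙ false false = refl

swap-cancel : ∀ x y q → sgn x * (sgn y * (sgn x * (sgn y * q))) ≡ q
swap-cancel x y q = trans (rearrange (sgn x) (sgn y) q)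
                          (trans (cong (sgn x *_) (cong (sgn x *_) (sgn-cancel y q))) (sgn-cancel x q))
  where
  rearrange : ∀ x y q → x * (y * (x * (y * q))) ≡ x * (x * (y * (y * q)))
  rearrange = solve-∀ ringℚ

sgn-ternary : ∀ b → Ternary (sgn b)
sgn-ternary true  = inj₂ (inj₁ refl)
sgn-ternary false = inj₂ (inj₂ refl)

sgn≢0 : ∀ b → sgn b ≢ 0ℚ
sgn≢0 true  ()
sgn≢0 false ()

module _ {r s} (D D′ : Matrix r s) (ε : Fin r → Bool) (δ : Fin s → Bool)
         (switched : ∀ b c → D′ b c ≡ sgn (ε b) * (sgn (δ c) * D b c)) where

  private
    twist : (Fin s → ℚ) → Fin s → ℚ
    twist ζ c = sgn (δ c) * ζ c

    ·ᵛ-switch : ∀ ζ b → (D′ ·ᵛ ζ) b ≡ sgn (ε b) * (D ·ᵛ twist ζ) b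
    ·ᵛ-switch ζ b = trans
      (sum-cong (λ c → trans (cong (_* ζ c) (switched b c)) (rearrange (sgn (ε b)) (sgn (δ c)) (D b c) (ζ c))))
      (sum-*ˡ (sgn (ε b)) (λ c → D b c * twist ζ c))
      where
      rearrange : ∀ x y d z → x * (y * d) * z ≡ x * (d * (y * z))
      rearrange = solve-∀ ringℚ

    sgn-*-0 : ∀ x {q} → q ≡ 0ℚ → sgn x * q ≡ 0ℚ
    sgn-*-0 x refl = ℚ.*-zeroʳ (sgn x)

    twist-twist : ∀ (ζ : Fin s → ℚ) c → twist (twist ζ) c ≡ ζ c
    twist-twist ζ c = sgn-cancel (δ c) (ζ c)

    ·ᵛ-untwist : ∀ ζ b → (D′ ·ᵛ twist ζ) b ≡ sgn (ε b) * (D ·ᵛ ζ) b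
    ·ᵛ-untwist ζ b = trans (·ᵛ-switch (twist ζ) b)
      (cong (sgn (ε b) *_) (sum-cong (λ c → cong (D b c *_) (twist-twist ζ c))))

  -- Multiplying by signs is an involution that keeps supports and ternary values, so a circuit of
  -- `D` at the twisted ζ, twisted back, is a circuit of `D′` at ζ.
  Regular-switch : Regular D → Regular D′
  Regular-switch reg ζ (c , ζc≢0) = record
    { η         = twist C.η
    ; nonzero   = proj₁ C.nonzero , λ eq → proj₂ C.nonzero (*-cancel-0 (sgn≢0 (δ _)) eq)
    ; support   = λ c eq → sgn-*-0 (δ c) (C.support c (sgn-*-0 (δ c) eq))
    ; image     = λ b eq → trans (·ᵛ-untwist C.η b) (sgn-*-0 (ε b)
                    (C.image b (*-cancel-0 (sgn≢0 (ε b)) (trans (sym (·ᵛ-switch ζ b)) eq))))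
    ; ternary   = λ c → ternary-* (sgn-ternary (δ c)) (C.ternary c)
    ; ternary·ᵛ = λ b → subst Ternary (sym (·ᵛ-untwist C.η b)) (ternary-* (sgn-ternary (ε b)) (C.ternary·ᵛ b))
    }
    where
    module C = Circuit (reg (twist ζ) (c , λ eq → ζc≢0 (*-cancel-0 (sgn≢0 (δ c)) eq)))

-- Pad ζ by 0 at the deleted column: a circuit stays inside the support, so its own entry there is 0
-- and can be deleted again.
Regular-tail : ∀ {r s} (D : Matrix r (suc s)) → Regular D → Regular (λ b c → D b (suc c))
Regular-tail D reg ζ (c , ζc≢0) = record
  { η         = λ c → C.η (suc c)
  ; nonzero   = nonzero C.nonzero
  ; support   = λ c → C.support (suc c)
  ; image     = λ b eq → trans (sym (drop C.η η₀≡0 b)) (C.image b (trans (drop ζ⁺ refl b) eq))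
  ; ternary   = λ c → C.ternary (suc c)
  ; ternary·ᵛ = λ b → subst Ternary (drop C.η η₀≡0 b) (C.ternary·ᵛ b)
  }
  where
  ζ⁺ : Fin _ → ℚ
  ζ⁺ zero    = 0ℚ
  ζ⁺ (suc c) = ζ c
  module C = Circuit (reg ζ⁺ (suc c , ζc≢0))
  η₀≡0 : C.η zero ≡ 0ℚ
  η₀≡0 = C.support zero refl
  nonzero : (∃ λ c → C.η c ≢ 0ℚ) → ∃ λ c → C.η (suc c) ≢ 0ℚ
  nonzero (zero  , η₀≢0) = contradiction η₀≡0 η₀≢0
  nonzero (suc c , ηc≢0) = c , ηc≢0
  drop : ∀ ξ → ξ zero ≡ 0ℚ → ∀ b →
         (D ·ᵛ ξ) b ≡ ((λ b c → D b (suc c)) ·ᵛ (λ c → ξ (suc c))) b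
  drop ξ ξ₀≡0 b = trans (cong (_+ rest) (trans (cong (D b zero *_) ξ₀≡0) (ℚ.*-zeroʳ (D b zero)))) (ℚ.+-identityˡ rest)
    where
    rest = sumF (λ c → D b (suc c) * ξ (suc c))

_◂_ : ∀ {r s} → (Fin r → ℚ) → Matrix r s → Matrix r (suc s)
(a ◂ M) b zero    = a b
(a ◂ M) b (suc c) = M b c

-- Rows e 0 , … , e k are linked by columns c 0 , … , c (k ∸ 1), consecutive rows
-- sharing a column, with no further incidences.  A new column a meeting the chain
-- only in e 0 and e k closes it to a chordless cycle.
module Chordless {r s} (M : Matrix r s) (ternaryM : ∀ b c → Ternary (M b c))
  (e : ℕ → Fin r) (c : ℕ → Fin s) (k : ℕ)
  (lower : ∀ i → i ℕ.< k → M (e i) (c i) ≢ 0ℚ)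
  (chordless : ∀ i j → i ℕ.< k → j ℕ.≤ k → j ≢ i → j ≢ suc i → M (e j) (c i) ≡ 0ℚ)
  (α : ℚ) where

  -- Chosen so that adding these multiples of `c 0`, `c 1`, ... to the new column cancels the rows
  -- `e 0`, `e 1`, ... in turn; nonzero entries of `M` are their own inverses. The new column enters
  -- only through its entry α at `e 0`, so two columns with the same start share the coefficients.
  coeff : ℕ → ℚ
  coeff zero    = - (α * M (e 0) (c 0))
  coeff (suc i) = - (coeff i * M (e (suc i)) (c i) * M (e (suc i)) (c (suc i)))

  module Column (a : Fin r → ℚ) (start : a (e 0) ≡ α)
    (middle : ∀ j → 0 ℕ.< j → j ℕ.< k → a (e j) ≡ 0ℚ) where

    μ : ℕ → Fin (suc s) → ℚ
    μ zero    = unit zero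
    μ (suc n) = λ x → μ n x + coeff n * unit (suc (c n)) x

    S : ℕ → Fin r → ℚ
    S zero    b = a b
    S (suc n) b = S n b + coeff n * M b (c n)

    ·ᵛ-μ : ∀ n b → ((a ◂ M) ·ᵛ μ n) b ≡ S n b
    ·ᵛ-μ zero    b = ·ᵛ-unit (a ◂ M) zero b
    ·ᵛ-μ (suc n) b = trans (·ᵛ-linear (a ◂ M) (μ n) (unit (suc (c n))) (coeff n) b)
      (cong₂ _+_ (·ᵛ-μ n b) (cong (coeff n *_) (·ᵛ-unit (a ◂ M) (suc (c n)) b)))

    μ-zero : ∀ n → μ n zero ≡ 1ℚ
    μ-zero zero    = refl
    μ-zero (suc n) = trans (cong₂ _+_ (μ-zero n) (ℚ.*-zeroʳ (coeff n))) refl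

    μ-support : ∀ n x → (∀ i → i ℕ.< n → c i ≢ x) → μ n (suc x) ≡ 0ℚ
    μ-support zero    x out = refl
    μ-support (suc n) x out = trans
      (cong₂ _+_ (μ-support n x (λ i i<n → out i (ℕ.m<n⇒m<1+n i<n)))
                 (trans (cong (coeff n *_) (unit-other (out n ℕ.≤-refl ∘ Fin.suc-injective))) (ℚ.*-zeroʳ (coeff n))))
      refl

    private
      +-*-0 : ∀ {p t m} → m ≡ 0ℚ → p + t * m ≡ p
      +-*-0 {p} {t} refl = trans (cong (p +_) (ℚ.*-zeroʳ t)) (ℚ.+-identityʳ p)

    -- Column `c i` meets only `e i` and `e (suc i)` among the rows of the chain. So after n steps
    -- only row `e n` is in flux: later rows still show `a`, earlier ones are already 0
    -- (`S-behind`).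
    S-ahead : ∀ n j → n ℕ.< j → j ℕ.≤ k → S n (e j) ≡ a (e j)
    S-ahead zero    j n<j j≤k = refl
    S-ahead (suc n) j n<j j≤k = trans
      (+-*-0 {S n (e j)} {coeff n} (chordless n j (ℕ.<-trans ℕ.≤-refl (ℕ.<-≤-trans n<j j≤k)) j≤k
        (λ { refl → ℕ.<-asym n<j ℕ.≤-refl }) (λ { refl → ℕ.<-irrefl refl n<j })))
      (S-ahead n j (ℕ.<-trans ℕ.≤-refl n<j) j≤k)

    S-front : ∀ n → n ℕ.< k → S (suc n) (e (suc n)) ≡ a (e (suc n)) + coeff n * M (e (suc n)) (c n)
    S-front n n<k = cong (_+ coeff n * M (e (suc n)) (c n)) (S-ahead n (suc n) ℕ.≤-refl n<k)

    private
      kill : ∀ p m → m * m ≡ 1ℚ → p + - (p * m) * m ≡ 0ℚ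
      kill p m mm≡1 = trans (expand p m) (trans (cong (λ t → p - p * t) mm≡1) (cancel p))
        where
        expand : ∀ p m → p + - (p * m) * m ≡ p - p * (m * m)
        expand = solve-∀ ringℚ
        cancel : ∀ p → p - p * 1ℚ ≡ 0ℚ
        cancel = solve-∀ ringℚ

      square : ∀ i → i ℕ.< k → M (e i) (c i) * M (e i) (c i) ≡ 1ℚ
      square i i<k = ternary-square (ternaryM (e i) (c i)) (lower i i<k)

    S-at : ∀ n → n ℕ.< k → S (suc n) (e n) ≡ 0ℚ
    S-at zero    n<k = trans (cong (λ t → t + coeff 0 * M (e 0) (c 0)) start) (kill α (M (e 0) (c 0)) (square 0 n<k))
    S-at (suc n) n<k = trans (cong (_+ coeff (suc n) * M (e (suc n)) (c (suc n))) front)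
                             (kill (coeff n * M (e (suc n)) (c n)) (M (e (suc n)) (c (suc n))) (square (suc n) n<k))
      where
      front : S (suc n) (e (suc n)) ≡ coeff n * M (e (suc n)) (c n)
      front = trans (S-front n (ℕ.<-trans ℕ.≤-refl n<k))
                    (trans (cong (_+ coeff n * M (e (suc n)) (c n)) (middle (suc n) (s≤s z≤n) n<k)) (ℚ.+-identityˡ _))

    S-behind : ∀ n j → j ℕ.< n → n ℕ.≤ k → S n (e j) ≡ 0ℚ
    S-behind (suc n) j (s≤s j≤n) n<k with j ℕ.≟ n
    ... | yes refl = S-at n n<k
    ... | no j≢n   = trans
      (+-*-0 {S n (e j)} {coeff n} (chordless n j n<k (ℕ.≤-trans j≤n (ℕ.<⇒≤ n<k)) j≢n (λ { refl → ℕ.<-irrefl refl j≤n })))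
      (S-behind n j (ℕ.≤∧≢⇒< j≤n j≢n) (ℕ.<⇒≤ n<k))

    -- By triangularity of the rows e 0 , … , e (k ∸ 1).
    unique : ∀ (q : Fin (suc s) → ℚ) → q zero ≡ 0ℚ →
             (∀ x → (∀ i → i ℕ.< k → c i ≢ x) → q (suc x) ≡ 0ℚ) →
             (∀ j → j ℕ.< k → ((a ◂ M) ·ᵛ q) (e j) ≡ 0ℚ) →
             ∀ n → n ℕ.≤ k → ∀ j → j ℕ.< n → q (suc (c j)) ≡ 0ℚ
    unique q q₀ out rows (suc n) n<k j (s≤s j≤n) with j ℕ.≟ n
    ... | no j≢n   = unique q q₀ out rows n (ℕ.<⇒≤ n<k) j (ℕ.≤∧≢⇒< j≤n j≢n)
    ... | yes refl = *-cancel-0 (lower n n<k) (trans (sym (sum-single (suc (c n)) others)) (rows n n<k))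
      where
      *-0 : ∀ m {q} → q ≡ 0ℚ → m * q ≡ 0ℚ
      *-0 m refl = ℚ.*-zeroʳ m
      others : ∀ x → x ≢ suc (c n) → (a ◂ M) (e n) x * q x ≡ 0ℚ
      others zero    _  = *-0 (a (e n)) q₀
      others (suc x) x≢ with ℕ.anyUpTo? (λ i → c i Fin.≟ x) k
      ... | no none = *-0 (M (e n) x) (out x (λ i i<k eq → none (i , i<k , eq)))
      ... | yes (i , i<k , refl) with ℕ.<-cmp i n
      ...   | tri< i<n _ _  = *-0 (M (e n) x) (unique q q₀ out rows n (ℕ.<⇒≤ n<k) i i<n)
      ...   | tri≈ _ refl _ = contradiction refl x≢
      ...   | tri> _ _ n<i  = trans (cong (_* q (suc x)) (chordless i n i<k (ℕ.<⇒≤ n<k)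
                (λ { refl → ℕ.<-irrefl refl n<i }) (λ { refl → ℕ.<-asym n<i ℕ.≤-refl }))) (ℚ.*-zeroˡ (q (suc x)))

    -- Up to a scalar, `μ k` is the only vector on its columns whose image vanishes on `e 0` , ... ,
    -- `e (k ∸ 1)`. So the circuit provided by regularity is `η₀` times `μ k` with `η₀` a sign, and
    -- the image of `μ k` at `e k` is ternary because that of the circuit is.
    closing-ternary : Regular (a ◂ M) → Ternary (S k (e k))
    closing-ternary reg = subst Ternary ηη (ternary-* (C.ternary zero) (subst Ternary image (C.ternary·ᵛ (e k))))
      where
      module C = Circuit (reg (μ k) (zero , λ eq → 0≢1 (trans (sym eq) (μ-zero k))))
      η₀ = C.η zero
      -- Cancelling the entry at the new column leaves a vector that `unique` forces to be 0.
      q : Fin (suc s) → ℚ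
      q x = C.η x + - η₀ * μ k x
      ·ᵛ-q : ∀ b → ((a ◂ M) ·ᵛ q) b ≡ ((a ◂ M) ·ᵛ C.η) b + - η₀ * S k b
      ·ᵛ-q b = trans (·ᵛ-linear (a ◂ M) C.η (μ k) (- η₀) b) (cong (λ t → ((a ◂ M) ·ᵛ C.η) b + - η₀ * t) (·ᵛ-μ k b))
      cancel : ∀ p → p + - p * 1ℚ ≡ 0ℚ
      cancel = solve-∀ ringℚ
      q-zero : q zero ≡ 0ℚ
      q-zero = trans (cong (λ t → η₀ + - η₀ * t) (μ-zero k)) (cancel η₀)
      vanish : ∀ {p t} → p ≡ 0ℚ → t ≡ 0ℚ → p + - η₀ * t ≡ 0ℚ
      vanish refl refl = trans (ℚ.+-identityˡ (- η₀ * 0ℚ)) (ℚ.*-zeroʳ (- η₀))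
      q-out : ∀ x → (∀ i → i ℕ.< k → c i ≢ x) → q (suc x) ≡ 0ℚ
      q-out x out = vanish (C.support (suc x) (μ-support k x out)) (μ-support k x out)
      q-rows : ∀ j → j ℕ.< k → ((a ◂ M) ·ᵛ q) (e j) ≡ 0ℚ
      q-rows j j<k = trans (·ᵛ-q (e j)) (vanish (C.image (e j) (trans (·ᵛ-μ k (e j)) Sj≡0)) Sj≡0)
        where
        Sj≡0 = S-behind k j j<k ℕ.≤-refl
      q≡0 : ∀ x → q x ≡ 0ℚ
      q≡0 zero    = q-zero
      q≡0 (suc x) with ℕ.anyUpTo? (λ i → c i Fin.≟ x) k
      ... | no none = q-out x (λ i i<k eq → none (i , i<k , eq))
      ... | yes (i , i<k , refl) = unique q q-zero q-out q-rows k ℕ.≤-refl i i<k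
      shift : ∀ {p t} → p + - η₀ * t ≡ 0ℚ → p ≡ η₀ * t
      shift {p} {t} eq = p-q≡0⇒p≡q (trans (cong (p +_) (ℚ.neg-distribˡ-* η₀ t)) eq)
      η≡ : ∀ x → C.η x ≡ η₀ * μ k x
      η≡ x = shift (q≡0 x)
      image : ((a ◂ M) ·ᵛ C.η) (e k) ≡ η₀ * S k (e k)
      image = shift (trans (sym (·ᵛ-q (e k))) (sum-zero (λ x → trans (cong ((a ◂ M) (e k) x *_) (q≡0 x)) (ℚ.*-zeroʳ ((a ◂ M) (e k) x)))))
      η₀≢0 : η₀ ≢ 0ℚ
      η₀≢0 eq = proj₂ C.nonzero (trans (η≡ _) (trans (cong (_* μ k (proj₁ C.nonzero)) eq) (ℚ.*-zeroˡ (μ k (proj₁ C.nonzero)))))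
      ηη : η₀ * (η₀ * S k (e k)) ≡ S k (e k)
      ηη = trans (sym (ℚ.*-assoc η₀ η₀ (S k (e k))))
                 (trans (cong (_* S k (e k)) (ternary-square (C.ternary zero) η₀≢0)) (ℚ.*-identityˡ _))

-- The inductive situation: two regular matrices that differ in one column only, with equal support
-- there. Signs are sought that turn `a` into `a′` and fix `M`.
module Switching {r s} (M : Matrix r s) (ternaryM : ∀ b c → Ternary (M b c))
  (a a′ : Fin r → ℚ) (ternary-a : ∀ b → Ternary (a b)) (ternary-a′ : ∀ b → Ternary (a′ b))
  (a⇒a′ : ∀ b → a b ≡ 0ℚ → a′ b ≡ 0ℚ) (a′⇒a : ∀ b → a′ b ≡ 0ℚ → a b ≡ 0ℚ)
  (regular : Regular (a ◂ M)) (regular′ : Regular (a′ ◂ M)) where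

  Agree Disagree : Fin r → Set
  Agree    b = a b ≢ 0ℚ × a′ b ≡ a b
  Disagree b = a b ≢ 0ℚ × a′ b ≡ - a b

  agree? : ∀ b → a b ≢ 0ℚ → Agree b ⊎ Disagree b
  agree? b ab≢0 with ternary-a b | ternary-a′ b
  ... | inj₁ ab≡0        | _                = contradiction ab≡0 ab≢0
  ... | inj₂ _           | inj₁ a′b≡0       = contradiction (a′⇒a b a′b≡0) ab≢0
  ... | inj₂ (inj₁ p)    | inj₂ (inj₁ p′)   = inj₁ (ab≢0 , trans p′ (sym p))
  ... | inj₂ (inj₁ p)    | inj₂ (inj₂ p′)   = inj₂ (ab≢0 , trans p′ (cong -_ (sym p)))
  ... | inj₂ (inj₂ p)    | inj₂ (inj₁ p′)   = inj₂ (ab≢0 , trans p′ (cong -_ (sym p)))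
  ... | inj₂ (inj₂ p)    | inj₂ (inj₂ p′)   = inj₁ (ab≢0 , trans p′ (sym p))

  ¬agree∧disagree : ∀ {b} → Agree b → Disagree b → ⊥
  ¬agree∧disagree {b} (ab≢0 , p) (_ , p′) with ternary-a b
  ... | inj₁ ab≡0      = ab≢0 ab≡0
  ... | inj₂ (inj₁ ab) = case (trans (sym ab) (trans (trans (sym p) p′) (cong -_ ab)))
    where
    case : 1ℚ ≢ - 1ℚ
    case ()
  ... | inj₂ (inj₂ ab) = case (trans (sym ab) (trans (trans (sym p) p′) (cong -_ ab)))
    where
    case : - 1ℚ ≢ - (- 1ℚ)
    case ()

  -- A walk through n columns in the bipartite incidence graph of `M`, from row b to a disagreeing
  -- row.
  data Path : ℕ → Fin r → Set where
    stop : ∀ {b} → Disagree b → Path 0 b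
    step : ∀ {n b b′} c → M b c ≢ 0ℚ → M b′ c ≢ 0ℚ → Path n b′ → Path (suc n) b

  -- `Chordless` takes total functions on ℕ: beyond the end of the path `row` repeats the last row
  -- and `col` returns the default d.
  row : ∀ {n b} → Path n b → ℕ → Fin r
  row {b = b} p              zero    = b
  row {b = b} (stop _)       (suc i) = b
  row         (step _ _ _ p) (suc i) = row p i

  col : ∀ {n b} → Fin s → Path n b → ℕ → Fin s
  col d (stop _)       i       = d
  col d (step c _ _ p) zero    = c
  col d (step c _ _ p) (suc i) = col d p i

  lower : ∀ {n b} d (p : Path n b) i → i ℕ.< n → M (row p i) (col d p i) ≢ 0ℚ
  lower d (step c x y p) zero    _         = x
  lower d (step c x y p) (suc i) (s≤s i<n) = lower d p i i<n

  upper : ∀ {n b} d (p : Path n b) i → i ℕ.< n → M (row p (suc i)) (col d p i) ≢ 0ℚ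
  upper d (step c x y p) zero    _         = y
  upper d (step c x y p) (suc i) (s≤s i<n) = upper d p i i<n

  last : ∀ {n b} (p : Path n b) → Disagree (row p n)
  last (stop x)       = x
  last (step _ _ _ p) = last p

  suffix : ∀ {n b} (p : Path n b) i → i ℕ.≤ n → Path (n ℕ.∸ i) (row p i)
  suffix p              zero    _         = p
  suffix (step _ _ _ p) (suc i) (s≤s i≤n) = suffix p i i≤n

  glue : ∀ {n m b} (p : Path n b) i → i ℕ.≤ n → Path m (row p i) → Path (i ℕ.+ m) b
  glue p              zero    _         q = q
  glue (step c x y p) (suc i) (s≤s i≤n) q = step c x y (glue p i i≤n q)

  private
    shortcut : ∀ {i j k} → suc i ℕ.< j → j ℕ.≤ k → i ℕ.+ suc (k ℕ.∸ j) ℕ.< k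
    shortcut {i} {j} {k} 1+i<j j≤k = begin-strict
      i ℕ.+ suc (k ℕ.∸ j) ≡⟨ ℕ.+-suc i (k ℕ.∸ j) ⟩
      suc i ℕ.+ (k ℕ.∸ j) <⟨ ℕ.+-monoˡ-< (k ℕ.∸ j) 1+i<j ⟩
      j ℕ.+ (k ℕ.∸ j)     ≡⟨ ℕ.m+[n∸m]≡n j≤k ⟩
      k                   ∎
      where open ℕ.≤-Reasoning

    parity : ∀ {x t} → Ternary x → Ternary t → x ≢ 0ℚ → t ≢ 0ℚ → Ternary (t + x) → Ternary (- t + x) → ⊥
    parity (inj₁ refl) _ x≢0 _ _ _ = x≢0 refl
    parity (inj₂ _) (inj₁ refl) _ t≢0 _ _ = t≢0 refl
    parity (inj₂ (inj₁ refl)) (inj₂ (inj₁ refl)) _ _ (inj₁ ()) _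
    parity (inj₂ (inj₁ refl)) (inj₂ (inj₁ refl)) _ _ (inj₂ (inj₁ ())) _
    parity (inj₂ (inj₁ refl)) (inj₂ (inj₁ refl)) _ _ (inj₂ (inj₂ ())) _
    parity (inj₂ (inj₂ refl)) (inj₂ (inj₂ refl)) _ _ (inj₁ ()) _
    parity (inj₂ (inj₂ refl)) (inj₂ (inj₂ refl)) _ _ (inj₂ (inj₁ ())) _
    parity (inj₂ (inj₂ refl)) (inj₂ (inj₂ refl)) _ _ (inj₂ (inj₂ ())) _
    parity (inj₂ (inj₁ refl)) (inj₂ (inj₂ refl)) _ _ _ (inj₁ ())
    parity (inj₂ (inj₁ refl)) (inj₂ (inj₂ refl)) _ _ _ (inj₂ (inj₁ ()))
    parity (inj₂ (inj₁ refl)) (inj₂ (inj₂ refl)) _ _ _ (inj₂ (inj₂ ()))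
    parity (inj₂ (inj₂ refl)) (inj₂ (inj₁ refl)) _ _ _ (inj₁ ())
    parity (inj₂ (inj₂ refl)) (inj₂ (inj₁ refl)) _ _ _ (inj₂ (inj₁ ()))
    parity (inj₂ (inj₂ refl)) (inj₂ (inj₁ refl)) _ _ _ (inj₂ (inj₂ ()))

  -- A shortest path from an agreeing to a disagreeing row would close up to a chordless
  -- cycle whose sum over a differs by 2 from its sum over a′.
  no-path : ∀ N k → k ℕ.< N → ∀ {b} → Agree b → Path k b → ⊥
  no-path (suc N) zero    _           agree (stop disagree) = ¬agree∧disagree agree disagree
  no-path (suc N) (suc n) (s≤s k≤N) {b} agree p@(step d _ _ _) =
    -- The chain of columns contributes the same x at the closing row for `a` and for `a′`, which
    -- agree at the start, whereas their own entries there are opposite, t and - t. With t and x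
    -- signs, t + x and - t + x are not both ternary.
    parity ternary-x (ternary-a (ρ k)) x≢0 (proj₁ (last p))
      (subst Ternary (A.S-front n ℕ.≤-refl) (A.closing-ternary regular))
      (subst Ternary (trans (A′.S-front n ℕ.≤-refl) (cong (_+ coeff n * M (ρ k) (c n)) (proj₂ (last p)))) (A′.closing-ternary regular′))
    where
    k = suc n
    ρ = row p
    c = col d p
    IH : ∀ {j} → j ℕ.< k → ∀ {b} → Agree b → Path j b → ⊥
    IH j<k = no-path N _ (ℕ.<-≤-trans j<k k≤N)
    -- A nonzero entry of column `c i` in a third row `ρ j` is a shortcut, from `ρ j` to `ρ (suc i)`
    -- or from `ρ i` to `ρ j`, and `IH` excludes the shorter path.
    chordless : ∀ i j → i ℕ.< k → j ℕ.≤ k → j ≢ i → j ≢ suc i → M (ρ j) (c i) ≡ 0ℚ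
    chordless i j i<k j≤k j≢i j≢1+i with M (ρ j) (c i) ℚ.≟ 0ℚ
    ... | yes eq = eq
    ... | no ≢0 with ℕ.<-cmp j i
    ...   | tri< j<i _ _ = ⊥-elim (IH (shortcut (s≤s j<i) i<k) agree
              (glue p j j≤k (step (c i) ≢0 (upper d p i i<k) (suffix p (suc i) i<k))))
    ...   | tri≈ _ j≡i _ = contradiction j≡i j≢i
    ...   | tri> _ _ i<j = ⊥-elim (IH (shortcut (ℕ.≤∧≢⇒< i<j (j≢1+i ∘ sym)) j≤k) agree
              (glue p i (ℕ.<⇒≤ i<k) (step (c i) (lower d p i i<k) ≢0 (suffix p j j≤k))))
    -- An inner row in the support of `a` either agrees, and starts a shorter path, or disagrees,
    -- and ends one.
    middle : ∀ j → 0 ℕ.< j → j ℕ.< k → a (ρ j) ≡ 0ℚ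
    middle j 0<j j<k with a (ρ j) ℚ.≟ 0ℚ
    ... | yes eq = eq
    ... | no ≢0 with agree? (ρ j) ≢0
    ...   | inj₁ agree-j    = ⊥-elim (IH (ℕ.∸-monoʳ-< 0<j (ℕ.<⇒≤ j<k)) agree-j (suffix p j (ℕ.<⇒≤ j<k)))
    ...   | inj₂ disagree-j = ⊥-elim (IH (subst (ℕ._< k) (sym (ℕ.+-identityʳ j)) j<k) agree
                                         (glue p j (ℕ.<⇒≤ j<k) (stop disagree-j)))
    open Chordless M ternaryM ρ c k (lower d p) chordless (a b)
    module A  = Column a refl middle
    module A′ = Column a′ (proj₂ agree) (λ j 0<j j<k → a⇒a′ (ρ j) (middle j 0<j j<k))
    neg≢0 : ∀ {q} → q ≢ 0ℚ → - q ≢ 0ℚ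
    neg≢0 q≢0 eq = q≢0 (ℚ.neg-injective eq)
    *≢0 : ∀ {p q} → p ≢ 0ℚ → q ≢ 0ℚ → p * q ≢ 0ℚ
    *≢0 p≢0 q≢0 eq = q≢0 (*-cancel-0 p≢0 eq)
    ternary-coeff : ∀ i → Ternary (coeff i)
    ternary-coeff zero    = ternary-neg (ternary-* (ternary-a b) (ternaryM (ρ 0) (c 0)))
    ternary-coeff (suc i) = ternary-neg (ternary-* (ternary-* (ternary-coeff i) (ternaryM (ρ (suc i)) (c i)))
                                                   (ternaryM (ρ (suc i)) (c (suc i))))
    coeff≢0 : ∀ i → i ℕ.< k → coeff i ≢ 0ℚ
    coeff≢0 zero    i<k = neg≢0 (*≢0 (proj₁ agree) (lower d p 0 i<k))
    coeff≢0 (suc i) i<k = neg≢0 (*≢0 (*≢0 (coeff≢0 i i<k′) (upper d p i i<k′)) (lower d p (suc i) i<k))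
      where
      i<k′ = ℕ.<-trans ℕ.≤-refl i<k
    ternary-x : Ternary (coeff n * M (ρ k) (c n))
    ternary-x = ternary-* (ternary-coeff n) (ternaryM (ρ k) (c n))
    x≢0 : coeff n * M (ρ k) (c n) ≢ 0ℚ
    x≢0 = *≢0 (coeff≢0 n ℕ.≤-refl) (upper d p n ℕ.≤-refl)

  Flipped : Fin r → Set
  Flipped b = ∃ λ n → Path n b

  -- Change the signs of exactly those rows and columns that are connected to a disagreeing row. A
  -- nonzero entry of `M` has row and column in one component and so gets two equal signs; by
  -- `no-path` no agreeing row changes. Connectedness is decided by excluded middle, hence the
  -- double negation.
  switch : ¬ ¬ (Σ (Fin r → Bool) λ ε → Σ (Fin s → Bool) λ δ →
             (∀ b → a′ b ≡ sgn (ε b) * a b) × (∀ b c → M b c ≡ sgn (ε b) * (sgn (δ c) * M b c)))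
  switch k = ¬¬-∀ {P = λ b → Dec (Flipped b)} (λ b → ¬¬-excluded-middle) λ flipped? →
    let
      ε : Fin r → Bool
      ε b = not (does (flipped? b))
      hit? : ∀ c → Dec (∃ λ b → Flipped b × M b c ≢ 0ℚ)
      hit? c = Fin.any? (λ b → flipped? b ×-dec ¬? (M b c ℚ.≟ 0ℚ))
      δ : Fin s → Bool
      δ c = not (does (hit? c))
      col-a : ∀ b → a′ b ≡ sgn (ε b) * a b
      col-a b = col-a′ b (flipped? b)
      col-M : ∀ b c → M b c ≡ sgn (ε b) * (sgn (δ c) * M b c)
      col-M b c = col-M′ b c (flipped? b) (hit? c)
    in k (ε , δ , col-a , col-M)
    where
    -1* : ∀ q → - 1ℚ * q ≡ - q
    -1* = solve-∀ ringℚ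
    col-a′ : ∀ b (F? : Dec (Flipped b)) → a′ b ≡ sgn (not (does F?)) * a b
    col-a′ b F? with a b ℚ.≟ 0ℚ
    ... | yes ab≡0 = trans (a⇒a′ b ab≡0) (sym (trans (cong (sgn (not (does F?)) *_) ab≡0) (ℚ.*-zeroʳ (sgn (not (does F?))))))
    ... | no ab≢0 with agree? b ab≢0 | F?
    ...   | inj₁ (_ , eq) | no _        = trans eq (sym (ℚ.*-identityˡ (a b)))
    ...   | inj₁ agree    | yes (n , p) = ⊥-elim (no-path (suc n) n ℕ.≤-refl agree p)
    ...   | inj₂ disagree | no ¬F       = contradiction (0 , stop disagree) ¬F
    ...   | inj₂ (_ , eq) | yes _       = trans eq (sym (-1* (a b)))
    col-M′ : ∀ b c (F? : Dec (Flipped b)) (H? : Dec (∃ λ b → Flipped b × M b c ≢ 0ℚ)) →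
             M b c ≡ sgn (not (does F?)) * (sgn (not (does H?)) * M b c)
    col-M′ b c F? H? with M b c ℚ.≟ 0ℚ
    ... | yes eq = trans eq (sym (trans (cong (λ t → sgn (not (does F?)) * (sgn (not (does H?)) * t)) eq)
                                        (trans (cong (sgn (not (does F?)) *_) (ℚ.*-zeroʳ (sgn (not (does H?))))) (ℚ.*-zeroʳ (sgn (not (does F?)))))))
    ... | no ≢0 with F? | H?
    ...   | yes _       | yes _                    = sym (sgn-cancel false (M b c))
    ...   | no _        | no _                     = sym (sgn-cancel true (M b c))
    ...   | yes F       | no ¬H                    = contradiction (b , F , ≢0) ¬H
    ...   | no ¬F       | yes (b′ , (n , p) , ≢0′) = contradiction (suc n , step c ≢0 ≢0′ p) ¬F

-- Camion's uniqueness of signings, by induction on the columns: signs match the tails, the row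
-- signs are applied to the first column of `D′`, and `Switching` repairs that column by signs that
-- fix the tail.
camion : ∀ {r s} (D D′ : Matrix r s) →
  (∀ b c → Ternary (D b c)) → (∀ b c → Ternary (D′ b c)) →
  (∀ b c → D b c ≡ 0ℚ → D′ b c ≡ 0ℚ) → (∀ b c → D′ b c ≡ 0ℚ → D b c ≡ 0ℚ) →
  Regular D → Regular D′ →
  ¬ ¬ (Σ (Fin r → Bool) λ ε → Σ (Fin s → Bool) λ δ → ∀ b c → D′ b c ≡ sgn (ε b) * (sgn (δ c) * D b c))
camion {s = zero}  D D′ _ _ _ _ _ _ k = k ((λ _ → true) , (λ ()) , λ _ ())
camion {r} {suc s} D D′ ternary ternary′ D⇒D′ D′⇒D reg reg′ k =
  camion (λ b c → D b (suc c)) (λ b c → D′ b (suc c)) (λ b c → ternary b (suc c)) (λ b c → ternary′ b (suc c))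
    (λ b c → D⇒D′ b (suc c)) (λ b c → D′⇒D b (suc c)) (Regular-tail D reg) (Regular-tail D′ reg′)
  λ { (ε , δ , D′≡) →
    let
      a : Fin r → ℚ
      a b = D b zero
      a′ : Fin r → ℚ
      a′ b = sgn (ε b) * D′ b zero
      M : Matrix r s
      M b c = D b (suc c)
      δ⁺ : Fin (suc s) → Bool
      δ⁺ = Fin.∀-cons true δ
      -- `a′ ◂ M` inherits regularity from `D′`, of which it is a switching: signs are their own
      -- inverses, so `D′≡` can be read backwards.
      back : ∀ b c → (a′ ◂ M) b c ≡ sgn (ε b) * (sgn (δ⁺ c) * D′ b c)
      back b = Fin.∀-cons (cong (sgn (ε b) *_) (sym (ℚ.*-identityˡ (D′ b zero)))) (λ c →
        sym (trans (cong (λ t → sgn (ε b) * (sgn (δ c) * t)) (D′≡ b c)) (swap-cancel (ε b) (δ c) (D b (suc c)))))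
      same : ∀ b c → (a ◂ M) b c ≡ sgn true * (sgn true * D b c)
      same b = Fin.∀-cons (sym (sgn-cancel true (D b zero))) (λ c → sym (sgn-cancel true (D b (suc c))))
      a≡0⇒ : ∀ b → a b ≡ 0ℚ → a′ b ≡ 0ℚ
      a≡0⇒ b eq = trans (cong (sgn (ε b) *_) (D⇒D′ b zero eq)) (ℚ.*-zeroʳ (sgn (ε b)))
    in Switching.switch M (λ b c → ternary b (suc c)) a a′ (λ b → ternary b zero)
         (λ b → ternary-* (sgn-ternary (ε b)) (ternary′ b zero))
         a≡0⇒ (λ b eq → D′⇒D b zero (*-cancel-0 (sgn≢0 (ε b)) eq))
         (Regular-switch D (a ◂ M) (λ _ → true) (λ _ → true) same reg)
         (Regular-switch D′ (a′ ◂ M) ε δ⁺ back reg′)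
    λ { (ε₂ , δ₂ , a′≡ , M≡) →
      k ( (λ b → ε b ⊙ ε₂ b) , Fin.∀-cons true (λ c → δ c ⊙ δ₂ c)
        , λ b → Fin.∀-cons (first (ε b) (ε₂ b) (a′≡ b))
                           (λ c → rest (ε b) (ε₂ b) (δ c) (δ₂ c) (D′≡ b c) (M≡ b c)) ) } }
  where
  first : ∀ x x₂ {d′ d} → sgn x * d′ ≡ sgn x₂ * d → d′ ≡ sgn (x ⊙ x₂) * (1ℚ * d)
  first x x₂ {d′} {d} eq = trans (sym (sgn-cancel x d′)) (trans (cong (sgn x *_) eq)
    (trans (rearrange (sgn x) (sgn x₂) d) (cong (_* (1ℚ * d)) (sym (sgn-⊙ x x₂)))))
    where
    rearrange : ∀ x x₂ d → x * (x₂ * d) ≡ x * x₂ * (1ℚ * d)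
    rearrange = solve-∀ ringℚ
  rest : ∀ x x₂ y y₂ {d′ d} → d′ ≡ sgn x * (sgn y * d) → d ≡ sgn x₂ * (sgn y₂ * d) →
         d′ ≡ sgn (x ⊙ x₂) * (sgn (y ⊙ y₂) * d)
  rest x x₂ y y₂ {d′} {d} eq₁ eq₂ = trans eq₁ (trans (cong (λ t → sgn x * (sgn y * t)) eq₂)
    (trans (rearrange (sgn x) (sgn x₂) (sgn y) (sgn y₂) d)
           (sym (cong₂ (λ s t → s * (t * d)) (sgn-⊙ x x₂) (sgn-⊙ y y₂)))))
    where
    rearrange : ∀ x x₂ y y₂ d → x * (y * (x₂ * (y₂ * d))) ≡ x * x₂ * (y * y₂ * d)
    rearrange = solve-∀ ringℚ

-- Regular chain groups

record Elementary {m} (Z : (Fin m → ℚ) → Set) (z : Fin m → ℚ) : Set where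
  field
    y       : Fin m → ℚ
    y∈Z     : Z y
    ternary : ∀ k → Ternary (y k)
    nonzero : ∃ λ k → y k ≢ 0ℚ
    support : ∀ k → z k ≡ 0ℚ → y k ≡ 0ℚ

record ChainGroup (m : ℕ) : Set₁ where
  field
    Z          : (Fin m → ℚ) → Set
    Z-resp     : ∀ {u v} → u ≋ v → Z u → Z v
    Z-zero     : Z (λ _ → 0ℚ)
    Z-linear   : ∀ {u v} t → Z u → Z v → Z (λ k → u k + t * v k)
    elementary : ∀ {z} → Z z → (∃ λ k → z k ≢ 0ℚ) → Elementary Z z

  Z-scale : ∀ {u} t → Z u → Z (λ k → t * u k)
  Z-scale {u} t Zu = Z-resp (λ k → ℚ.+-identityˡ (t * u k)) (Z-linear t Z-zero Zu)

  Z-sum : ∀ {n} (t : Fin n → ℚ) (Y : Fin n → Fin m → ℚ) → (∀ c → Z (Y c)) → Z (λ k → sumF (λ c → t c * Y c k))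
  Z-sum {zero}  t Y Y∈Z = Z-zero
  Z-sum {suc n} t Y Y∈Z = Z-resp
    (λ k → trans (cong (_+ t zero * Y zero k) (ℚ.*-identityˡ (rest k))) (ℚ.+-comm (rest k) (t zero * Y zero k)))
    (Z-linear (t zero) (Z-scale 1ℚ (Z-sum (t ∘ suc) (Y ∘ suc) (Y∈Z ∘ suc))) (Y∈Z zero))
    where
    rest : Fin m → ℚ
    rest k = sumF (λ c → t (suc c) * Y (suc c) k)

-- Dependent sets appear as supports.  The double negation is all that can be had from an
-- isomorphism of matroids, because Independent is a negation.
Dependents⊆ : ∀ {m} → ChainGroup m → ChainGroup m → Set
Dependents⊆ {m} S S′ = ∀ z → ChainGroup.Z S z → (∃ λ k → z k ≢ 0ℚ) →
  ¬ ¬ (Σ (Fin m → ℚ) λ z′ → ChainGroup.Z S′ z′ × (∃ λ k → z′ k ≢ 0ℚ) × (∀ k → z k ≡ 0ℚ → z′ k ≡ 0ℚ))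

module Basis {m} (S : ChainGroup m) where
  open ChainGroup S

  Outside : (Fin m → Bool) → (Fin m → ℚ) → Set
  Outside B z = ∀ k → B k ≡ false → z k ≡ 0ℚ

  Outside-except : (Fin m → Bool) → Fin m → (Fin m → ℚ) → Set
  Outside-except B c z = ∀ k → B k ≡ false → k ≢ c → z k ≡ 0ℚ

  -- Independence of B in the matroid of the chain group. `Spans B c` puts c in the closure of B, so
  -- a free set that spans its complement is a basis.
  Free : (Fin m → Bool) → Set
  Free B = ∀ z → Z z → Outside B z → ∀ k → z k ≡ 0ℚ

  Spans : (Fin m → Bool) → Fin m → Set
  Spans B c = Σ (Fin m → ℚ) λ y → Z y × y c ≢ 0ℚ × Outside-except B c y

  private
    -- The greedy algorithm along the ground set. An element l not spanned by B may be added: a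
    -- chain on B and l that is nonzero at l would witness `Spans B l`. Each choice is by excluded
    -- middle.
    greedy : ∀ n → n ℕ.≤ m →
      ¬ ¬ (Σ (Fin m → Bool) λ B → Free B × (∀ c → toℕ c ℕ.< n → B c ≡ false → Spans B c))
    greedy zero    _   k = k ((λ _ → false) , (λ z _ out j → out j refl) , λ _ ())
    greedy (suc n) n<m k = greedy n (ℕ.<⇒≤ n<m) λ { (B , free , spans) →
      ¬¬-excluded-middle {A = Spans B l} λ
        { (yes s) → k (B , free , keep B spans s)
        ; (no ¬s) → k (insert B , insert-free B free ¬s , insert-spans B spans) } }
      where
      l = fromℕ< n<m
      insert : (Fin m → Bool) → Fin m → Bool
      insert B k = if does (l Fin.≟ k) then true else B k
      insert-false : ∀ B k → insert B k ≡ false → l ≢ k × B k ≡ false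
      insert-false B k eq with l Fin.≟ k
      ... | yes _  = contradiction eq λ ()
      ... | no l≢k = l≢k , eq
      insert-out : ∀ B k → l ≢ k → B k ≡ false → insert B k ≡ false
      insert-out B k l≢k eq with l Fin.≟ k
      ... | yes l≡k = contradiction l≡k l≢k
      ... | no _    = eq
      before : ∀ c → toℕ c ℕ.< suc n → l ≢ c → toℕ c ℕ.< n
      before c (s≤s c≤n) l≢c = ℕ.≤∧≢⇒< c≤n (λ eq → l≢c (Fin.toℕ-injective (trans (Fin.toℕ-fromℕ< n<m) (sym eq))))
      keep : ∀ B → (∀ c → toℕ c ℕ.< n → B c ≡ false → Spans B c) → Spans B l →
             ∀ c → toℕ c ℕ.< suc n → B c ≡ false → Spans B c
      keep B spans s c c<1+n out with l Fin.≟ c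
      ... | yes refl = s
      ... | no l≢c   = spans c (before c c<1+n l≢c) out
      insert-free : ∀ B → Free B → ¬ Spans B l → Free (insert B)
      insert-free B free ¬s z Zz out = free z Zz out′
        where
        off : ∀ k → B k ≡ false → k ≢ l → z k ≡ 0ℚ
        off k Bk k≢l = out k (insert-out B k (k≢l ∘ sym) Bk)
        out′ : Outside B z
        out′ k Bk with k Fin.≟ l
        ... | no k≢l = off k Bk k≢l
        ... | yes refl with z l ℚ.≟ 0ℚ
        ...   | yes zl≡0 = zl≡0
        ...   | no zl≢0  = contradiction (z , Zz , zl≢0 , off) ¬s
      insert-spans : ∀ B → (∀ c → toℕ c ℕ.< n → B c ≡ false → Spans B c) →
                     ∀ c → toℕ c ℕ.< suc n → insert B c ≡ false → Spans (insert B) c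
      insert-spans B spans c c<1+n out =
        let l≢c , Bc = insert-false B c out
            y , Zy , yc≢0 , off = spans c (before c c<1+n l≢c) Bc
        in y , Zy , yc≢0 , λ k out → off k (proj₂ (insert-false B k out))

  basis : ¬ ¬ (Σ (Fin m → Bool) λ B → Free B × (∀ c → B c ≡ false → Spans B c))
  basis k = greedy m ℕ.≤-refl λ { (B , free , spans) → k (B , free , λ c → spans c (Fin.toℕ<n c)) }

  -- `Y c` is the fundamental circuit of c over the basis, scaled to 1 at c. For c in B it is set to
  -- 0, so that rows and columns both range over `Fin m`.
  record Frame (B : Fin m → Bool) : Set where
    field
      free      : Free B
      Y         : Fin m → Fin m → ℚ
      Y∈Z       : ∀ c → Z (Y c)
      Y-ternary : ∀ c k → Ternary (Y c k)
      Y-inside  : ∀ c → B c ≡ true → ∀ k → Y c k ≡ 0ℚ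
      Y-diag    : ∀ c → B c ≡ false → Y c c ≡ 1ℚ
      Y-off     : ∀ c → Outside-except B c (Y c)

    multiple : ∀ c → B c ≡ false → ∀ z → Z z → Outside-except B c z → ∀ k → z k ≡ z c * Y c k
    multiple c Bc z Zz off k = p-q≡0⇒p≡q (trans (cong (z k +_) (ℚ.neg-distribˡ-* (z c) (Y c k)))
      (free (λ k → z k + - z c * Y c k) (Z-linear (- z c) Zz (Y∈Z c)) out k))
      where
      cancel : ∀ p → p + - p * 1ℚ ≡ 0ℚ
      cancel = solve-∀ ringℚ
      out : Outside B (λ k → z k + - z c * Y c k)
      out k Bk with k Fin.≟ c
      ... | yes refl = trans (cong (λ t → z c + - z c * t) (Y-diag c Bc)) (cancel (z c))
      ... | no k≢c   = trans (cong₂ (λ s t → s + - z c * t) (off k Bk k≢c) (Y-off c k Bk k≢c))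
                             (trans (ℚ.+-identityˡ (- z c * 0ℚ)) (ℚ.*-zeroʳ (- z c)))

    sum-outside : ∀ (t : Fin m → ℚ) k → B k ≡ false → sumF (λ c → t c * Y c k) ≡ t k
    sum-outside t k Bk = trans
      (sum-single k (λ c c≢k → trans (cong (t c *_) (Y-off c k Bk (c≢k ∘ sym))) (ℚ.*-zeroʳ (t c))))
      (trans (cong (t k *_) (Y-diag k Bk)) (ℚ.*-identityʳ (t k)))

    expand : ∀ z → Z z → ∀ k → z k ≡ sumF (λ c → z c * Y c k)
    expand z Zz k = p-q≡0⇒p≡q (trans (cong (z k +_) (neg (sumF (λ c → z c * Y c k)))) (free q
      (Z-linear (- 1ℚ) Zz (Z-sum z Y Y∈Z)) out k))
      where
      neg : ∀ p → - p ≡ - 1ℚ * p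
      neg = solve-∀ ringℚ
      cancel : ∀ p → p + - 1ℚ * p ≡ 0ℚ
      cancel = solve-∀ ringℚ
      q : Fin m → ℚ
      q k = z k + - 1ℚ * sumF (λ c → z c * Y c k)
      out : Outside B q
      out k Bk = trans (cong (λ t → z k + - 1ℚ * t) (sum-outside z k Bk)) (cancel (z k))

    -- The standard representation of the matroid over the basis, padded to a square: columns in B
    -- are 0, and the remaining columns have an identity block in the rows outside B.
    matrix : Matrix m m
    matrix b c = Y c b

    private
      ·ᵛ-comm : ∀ ζ b → (matrix ·ᵛ ζ) b ≡ sumF (λ c → ζ c * Y c b)
      ·ᵛ-comm ζ b = sum-cong (λ c → ℚ.*-comm (Y c b) (ζ c))

    matrix-regular : Regular matrix
    -- If ζ touches a column in B, the unit vector there is a circuit with image 0.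
    matrix-regular ζ (c₀ , ζc₀≢0) with Fin.any? (λ c → (B c Bool.≟ true) ×-dec ¬? (ζ c ℚ.≟ 0ℚ))
    ... | yes (c , Bc , ζc≢0) = record
      { η         = unit c
      ; nonzero   = c , λ eq → 0≢1 (trans (sym eq) (unit-same c))
      ; support   = λ x ζx≡0 → unit-other {u = c} λ { refl → ζc≢0 ζx≡0 }
      ; image     = λ b _ → image b
      ; ternary   = unit-ternary c
      ; ternary·ᵛ = λ b → inj₁ (image b)
      }
      where
      image : ∀ b → (matrix ·ᵛ unit c) b ≡ 0ℚ
      image b = trans (·ᵛ-unit matrix c b) (Y-inside c Bc b)
    -- Otherwise ζ lives outside B, where the chain `matrix ·ᵛ ζ` restricts to ζ. The elementary
    -- chain below it, restricted outside B, is the circuit, and its image is that elementary chain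
    -- again.
    ... | no none = record
      { η         = η
      ; nonzero   = nonzero
      ; support   = support
      ; image     = λ b eq → trans (image b) (E.support b eq)
      ; ternary   = ternary
      ; ternary·ᵛ = λ b → subst Ternary (sym (image b)) (E.ternary b)
      }
      where
      inside-0 : ∀ c → B c ≡ true → ζ c ≡ 0ℚ
      inside-0 c Bc with ζ c ℚ.≟ 0ℚ
      ... | yes eq = eq
      ... | no ≢0  = contradiction (c , Bc , ≢0) none
      z : Fin m → ℚ
      z = matrix ·ᵛ ζ
      z≡ζ : ∀ c → B c ≡ false → z c ≡ ζ c
      z≡ζ c Bc = trans (·ᵛ-comm ζ c) (sum-outside ζ c Bc)
      zc₀≢0 : z c₀ ≢ 0ℚ
      zc₀≢0 eq with B c₀ in Bc₀
      ... | true  = ζc₀≢0 (inside-0 c₀ Bc₀)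
      ... | false = ζc₀≢0 (trans (sym (z≡ζ c₀ Bc₀)) eq)
      module E = Elementary (elementary (Z-resp (λ b → sym (·ᵛ-comm ζ b)) (Z-sum ζ Y Y∈Z)) (c₀ , zc₀≢0))
      η : Fin m → ℚ
      η c = if B c then 0ℚ else E.y c
      η-outside : ∀ c → B c ≡ false → η c ≡ E.y c
      η-outside c Bc rewrite Bc = refl
      ternary : ∀ c → Ternary (η c)
      ternary c with B c
      ... | true  = inj₁ refl
      ... | false = E.ternary c
      support : ∀ c → ζ c ≡ 0ℚ → η c ≡ 0ℚ
      support c ζc≡0 with B c in Bc
      ... | true  = refl
      ... | false = E.support c (trans (z≡ζ c Bc) ζc≡0)
      image : ∀ b → (matrix ·ᵛ η) b ≡ E.y b
      image b = trans (·ᵛ-comm η b) (trans (sum-cong term) (sym (expand E.y E.y∈Z b)))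
        where
        term : ∀ c → η c * Y c b ≡ E.y c * Y c b
        term c with B c in Bc
        ... | true  = trans (ℚ.*-zeroˡ (Y c b)) (sym (trans (cong (E.y c *_) (Y-inside c Bc b)) (ℚ.*-zeroʳ (E.y c))))
        ... | false = refl
      nonzero : ∃ λ c → η c ≢ 0ℚ
      nonzero with Fin.any? (λ c → ¬? (η c ℚ.≟ 0ℚ))
      ... | yes p = p
      ... | no η≡0 = contradiction (free E.y E.y∈Z out (proj₁ E.nonzero)) (proj₂ E.nonzero)
        where
        out : Outside B E.y
        out k Bk with η k ℚ.≟ 0ℚ
        ... | yes eq = trans (sym (η-outside k Bk)) eq
        ... | no ≢0  = contradiction (k , ≢0) η≡0

  frame : ∀ {B} → Free B → (∀ c → B c ≡ false → Spans B c) → Frame B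
  frame {B} free spans = record
    { free      = free
    ; Y         = λ c → V.vec c
    ; Y∈Z       = λ c → V.vec∈Z c
    ; Y-ternary = λ c → V.vec-ternary c
    ; Y-inside  = λ c → V.vec-inside c
    ; Y-diag    = λ c → V.vec-diag c
    ; Y-off     = λ c → V.vec-off c
    }
    where
    module V (c : Fin m) where
      module E (Bc : B c ≡ false) where
        y₀ = spans c Bc
        open Elementary (elementary (proj₁ (proj₂ y₀)) (c , proj₁ (proj₂ (proj₂ y₀)))) public
        off : Outside-except B c y
        off k Bk k≢c = support k (proj₂ (proj₂ (proj₂ y₀)) k Bk k≢c)
        yc≢0 : y c ≢ 0ℚ
        yc≢0 yc≡0 = proj₂ nonzero (free y y∈Z out (proj₁ nonzero))
          where
          out : Outside B y
          out k Bk with k Fin.≟ c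
          ... | yes refl = yc≡0
          ... | no k≢c   = off k Bk k≢c
      vec-by : ∀ b → B c ≡ b → Fin m → ℚ
      vec-by true  _  k = 0ℚ
      -- The entry at c is a sign; multiplying by it makes that entry 1.
      vec-by false Bc k = E.y Bc c * E.y Bc k
      vec : Fin m → ℚ
      vec = vec-by (B c) refl
      vec∈Z : Z vec
      vec∈Z = go (B c) refl
        where
        go : ∀ b Bc → Z (vec-by b Bc)
        go true  _  = Z-zero
        go false Bc = Z-scale (E.y Bc c) (E.y∈Z Bc)
      vec-ternary : ∀ k → Ternary (vec k)
      vec-ternary k = go (B c) refl
        where
        go : ∀ b Bc → Ternary (vec-by b Bc k)
        go true  _  = inj₁ refl
        go false Bc = ternary-* (E.ternary Bc c) (E.ternary Bc k)
      vec-inside : B c ≡ true → ∀ k → vec k ≡ 0ℚ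
      vec-inside eq k = go (B c) refl eq
        where
        go : ∀ b Bc → b ≡ true → vec-by b Bc k ≡ 0ℚ
        go true _ _ = refl
      vec-diag : B c ≡ false → vec c ≡ 1ℚ
      vec-diag eq = go (B c) refl eq
        where
        go : ∀ b Bc → b ≡ false → vec-by b Bc c ≡ 1ℚ
        go false Bc _ = ternary-square (E.ternary Bc c) (E.yc≢0 Bc)
      vec-off : Outside-except B c vec
      vec-off k Bk k≢c = go (B c) refl
        where
        go : ∀ b Bc → vec-by b Bc k ≡ 0ℚ
        go true  _  = refl
        go false Bc = trans (cong (E.y Bc c *_) (E.off Bc k Bk k≢c)) (ℚ.*-zeroʳ (E.y Bc c))

-- Comparing chain groups with the same dependent sets

module _ {m} (S S′ : ChainGroup m) (B : Fin m → Bool) where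
  private
    module S = ChainGroup S
    module S′ = ChainGroup S′
    module 𝔹 = Basis S
    module 𝔹′ = Basis S′

  free-transfer : Dependents⊆ S′ S → 𝔹.Free B → 𝔹′.Free B
  free-transfer transfer free z′ Z′z′ out k with z′ k ℚ.≟ 0ℚ
  ... | yes eq = eq
  ... | no ≢0  = ⊥-elim (transfer z′ Z′z′ (k , ≢0) λ { (z , Zz , (j , zj≢0) , supp) →
                   zj≢0 (free z Zz (λ i Bi → supp i (out i Bi)) j) })

  -- The chain of `S′` below the one that spans c is nonzero at c: otherwise it would be supported
  -- in B, which is free for `S′`.
  spans-transfer : Dependents⊆ S S′ → 𝔹′.Free B → ∀ c → 𝔹.Spans B c → ¬ ¬ 𝔹′.Spans B c
  spans-transfer transfer free′ c (y , Zy , yc≢0 , off) k =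
    transfer y Zy (c , yc≢0) λ { (z′ , Z′z′ , (j , z′j≢0) , supp) →
      k (z′ , Z′z′ , (λ z′c≡0 → z′j≢0 (free′ z′ Z′z′ (out z′ supp z′c≡0) j)) , λ i Bi i≢c → supp i (off i Bi i≢c)) }
    where
    out : ∀ z′ → (∀ i → y i ≡ 0ℚ → z′ i ≡ 0ℚ) → z′ c ≡ 0ℚ → ∀ i → B i ≡ false → z′ i ≡ 0ℚ
    out z′ supp z′c≡0 i Bi with i Fin.≟ c
    ... | yes refl = z′c≡0
    ... | no i≢c   = supp i (off i Bi i≢c)

  -- Fundamental circuits have minimal support: the chain of `S′` found inside the support of `Y c`
  -- is a nonzero multiple of the fundamental circuit of c in `S′`.
  support-transfer : Dependents⊆ S S′ → (F : 𝔹.Frame B) (F′ : 𝔹′.Frame B) →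
                     ∀ b c → 𝔹.Frame.Y F c b ≡ 0ℚ → 𝔹′.Frame.Y F′ c b ≡ 0ℚ
  support-transfer transfer F F′ b c Ycb≡0 with F′.Y c b ℚ.≟ 0ℚ
    where module F′ = 𝔹′.Frame F′
  ... | yes eq = eq
  ... | no ≢0 with B c in Bc
  ...   | true  = 𝔹′.Frame.Y-inside F′ c Bc b
  ...   | false = ⊥-elim (transfer (F.Y c) (F.Y∈Z c) (c , λ eq → 0≢1 (trans (sym eq) (F.Y-diag c Bc)))
    λ { (z′ , Z′z′ , (j , z′j≢0) , supp) →
      let z′≡ = F′.multiple c Bc z′ Z′z′ (λ k Bk k≢c → supp k (F.Y-off c k Bk k≢c))
          z′c≢0 : z′ c ≢ 0ℚ
          z′c≢0 eq = z′j≢0 (trans (z′≡ j) (trans (cong (_* F′.Y c j) eq) (ℚ.*-zeroˡ (F′.Y c j))))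
      in ≢0 (*-cancel-0 z′c≢0 (trans (sym (z′≡ b)) (supp b Ycb≡0))) })
    where
    module F  = 𝔹.Frame F
    module F′ = 𝔹′.Frame F′

  transport : (F : 𝔹.Frame B) (F′ : 𝔹′.Frame B) (ε : Fin m → Bool) →
    (∀ b c → 𝔹′.Frame.Y F′ c b ≡ sgn (ε b) * (sgn (ε c) * 𝔹.Frame.Y F c b)) →
    ∀ z → S.Z z → S′.Z (λ k → sgn (ε k) * z k)
  transport F F′ ε signed z Zz = S′.Z-resp (λ b → sym (expanded b)) (S′.Z-sum (λ c → sgn (ε c) * z c) F′.Y F′.Y∈Z)
    where
    module F  = 𝔹.Frame F
    module F′ = 𝔹′.Frame F′
    rearrange : ∀ x y z q → x * (y * y * z * q) ≡ y * z * (x * (y * q))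
    rearrange = solve-∀ ringℚ
    term : ∀ b c → sgn (ε b) * (z c * F.Y c b) ≡ sgn (ε c) * z c * F′.Y c b
    term b c = begin
      sgn (ε b) * (z c * F.Y c b)
        ≡⟨ cong (λ t → sgn (ε b) * (t * F.Y c b)) (ℚ.*-identityˡ (z c)) ⟨
      sgn (ε b) * (1ℚ * z c * F.Y c b)
        ≡⟨ cong (λ t → sgn (ε b) * (t * z c * F.Y c b)) (sgn-square (ε c)) ⟨
      sgn (ε b) * (sgn (ε c) * sgn (ε c) * z c * F.Y c b)
        ≡⟨ rearrange (sgn (ε b)) (sgn (ε c)) (z c) (F.Y c b) ⟩
      sgn (ε c) * z c * (sgn (ε b) * (sgn (ε c) * F.Y c b))
        ≡⟨ cong (sgn (ε c) * z c *_) (signed b c) ⟨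
      sgn (ε c) * z c * F′.Y c b ∎
      where open ≡-Reasoning
    expanded : ∀ b → sgn (ε b) * z b ≡ sumF (λ c → sgn (ε c) * z c * F′.Y c b)
    expanded b = trans (cong (sgn (ε b) *_) (F.expand z Zz b))
      (trans (sym (sum-*ˡ (sgn (ε b)) (λ c → z c * F.Y c b))) (sum-cong (term b)))

unique-signing : ∀ {m} (S S′ : ChainGroup m) → Dependents⊆ S S′ → Dependents⊆ S′ S →
  ¬ ¬ (Σ (Fin m → Bool) λ ε →
    (∀ z → ChainGroup.Z S z → ChainGroup.Z S′ (λ k → sgn (ε k) * z k)) ×
    (∀ z → ChainGroup.Z S′ z → ChainGroup.Z S (λ k → sgn (ε k) * z k)))
unique-signing {m} S S′ S⊆S′ S′⊆S k = 𝔹.basis λ { (B , free , spans) →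
  let free′ = free-transfer S S′ B S′⊆S free in
  ¬¬-∀ {P = λ c → B c ≡ false → 𝔹′.Spans B c} (λ c k′ → spans′ B free′ spans c k′) λ spans′ →
  let F  = 𝔹.frame free spans
      F′ = 𝔹′.frame free′ spans′
      module F  = 𝔹.Frame F
      module F′ = 𝔹′.Frame F′
  in camion F.matrix F′.matrix (λ b c → F.Y-ternary c b) (λ b c → F′.Y-ternary c b)
       (support-transfer S S′ B S⊆S′ F F′) (support-transfer S′ S B S′⊆S F′ F) F.matrix-regular F′.matrix-regular
  λ { (ε , δ , Y′≡) →
    let signed = symmetric-signs B F F′ ε δ Y′≡ in
    k (ε , transport S S′ B F F′ ε signed
         , transport S′ S B F′ F ε (λ b c → sym (trans (cong (λ t → sgn (ε b) * (sgn (ε c) * t)) (signed b c))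
                                                       (swap-cancel (ε b) (ε c) (F.Y c b))))) } }
  where
  module 𝔹 = Basis S
  module 𝔹′ = Basis S′
  spans′ : ∀ B → 𝔹′.Free B → (∀ c → B c ≡ false → 𝔹.Spans B c) → ∀ c → ¬ ¬ (B c ≡ false → 𝔹′.Spans B c)
  spans′ B free′ spans c k with B c in Bc
  ... | true  = k λ ()
  ... | false = spans-transfer S S′ B S⊆S′ free′ c (spans c Bc) λ s → k λ _ → s
  -- The diagonal entries of both matrices are 1 on the non-basis columns, so ε and δ agree there.
  symmetric-signs : ∀ B (F : 𝔹.Frame B) (F′ : 𝔹′.Frame B) (ε δ : Fin m → Bool) →
    (∀ b c → 𝔹′.Frame.Y F′ c b ≡ sgn (ε b) * (sgn (δ c) * 𝔹.Frame.Y F c b)) →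
    ∀ b c → 𝔹′.Frame.Y F′ c b ≡ sgn (ε b) * (sgn (ε c) * 𝔹.Frame.Y F c b)
  symmetric-signs B F F′ ε δ Y′≡ b c with B c in Bc
  ... | true  = trans (𝔹′.Frame.Y-inside F′ c Bc b) (sym (trans
                  (cong (λ t → sgn (ε b) * (sgn (ε c) * t)) (𝔹.Frame.Y-inside F c Bc b))
                  (trans (cong (sgn (ε b) *_) (ℚ.*-zeroʳ (sgn (ε c)))) (ℚ.*-zeroʳ (sgn (ε b))))))
  ... | false = trans (Y′≡ b c) (cong (λ t → sgn (ε b) * (t * F.Y c b)) δ≡ε)
    where
    module F  = 𝔹.Frame F
    module F′ = 𝔹′.Frame F′
    δ≡ε : sgn (δ c) ≡ sgn (ε c)
    δ≡ε = begin
      sgn (δ c)                                       ≡⟨ sgn-cancel (ε c) (sgn (δ c)) ⟨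
      sgn (ε c) * (sgn (ε c) * sgn (δ c))             ≡⟨ cong (λ t → sgn (ε c) * (sgn (ε c) * t)) (ℚ.*-identityʳ (sgn (δ c))) ⟨
      sgn (ε c) * (sgn (ε c) * (sgn (δ c) * 1ℚ))      ≡⟨ cong (λ t → sgn (ε c) * (sgn (ε c) * (sgn (δ c) * t))) (F.Y-diag c Bc) ⟨
      sgn (ε c) * (sgn (ε c) * (sgn (δ c) * F.Y c c)) ≡⟨ cong (sgn (ε c) *_) (Y′≡ c c) ⟨
      sgn (ε c) * F′.Y c c                            ≡⟨ cong (sgn (ε c) *_) (F′.Y-diag c Bc) ⟩
      sgn (ε c) * 1ℚ                                  ≡⟨ ℚ.*-identityʳ (sgn (ε c)) ⟩
      sgn (ε c)                                       ∎
      where open ≡-Reasoning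

-- Cycle spaces of graphs

module _ (G : Graph) where

  src tgt : Fin (e G) → Fin (n G)
  src k = proj₁ (ends G k)
  tgt k = proj₂ (ends G k)

  edge : Fin (e G) → Vecℚ (n G)
  edge k = gen G (k , true)

  Flow : (Fin (e G) → ℚ) → Set
  Flow z = ∀ i → sumF (λ k → z k * edge k i) ≡ 0ℚ

  Joins : Fin (e G) → Fin (n G) → Fin (n G) → Set
  Joins k u v = ends G k ≡ (u , v) ⊎ ends G k ≡ (v , u)

  src≢tgt : ∀ k → src k ≢ tgt k
  src≢tgt k eq = ℕ.<-irrefl (cong toℕ eq) (ordered G k)

  edge-src : ∀ k → edge k (src k) ≡ 1ℚ
  edge-src k = cong₂ _-_ (unit-same (src k)) (unit-other (src≢tgt k ∘ sym))

  edge-tgt : ∀ k → edge k (tgt k) ≡ - 1ℚ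
  edge-tgt k = cong₂ _-_ (unit-other (src≢tgt k)) (unit-same (tgt k))

  edge-away : ∀ k {v} → src k ≢ v → tgt k ≢ v → edge k v ≡ 0ℚ
  edge-away k s≢v t≢v = cong₂ _-_ (unit-other s≢v) (unit-other t≢v)

  edge-ternary : ∀ k v → Ternary (edge k v)
  edge-ternary k v with src k Fin.≟ v | tgt k Fin.≟ v
  ... | yes _ | yes _ = inj₁ refl
  ... | yes _ | no _  = inj₂ (inj₁ refl)
  ... | no _  | yes _ = inj₂ (inj₂ refl)
  ... | no _  | no _  = inj₁ refl

  edge-end≢0 : ∀ {k u v} → Joins k u v → edge k u ≢ 0ℚ
  edge-end≢0 {k} (inj₁ refl) eq with trans (sym (edge-src k)) eq
  ... | ()
  edge-end≢0 {k} (inj₂ refl) eq with trans (sym (edge-tgt k)) eq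
  ... | ()

  joins-ends : ∀ {k u v u′ v′} → Joins k u v → Joins k u′ v′ → (u ≡ u′ × v ≡ v′) ⊎ (u ≡ v′ × v ≡ u′)
  joins-ends (inj₁ refl) (inj₁ refl) = inj₁ (refl , refl)
  joins-ends (inj₁ refl) (inj₂ refl) = inj₂ (refl , refl)
  joins-ends (inj₂ refl) (inj₁ refl) = inj₂ (refl , refl)
  joins-ends (inj₂ refl) (inj₂ refl) = inj₁ (refl , refl)

  joins-unique : ∀ {k l u v} → Joins k u v → Joins l u v → k ≡ l
  joins-unique {k} {l} (inj₁ p) (inj₁ q) = simple G k l (trans p (sym q))
  joins-unique {k} {l} (inj₂ p) (inj₂ q) = simple G k l (trans p (sym q))
  joins-unique {k} {l} (inj₁ p) (inj₂ q) with ordered G k | ordered G l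
  ... | u<v | v<u rewrite p | q = contradiction u<v (ℕ.<-asym v<u)
  joins-unique {k} {l} (inj₂ p) (inj₁ q) with ordered G k | ordered G l
  ... | u<v | v<u rewrite p | q = contradiction u<v (ℕ.<-asym v<u)

  joins-sym : ∀ {k u v} → Joins k u v → Joins k v u
  joins-sym (inj₁ p) = inj₂ p
  joins-sym (inj₂ p) = inj₁ p

  joins-irrefl : ∀ {k u} → ¬ Joins k u u
  joins-irrefl {k} (inj₁ p) = src≢tgt k (trans (cong proj₁ p) (sym (cong proj₂ p)))
  joins-irrefl {k} (inj₂ p) = src≢tgt k (trans (cong proj₁ p) (sym (cong proj₂ p)))

  -- Conservation at v: a flow that enters v along k leaves it along another edge.
  next-edge : ∀ {z k v v′} → Flow z → z k ≢ 0ℚ → Joins k v v′ →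
              Σ (Fin (e G)) λ l → l ≢ k × z l ≢ 0ℚ × Σ (Fin (n G)) λ u → Joins l u v
  next-edge {z} {k} {v} flow zk≢0 joins
    with Fin.any? (λ l → ¬? (l Fin.≟ k) ×-dec ¬? (z l ℚ.≟ 0ℚ) ×-dec ((src l Fin.≟ v) ⊎-dec (tgt l Fin.≟ v)))
  ... | yes (l , l≢k , zl≢0 , inj₁ refl) = l , l≢k , zl≢0 , tgt l , inj₂ refl
  ... | yes (l , l≢k , zl≢0 , inj₂ refl) = l , l≢k , zl≢0 , src l , inj₁ refl
  ... | no none = contradiction (*-cancel-0 zk≢0 (trans (sym (sum-single k others)) (flow v))) (edge-end≢0 joins)
    where
    others : ∀ l → l ≢ k → z l * edge l v ≡ 0ℚ
    others l l≢k with z l ℚ.≟ 0ℚ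
    ... | yes zl≡0 = trans (cong (_* edge l v) zl≡0) (ℚ.*-zeroˡ (edge l v))
    ... | no zl≢0  = trans (cong (z l *_) (edge-away l (λ s → none (l , l≢k , zl≢0 , inj₁ s))
                                                       (λ t → none (l , l≢k , zl≢0 , inj₂ t)))) (ℚ.*-zeroʳ (z l))

  module Walk {z} (flow : Flow z) (F : Subset (e G)) (supported : ∀ k → z k ≢ 0ℚ → k ∈ F) where

    -- The trail grows at the front: `w 0` is its newest vertex, and only `w 0` , ... , `w r` count.
    record Trail (r : ℕ) : Set where
      field
        w         : ℕ → Fin (n G)
        injective : ∀ {a b} → a ℕ.≤ r → b ℕ.≤ r → w a ≡ w b → a ≡ b
        link      : ∀ i → i ℕ.< r → Σ (Fin (e G)) λ k → z k ≢ 0ℚ × Joins k (w i) (w (suc i))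

    close : ∀ {r l} (T : Trail r) (let open Trail T) j → 2 ℕ.+ j ℕ.≤ r → z l ≢ 0ℚ → Joins l (w (2 ℕ.+ j)) (w 0) →
            CycleIn G F
    close {r} {l} T j j+2≤r zl≢0 joins = record
      { j        = j
      ; w        = w ∘ toℕ
      ; distinct = λ a b eq → Fin.toℕ-injective (injective (bound a) (bound b) eq)
      ; steps    = λ i → let k , zk≢0 , joins = link (toℕ i) (ℕ.<-≤-trans (Fin.toℕ<n i) j+2≤r)
                         in k , supported k zk≢0 , subst (λ x → Joins k (w x) (w (suc (toℕ i)))) (sym (Fin.toℕ-inject₁ i)) joins
      ; closing  = l , supported l zl≢0 , subst (λ x → Joins l (w x) (w 0)) (sym (Fin.toℕ-fromℕ (2 ℕ.+ j))) joins
      }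
      where
      open Trail T
      bound : ∀ (a : Fin (3 ℕ.+ j)) → toℕ a ℕ.≤ r
      bound a = ℕ.≤-trans (ℕ.≤-pred (Fin.toℕ<n a)) j+2≤r

    extend : ∀ {r l u} (T : Trail r) (let open Trail T) → z l ≢ 0ℚ → Joins l u (w 0) →
             (∀ i → i ℕ.≤ r → w i ≢ u) → Trail (suc r)
    extend {r} {l} {u} T zl≢0 joins fresh = record { w = w′ ; injective = injective′ ; link = link′ }
      where
      open Trail T
      w′ : ℕ → Fin (n G)
      w′ zero    = u
      w′ (suc i) = w i
      injective′ : ∀ {a b} → a ℕ.≤ suc r → b ℕ.≤ suc r → w′ a ≡ w′ b → a ≡ b
      injective′ {zero}  {zero}  _ _ _ = refl
      injective′ {zero}  {suc b} _ (s≤s b≤r) eq = contradiction (sym eq) (fresh b b≤r)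
      injective′ {suc a} {zero}  (s≤s a≤r) _ eq = contradiction eq (fresh a a≤r)
      injective′ {suc a} {suc b} (s≤s a≤r) (s≤s b≤r) eq = cong suc (injective a≤r b≤r eq)
      link′ : ∀ i → i ℕ.< suc r → Σ (Fin (e G)) λ k → z k ≢ 0ℚ × Joins k (w′ i) (w′ (suc i))
      link′ zero    _         = l , zl≢0 , joins
      link′ (suc i) (s≤s i<r) = link i i<r

    trail-bound : ∀ {r} → Trail r → r ℕ.< n G
    trail-bound T = Fin.injective⇒≤ {f = λ a → w (toℕ a)} λ {a} {b} eq →
      Fin.toℕ-injective (injective (ℕ.≤-pred (Fin.toℕ<n a)) (ℕ.≤-pred (Fin.toℕ<n b)) eq)
      where open Trail T

    -- By conservation the trail continues from its front vertex along a second edge. A new end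
    -- lengthens the trail, which stays shorter than `n G`. An end on the trail is not at position
    -- 0, which would be a loop, nor at 1, which would be a parallel edge, so it closes a cycle.
    search : ∀ fuel r → n G ℕ.≤ suc r ℕ.+ fuel → Trail (suc r) → CycleIn G F
    search zero r n≤r T = contradiction (trail-bound T)
      (ℕ.≤⇒≯ (subst (n G ℕ.≤_) (ℕ.+-identityʳ (suc r)) n≤r))
    search (suc fuel) r n≤ T with Trail.link T 0 (s≤s z≤n)
    ... | k , zk≢0 , joins with next-edge flow zk≢0 joins
    ...   | l , l≢k , zl≢0 , u , joins′ with ℕ.anyUpTo? (λ i → Trail.w T i Fin.≟ u) (suc (suc r))
    ...     | no fresh = search fuel (suc r) (subst (n G ℕ.≤_) (ℕ.+-suc (suc r) fuel) n≤)
                           (extend T zl≢0 joins′ (λ i i≤r eq → fresh (i , s≤s i≤r , eq)))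
    ...     | yes (zero , _ , refl)              = contradiction joins′ joins-irrefl
    ...     | yes (suc zero , _ , refl)          = contradiction (joins-unique (joins-sym joins′) joins) l≢k
    ...     | yes (suc (suc j) , s≤s j+2≤ , refl) = close T j j+2≤ zl≢0 joins′

    cycle : (∃ λ k → z k ≢ 0ℚ) → CycleIn G F
    cycle (k , zk≢0) = search (n G) 0 (ℕ.m≤n+m (n G) 1) record { w = w ; injective = injective ; link = link }
      where
      w : ℕ → Fin (n G)
      w zero    = src k
      w (suc _) = tgt k
      injective : ∀ {a b} → a ℕ.≤ 1 → b ℕ.≤ 1 → w a ≡ w b → a ≡ b
      injective z≤n       z≤n       _  = refl
      injective z≤n       (s≤s z≤n) eq = contradiction eq (src≢tgt k)
      injective (s≤s z≤n) z≤n       eq = contradiction (sym eq) (src≢tgt k)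
      injective (s≤s z≤n) (s≤s z≤n) _  = refl
      link : ∀ i → i ℕ.< 1 → Σ (Fin (e G)) λ k → z k ≢ 0ℚ × Joins k (w i) (w (suc i))
      link zero    _        = k , zk≢0 , inj₁ refl
      link (suc i) (s≤s ())

  joins-sign : ∀ {k u v} → Joins k u v → Bool
  joins-sign (inj₁ _) = true
  joins-sign (inj₂ _) = false

  edge-signed : ∀ {k u v} (joins : Joins k u v) i → sgn (joins-sign joins) * edge k i ≡ unit u i - unit v i
  edge-signed {k} (inj₁ refl) i = ℚ.*-identityˡ (edge k i)
  edge-signed {k} (inj₂ refl) i = flip (unit (src k) i) (unit (tgt k) i)
    where
    flip : ∀ x y → - 1ℚ * (x - y) ≡ y - x
    flip = solve-∀ ringℚ

  module FromCycle {F : Subset (e G)} (C : CycleIn G F) where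
    open CycleIn C

    -- The closing edge takes position 0, which makes all edges of the cycle one family.
    steps⁺ : Fin (3 ℕ.+ j) → Σ (Fin (n G) × Fin (n G)) λ (u , v) → JoinedIn G F u v
    steps⁺ zero    = (w (fromℕ (2 ℕ.+ j)) , w zero) , closing
    steps⁺ (suc i) = (w (inject₁ i) , w (suc i)) , steps i

    from to : Fin (3 ℕ.+ j) → Fin (n G)
    from a = proj₁ (proj₁ (steps⁺ a))
    to   a = proj₂ (proj₁ (steps⁺ a))

    K : Fin (3 ℕ.+ j) → Fin (e G)
    K a = proj₁ (proj₂ (steps⁺ a))

    K∈F : ∀ a → K a ∈ F
    K∈F a = proj₁ (proj₂ (proj₂ (steps⁺ a)))

    joins : ∀ a → Joins (K a) (from a) (to a)
    joins a = proj₂ (proj₂ (proj₂ (steps⁺ a)))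

    private
      closing≢step : ∀ i → K zero ≢ K (suc i)
      closing≢step i eq with joins-ends (joins zero) (subst (λ k → Joins k (from (suc i)) (to (suc i))) (sym eq) (joins (suc i)))
      ... | inj₁ (p , _) = Fin.fromℕ≢inject₁ (distinct _ _ p)
      -- An edge traversed in both directions would need a cycle of length 2; this one has at least
      -- 3 vertices.
      ... | inj₂ (p , q) with i
      ...   | zero  = contradiction (Fin.suc-injective (distinct _ _ p)) λ ()
      ...   | suc _ = contradiction (distinct _ _ q) λ ()

    K-injective : ∀ a b → K a ≡ K b → a ≡ b
    K-injective zero    zero    _  = refl
    K-injective zero    (suc b) eq = contradiction eq (closing≢step b)
    K-injective (suc a) zero    eq = contradiction (sym eq) (closing≢step a)
    K-injective (suc a) (suc b) eq
      with joins-ends (joins (suc a)) (subst (λ k → Joins k (from (suc b)) (to (suc b))) (sym eq) (joins (suc b)))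
    ... | inj₁ (_ , q) = distinct _ _ q
    ... | inj₂ (p , q) = contradiction a≡1+b (ℕ.<⇒≢ (ℕ.<-trans (ℕ.n<1+n (toℕ a)) (subst (ℕ._< suc (toℕ b)) (sym 1+a≡b) (ℕ.n<1+n (toℕ b)))))
      where
      a≡1+b : toℕ a ≡ suc (toℕ b)
      a≡1+b = trans (sym (Fin.toℕ-inject₁ a)) (cong toℕ (distinct _ _ p))
      1+a≡b : suc (toℕ a) ≡ toℕ b
      1+a≡b = trans (cong toℕ (distinct _ _ q)) (Fin.toℕ-inject₁ b)

    s : Fin (3 ℕ.+ j) → ℚ
    s a = sgn (joins-sign (joins a))

    y : Fin (e G) → ℚ
    y k = sumF (λ a → s a * unit (K a) k)

    y-on : ∀ a → y (K a) ≡ s a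
    y-on a = trans (sum-single a (λ b b≢a → trans (cong (s b *_) (unit-other (b≢a ∘ K-injective b a))) (ℚ.*-zeroʳ (s b))))
                   (trans (cong (s a *_) (unit-same (K a))) (ℚ.*-identityʳ (s a)))

    y-off : ∀ k → (∀ a → K a ≢ k) → y k ≡ 0ℚ
    y-off k off = sum-zero (λ a → trans (cong (s a *_) (unit-other (off a))) (ℚ.*-zeroʳ (s a)))

    on? : ∀ k → (∃ λ a → K a ≡ k) ⊎ (∀ a → K a ≢ k)
    on? k with Fin.any? (λ a → K a Fin.≟ k)
    ... | yes p = inj₁ p
    ... | no ¬p = inj₂ (λ a eq → ¬p (a , eq))

    y-ternary : ∀ k → Ternary (y k)
    y-ternary k with on? k
    ... | inj₁ (a , refl) = subst Ternary (sym (y-on a)) (sgn-ternary (joins-sign (joins a)))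
    ... | inj₂ off        = inj₁ (y-off k off)

    y-support : ∀ k → y k ≢ 0ℚ → k ∈ F
    y-support k yk≢0 with on? k
    ... | inj₁ (a , refl) = K∈F a
    ... | inj₂ off        = contradiction (y-off k off) yk≢0

    y-nonzero : ∃ λ k → y k ≢ 0ℚ
    y-nonzero = K zero , λ eq → sgn≢0 (joins-sign (joins zero)) (trans (sym (y-on zero)) eq)

    private
      telescope : ∀ {m} (h : Fin (suc m) → ℚ) → sumF (λ (i : Fin m) → h (inject₁ i) - h (suc i)) ≡ h zero - h (fromℕ m)
      telescope {zero}  h = sym (ℚ.+-inverseʳ (h zero))
      telescope {suc m} h = trans (cong (h zero - h (suc zero) +_) (telescope (h ∘ suc)))
                                  (collapse (h zero) (h (suc zero)) (h (fromℕ (suc m))))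
        where
        collapse : ∀ x y z → (x - y) + (y - z) ≡ x - z
        collapse = solve-∀ ringℚ

    y-flow : Flow y
    y-flow i = begin
      sumF (λ k → y k * edge k i)
        ≡⟨ sum-cong (λ k → sum-*ʳ (edge k i) (λ a → s a * unit (K a) k)) ⟨
      sumF (λ k → sumF (λ a → s a * unit (K a) k * edge k i))
        ≡⟨ sum-swap (λ k a → s a * unit (K a) k * edge k i) ⟩
      sumF (λ a → sumF (λ k → s a * unit (K a) k * edge k i))
        ≡⟨ sum-cong (λ a → trans (sum-cong (λ k → rearrange (s a) (unit (K a) k) (edge k i)))
                                 (sum-unitʳ (λ k → s a * edge k i) (K a))) ⟩
      sumF (λ a → s a * edge (K a) i)
        ≡⟨ sum-cong (λ a → edge-signed (joins a) i) ⟩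
      sumF (λ a → unit (from a) i - unit (to a) i)
        ≡⟨ cong (h (fromℕ (2 ℕ.+ j)) - h zero +_) (telescope h) ⟩
      (h (fromℕ (2 ℕ.+ j)) - h zero) + (h zero - h (fromℕ (2 ℕ.+ j)))
        ≡⟨ cancel (h (fromℕ (2 ℕ.+ j))) (h zero) ⟩
      0ℚ ∎
      where
      open ≡-Reasoning
      h : Fin (3 ℕ.+ j) → ℚ
      h a = unit (w a) i
      rearrange : ∀ s u g → s * u * g ≡ s * g * u
      rearrange = solve-∀ ringℚ
      cancel : ∀ x y → (x - y) + (y - x) ≡ 0ℚ
      cancel = solve-∀ ringℚ

-- Supports as subsets, and their transport along a bijection

supp : ∀ {m} → (Fin m → ℚ) → Subset m
supp z = tabulate (λ k → not (does (z k ℚ.≟ 0ℚ)))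

∈supp : ∀ {m} (z : Fin m → ℚ) k → z k ≢ 0ℚ → k ∈ supp z
∈supp z k zk≢0 = Vec.lookup⇒[]= k (supp z) (trans (Vec.lookup∘tabulate _ k) inside)
  where
  inside : not (does (z k ℚ.≟ 0ℚ)) ≡ true
  inside with z k ℚ.≟ 0ℚ
  ... | yes eq = contradiction eq zk≢0
  ... | no _   = refl

∈supp⁻¹ : ∀ {m} (z : Fin m → ℚ) k → k ∈ supp z → z k ≢ 0ℚ
∈supp⁻¹ z k k∈ with z k ℚ.≟ 0ℚ | trans (sym (Vec.lookup∘tabulate (λ k → not (does (z k ℚ.≟ 0ℚ))) k)) (Vec.[]=⇒lookup k∈)
... | yes _ | ()
... | no ≢0 | _ = ≢0

off-supp : ∀ {m} (z y : Fin m → ℚ) → (∀ k → y k ≢ 0ℚ → k ∈ supp z) → ∀ k → z k ≡ 0ℚ → y k ≡ 0ℚ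
off-supp z y support k zk≡0 with y k ℚ.≟ 0ℚ
... | yes eq = eq
... | no ≢0  = contradiction zk≡0 (∈supp⁻¹ z k (support k ≢0))

transported : ∀ {m m′} → Fin m ↔ Fin m′ → Subset m → Subset m′
transported σ F = tabulate (λ l → lookup F (Inverse.from σ l))

module _ {m m′} (σ : Fin m ↔ Fin m′) (F : Subset m) where
  open Inverse σ using (to; from; strictlyInverseʳ)

  ∈transported : ∀ l → from l ∈ F → l ∈ transported σ F
  ∈transported l ∈F = Vec.lookup⇒[]= l (transported σ F)
    (trans (Vec.lookup∘tabulate (λ l → lookup F (from l)) l) (Vec.[]=⇒lookup ∈F))

  ∈transported⁻¹ : ∀ k → to k ∈ transported σ F → k ∈ F
  ∈transported⁻¹ k ∈F = Vec.lookup⇒[]= k F (trans (cong (lookup F) (sym (strictlyInverseʳ k)))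
    (trans (sym (Vec.lookup∘tabulate (λ l → lookup F (from l)) (to k))) (Vec.[]=⇒lookup ∈F)))

cycleSpace : (G : Graph) → ChainGroup (e G)
cycleSpace G = record
  { Z          = Flow G
  ; Z-resp     = λ u≋v flow i → trans (sum-cong (λ k → cong (_* edge G k i) (sym (u≋v k)))) (flow i)
  ; Z-zero     = λ i → sum-zero (λ k → ℚ.*-zeroˡ (edge G k i))
  ; Z-linear   = λ {u} {v} t → linear {u} {v} t
  ; elementary = λ {z} flow nonzero →
      let C = Walk.cycle G flow (supp z) (∈supp z) nonzero
          open FromCycle G C
      in record { y = y ; y∈Z = y-flow ; ternary = y-ternary ; nonzero = y-nonzero
                ; support = off-supp z y y-support }
  }
  where
  linear : ∀ {u v} t → Flow G u → Flow G v → Flow G (λ k → u k + t * v k)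
  linear {u} {v} t flow-u flow-v i = begin
    sumF (λ k → (u k + t * v k) * edge G k i)
      ≡⟨ sum-cong (λ k → expand (u k) t (v k) (edge G k i)) ⟩
    sumF (λ k → u k * edge G k i + t * (v k * edge G k i))
      ≡⟨ sum-+ (λ k → u k * edge G k i) (λ k → t * (v k * edge G k i)) ⟩
    sumF (λ k → u k * edge G k i) + sumF (λ k → t * (v k * edge G k i))
      ≡⟨ cong₂ _+_ (flow-u i) (trans (sum-*ˡ t (λ k → v k * edge G k i)) (cong (t *_) (flow-v i))) ⟩
    0ℚ + t * 0ℚ
      ≡⟨ trans (ℚ.+-identityˡ (t * 0ℚ)) (ℚ.*-zeroʳ t) ⟩
    0ℚ ∎
    where
    open ≡-Reasoning
    expand : ∀ u t v g → (u + t * v) * g ≡ u * g + t * (v * g)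
    expand = solve-∀ ringℚ

-- Integral potentials

isInt-neg : ∀ q → IsInt q → IsInt (- q)
isInt-neg (mkℚ (ℤ.+ zero) d _)    int = int
isInt-neg (mkℚ (ℤ.+ (suc _)) d _) int = int
isInt-neg (mkℚ (ℤ.-[1+ _ ]) d _)  int = int

isInt-/1 : ∀ i → IsInt (i / 1)
isInt-/1 (ℤ.+ m)      = cong ℚ.denominatorℕ (ℚ.normalize-coprime (Coprime.sym (Coprime.1-coprimeTo m)))
isInt-/1 (ℤ.-[1+ m ]) = isInt-neg (ℤ.+ (suc m) / 1) (isInt-/1 (ℤ.+ (suc m)))

isInt-+ : ∀ p q → IsInt p → IsInt q → IsInt (p + q)
isInt-+ (mkℚ i zero _) (mkℚ j zero _) _ _ = isInt-/1 (i ℤ.* ℤ.+ 1 ℤ.+ j ℤ.* ℤ.+ 1)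

isInt-* : ∀ p q → IsInt p → IsInt q → IsInt (p * q)
isInt-* (mkℚ i zero _) (mkℚ j zero _) _ _ = isInt-/1 (i ℤ.* j)

isInt-sum : ∀ {m} (f : Fin m → ℚ) → (∀ i → IsInt (f i)) → IsInt (sumF f)
isInt-sum {zero}  f int = refl
isInt-sum {suc m} f int = isInt-+ (f zero) (sumF (f ∘ suc)) (int zero) (isInt-sum (f ∘ suc) (int ∘ suc))

isInt-ternary : ∀ {q} → Ternary q → IsInt q
isInt-ternary (inj₁ refl)        = refl
isInt-ternary (inj₂ (inj₁ refl)) = refl
isInt-ternary (inj₂ (inj₂ refl)) = refl

module Potential (G : Graph) where

  -- Each vertex v is the representative ρ v of its class plus an integral combination
  -- of edges, where classes are the components spanned by the first m edges.
  record Reduced (m : ℕ) : Set where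
    field
      ρ        : Fin (n G) → Fin (n G)
      P        : Fin (e G) → Fin (n G) → ℚ
      integral : ∀ k v → IsInt (P k v)
      reduces  : ∀ v i → unit v i ≡ unit (ρ v) i + sumF (λ k → P k v * edge G k i)
      merged   : ∀ l → toℕ l ℕ.< m → ρ (src G l) ≡ ρ (tgt G l)

  initial : Reduced 0
  initial = record
    { ρ = id ; P = λ _ _ → 0ℚ ; integral = λ _ _ → refl
    ; reduces = λ v i → sym (trans (cong (unit v i +_) (sum-zero (λ k → ℚ.*-zeroˡ (edge G k i)))) (ℚ.+-identityʳ (unit v i)))
    ; merged = λ _ ()
    }

  merge : ∀ {m} → m ℕ.< e G → Reduced m → Reduced (suc m)
  merge {m} m<e R = record { ρ = ρ′ ; P = P′ ; integral = integral′ ; reduces = reduces′ ; merged = merged′ }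
    where
    open Reduced R
    l = fromℕ< m<e
    u = src G l
    t = tgt G l
    ρ′ : Fin (n G) → Fin (n G)
    ρ′ v = if does (ρ v Fin.≟ ρ u) then ρ t else ρ v
    P′ : Fin (e G) → Fin (n G) → ℚ
    -- If v is in the class of u, then v = ρ u + T v, and ρ u = u - T u = edge l + t - T u = ρ t +
    -- edge l + T t - T u.
    P′ k v = if does (ρ v Fin.≟ ρ u) then P k v + (unit l k + (P k t - P k u)) else P k v
    integral′ : ∀ k v → IsInt (P′ k v)
    integral′ k v with ρ v Fin.≟ ρ u
    ... | no _  = integral k v
    ... | yes _ = isInt-+ (P k v) _ (integral k v) (isInt-+ (unit l k) _ (isInt-ternary (unit-ternary l k))
                    (isInt-+ (P k t) (- P k u) (integral k t) (isInt-neg (P k u) (integral k u))))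
    T : Fin (n G) → Fin (n G) → ℚ
    T v i = sumF (λ k → P k v * edge G k i)
    T′ : ∀ v i → sumF (λ k → (P k v + (unit l k + (P k t - P k u))) * edge G k i) ≡ T v i + (edge G l i + (T t i - T u i))
    T′ v i = begin
      sumF (λ k → (P k v + (unit l k + (P k t - P k u))) * edge G k i)
        ≡⟨ sum-cong (λ k → distribute (P k v) (unit l k) (P k t) (P k u) (edge G k i)) ⟩
      sumF (λ k → P k v * edge G k i + (edge G k i * unit l k + (P k t * edge G k i - P k u * edge G k i)))
        ≡⟨ sum-+ (λ k → P k v * edge G k i) (λ k → edge G k i * unit l k + (P k t * edge G k i - P k u * edge G k i)) ⟩
      T v i + sumF (λ k → edge G k i * unit l k + (P k t * edge G k i - P k u * edge G k i))
        ≡⟨ cong (T v i +_) (sum-+ (λ k → edge G k i * unit l k) (λ k → P k t * edge G k i - P k u * edge G k i)) ⟩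
      T v i + (sumF (λ k → edge G k i * unit l k) + sumF (λ k → P k t * edge G k i - P k u * edge G k i))
        ≡⟨ cong (T v i +_) (cong₂ _+_ (sum-unitʳ (λ k → edge G k i) l) (sum-- (λ k → P k t * edge G k i) (λ k → P k u * edge G k i))) ⟩
      T v i + (edge G l i + (T t i - T u i)) ∎
      where
      open ≡-Reasoning
      distribute : ∀ v x t u g → (v + (x + (t - u))) * g ≡ v * g + (g * x + (t * g - u * g))
      distribute = solve-∀ ringℚ
    reduces′ : ∀ v i → unit v i ≡ unit (ρ′ v) i + sumF (λ k → P′ k v * edge G k i)
    reduces′ v i with ρ v Fin.≟ ρ u
    ... | no _   = reduces v i
    ... | yes eq = sym (begin
      unit (ρ t) i + sumF (λ k → (P k v + (unit l k + (P k t - P k u))) * edge G k i)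
        ≡⟨ cong (unit (ρ t) i +_) (T′ v i) ⟩
      unit (ρ t) i + (T v i + ((unit u i - unit t i) + (T t i - T u i)))
        ≡⟨ cong₂ (λ x y → unit (ρ t) i + (T v i + ((x - y) + (T t i - T u i)))) (reduces u i) (reduces t i) ⟩
      unit (ρ t) i + (T v i + (((unit (ρ u) i + T u i) - (unit (ρ t) i + T t i)) + (T t i - T u i)))
        ≡⟨ collapse (unit (ρ t) i) (T v i) (unit (ρ u) i) (T u i) (T t i) ⟩
      unit (ρ u) i + T v i
        ≡⟨ cong (λ x → unit x i + T v i) eq ⟨
      unit (ρ v) i + T v i
        ≡⟨ reduces v i ⟨
      unit v i ∎)
      where
      open ≡-Reasoning
      collapse : ∀ a b c d f → a + (b + (((c + d) - (a + f)) + (f - d))) ≡ c + b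
      collapse = solve-∀ ringℚ
    ρ′-cong : ∀ {v v′} → ρ v ≡ ρ v′ → ρ′ v ≡ ρ′ v′
    ρ′-cong eq = cong (λ x → if does (x Fin.≟ ρ u) then ρ t else x) eq
    ρ′u : ρ′ u ≡ ρ t
    ρ′u with ρ u Fin.≟ ρ u
    ... | yes _ = refl
    ... | no ≢  = contradiction refl ≢
    ρ′t : ρ′ t ≡ ρ t
    ρ′t with ρ t Fin.≟ ρ u
    ... | yes _ = refl
    ... | no _  = refl
    merged′ : ∀ k → toℕ k ℕ.< suc m → ρ′ (src G k) ≡ ρ′ (tgt G k)
    merged′ k (s≤s k≤m) with k Fin.≟ l
    ... | yes refl = trans ρ′u (sym ρ′t)
    ... | no k≢l   = ρ′-cong (merged k (ℕ.≤∧≢⇒< k≤m (λ eq → k≢l (Fin.toℕ-injective (trans eq (sym (Fin.toℕ-fromℕ< m<e)))))))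

  reduced : ∀ m → m ℕ.≤ e G → Reduced m
  reduced zero    _   = initial
  reduced (suc m) m<e = merge m<e (reduced m (ℕ.<⇒≤ m<e))

  open Reduced (reduced (e G) ℕ.≤-refl) public using (P; integral)
  private module R = Reduced (reduced (e G) ℕ.≤-refl)

  Δ : Fin (e G) → Fin (e G) → ℚ
  Δ k l = P k (src G l) - P k (tgt G l)

  -- Once all edges are merged, the two ends of l have the same representative, which cancels in the
  -- difference.
  edge-expand : ∀ l i → edge G l i ≡ sumF (λ k → Δ k l * edge G k i)
  edge-expand l i = sym (begin
    sumF (λ k → Δ k l * edge G k i)
      ≡⟨ sum-cong (λ k → ℚ.*-distribʳ-+ (edge G k i) (P k u) (- P k t)) ⟩
    sumF (λ k → P k u * edge G k i + - P k t * edge G k i)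
      ≡⟨ sum-cong (λ k → cong (P k u * edge G k i +_) (sym (ℚ.neg-distribˡ-* (P k t) (edge G k i)))) ⟩
    sumF (λ k → P k u * edge G k i - P k t * edge G k i)
      ≡⟨ sum-- (λ k → P k u * edge G k i) (λ k → P k t * edge G k i) ⟩
    T u - T t
      ≡⟨ cancel (unit (R.ρ t) i) (T u) (T t) ⟨
    (unit (R.ρ t) i + T u) - (unit (R.ρ t) i + T t)
      ≡⟨ cong (λ x → (unit x i + T u) - (unit (R.ρ t) i + T t)) (R.merged l (Fin.toℕ<n l)) ⟨
    (unit (R.ρ u) i + T u) - (unit (R.ρ t) i + T t)
      ≡⟨ cong₂ _-_ (R.reduces u i) (R.reduces t i) ⟨
    edge G l i ∎)
    where
    open ≡-Reasoning
    u = src G l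
    t = tgt G l
    T : Fin (n G) → ℚ
    T v = sumF (λ k → P k v * edge G k i)
    cancel : ∀ a b c → (a + b) - (a + c) ≡ b - c
    cancel = solve-∀ ringℚ

  -- A functional on all of ℚⁿ with integral weights on the vertices, hence integral at every
  -- lattice point, whatever the expansion of that point in edges.
  φ : Fin (e G) → Vecℚ (n G) → ℚ
  φ k x = sumF (λ v → P k v * x v)

  φ-edge : ∀ k l → φ k (edge G l) ≡ Δ k l
  φ-edge k l = trans (sum-cong (λ v → distribute (P k v) (unit (src G l) v) (unit (tgt G l) v)))
    (trans (sum-- (λ v → P k v * unit (src G l) v) (λ v → P k v * unit (tgt G l) v))
           (cong₂ _-_ (sum-unitʳ (P k) (src G l)) (sum-unitʳ (P k) (tgt G l))))
    where
    distribute : ∀ p x y → p * (x - y) ≡ p * x - p * y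
    distribute = solve-∀ ringℚ

  φ-span : ∀ k (a : Fin (e G) → ℚ) x → (∀ i → x i ≡ sumF (λ l → a l * edge G l i)) → φ k x ≡ sumF (λ l → a l * Δ k l)
  φ-span k a x x≡ = begin
    sumF (λ v → P k v * x v)
      ≡⟨ sum-cong (λ v → trans (cong (P k v *_) (x≡ v)) (sym (sum-*ˡ (P k v) (λ l → a l * edge G l v)))) ⟩
    sumF (λ v → sumF (λ l → P k v * (a l * edge G l v)))
      ≡⟨ sum-swap (λ v l → P k v * (a l * edge G l v)) ⟩
    sumF (λ l → sumF (λ v → P k v * (a l * edge G l v)))
      ≡⟨ sum-cong (λ l → trans (sum-cong (λ v → swap (P k v) (a l) (edge G l v)))
                               (trans (sum-*ˡ (a l) (λ v → P k v * edge G l v)) (cong (a l *_) (φ-edge k l)))) ⟩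
    sumF (λ l → a l * Δ k l) ∎
    where
    open ≡-Reasoning
    swap : ∀ p a g → p * (a * g) ≡ a * (p * g)
    swap = solve-∀ ringℚ

  φ-reconstruct : ∀ (a : Fin (e G) → ℚ) x → (∀ i → x i ≡ sumF (λ l → a l * edge G l i)) →
                  ∀ i → sumF (λ k → φ k x * edge G k i) ≡ x i
  φ-reconstruct a x x≡ i = begin
    sumF (λ k → φ k x * edge G k i)
      ≡⟨ sum-cong (λ k → trans (cong (_* edge G k i) (φ-span k a x x≡)) (sym (sum-*ʳ (edge G k i) (λ l → a l * Δ k l)))) ⟩
    sumF (λ k → sumF (λ l → a l * Δ k l * edge G k i))
      ≡⟨ sum-swap (λ k l → a l * Δ k l * edge G k i) ⟩
    sumF (λ l → sumF (λ k → a l * Δ k l * edge G k i))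
      ≡⟨ sum-cong (λ l → trans (sum-cong (λ k → ℚ.*-assoc (a l) (Δ k l) (edge G k i)))
                               (trans (sum-*ˡ (a l) (λ k → Δ k l * edge G k i)) (cong (a l *_) (sym (edge-expand l i))))) ⟩
    sumF (λ l → a l * edge G l i)
      ≡⟨ x≡ i ⟨
    x i ∎
    where open ≡-Reasoning

-- Decidable chain groups with a finite spanning family

record Spanned {m} (S : ChainGroup m) : Set where
  open ChainGroup S
  field
    Z?     : ∀ z → Dec (Z z)
    U      : Fin m → Fin m → ℚ
    U∈Z    : ∀ l → Z (U l)
    U-span : ∀ z → Z z → ∀ k → z k ≡ sumF (λ l → z l * U l k)

cycleSpace-spanned : ∀ G → Spanned (cycleSpace G)
cycleSpace-spanned G = record
  { Z?     = λ z → Fin.all? (λ i → sumF (λ k → z k * edge G k i) ℚ.≟ 0ℚ)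
  ; U      = U
  ; U∈Z    = U∈Z
  ; U-span = U-span
  }
  where
  open Potential G
  -- The relation between `edge l` and its expansion. In the sum of the `z l * U l` the subtracted
  -- parts add up to `φ` at the sum of the `z l * edge l`, which is 0 for a flow z.
  U : Fin (e G) → Fin (e G) → ℚ
  U l k = unit l k - Δ k l
  U∈Z : ∀ l → Flow G (U l)
  U∈Z l i = trans (sum-cong (λ k → distribute (unit l k) (Δ k l) (edge G k i)))
    (trans (sum-- (λ k → edge G k i * unit l k) (λ k → Δ k l * edge G k i))
           (p≡q⇒p-q≡0 (trans (sum-unitʳ (λ k → edge G k i) l) (edge-expand l i))))
    where
    distribute : ∀ x d g → (x - d) * g ≡ g * x - d * g
    distribute = solve-∀ ringℚ
  U-span : ∀ z → Flow G z → ∀ k → z k ≡ sumF (λ l → z l * U l k)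
  U-span z flow k = sym (begin
    sumF (λ l → z l * (unit l k - Δ k l))
      ≡⟨ sum-cong (λ l → distribute (z l) (unit l k) (Δ k l)) ⟩
    sumF (λ l → z l * unit l k - z l * Δ k l)
      ≡⟨ sum-- (λ l → z l * unit l k) (λ l → z l * Δ k l) ⟩
    sumF (λ l → z l * unit l k) - sumF (λ l → z l * Δ k l)
      ≡⟨ cong₂ _-_ (trans (sum-cong (λ l → cong (z l *_) (unit-sym l k))) (sum-unitʳ z k))
                   (sym (φ-span k z (λ _ → 0ℚ) (λ i → sym (flow i)))) ⟩
    z k - φ k (λ _ → 0ℚ)
      ≡⟨ cong (λ t → z k - t) (sum-zero (λ v → ℚ.*-zeroʳ (P k v))) ⟩
    z k - 0ℚ
      ≡⟨ ℚ.+-identityʳ (z k) ⟩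
    z k ∎)
    where
    open ≡-Reasoning
    distribute : ∀ x d g → x * (d - g) ≡ x * d - x * g
    distribute = solve-∀ ringℚ
    unit-sym : ∀ (l k : Fin (e G)) → unit l k ≡ unit k l
    unit-sym l k with l Fin.≟ k | k Fin.≟ l
    ... | yes _    | yes _  = refl
    ... | no _     | no _   = refl
    ... | yes refl | no k≢k = contradiction refl k≢k
    ... | no l≢l | yes refl = contradiction refl l≢l

signing : ∀ {m} (S S′ : ChainGroup m) → Spanned S → Spanned S′ → Dependents⊆ S S′ → Dependents⊆ S′ S →
  Σ (Fin m → Bool) λ ε →
    (∀ z → ChainGroup.Z S z → ChainGroup.Z S′ (λ k → sgn (ε k) * z k)) ×
    (∀ z → ChainGroup.Z S′ z → ChainGroup.Z S (λ k → sgn (ε k) * z k))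
signing {m} S S′ sp sp′ S⊆S′ S′⊆S =
  let F , good , good′ = decidable-stable (anySubset? good?) λ ¬good →
        unique-signing S S′ S⊆S′ S′⊆S λ { (ε , to , from) → ¬good (tabulate ε
          , (λ l → S′.Z-resp (λ k → cong (λ b → sgn b * U.U l k) (sym (Vec.lookup∘tabulate ε k))) (to (U.U l) (U.U∈Z l)))
          , (λ l → S.Z-resp (λ k → cong (λ b → sgn b * U′.U l k) (sym (Vec.lookup∘tabulate ε k))) (from (U′.U l) (U′.U∈Z l)))) }
  in lookup F , extend S S′ sp (lookup F) good , extend S′ S sp′ (lookup F) good′
  where
  module S  = ChainGroup S
  module S′ = ChainGroup S′
  module U  = Spanned sp
  module U′ = Spanned sp′
  Good : Subset m → Set
  Good F = (∀ l → S′.Z (λ k → sgn (lookup F k) * U.U l k)) × (∀ l → S.Z (λ k → sgn (lookup F k) * U′.U l k))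
  good? : ∀ F → Dec (Good F)
  good? F = Fin.all? (λ l → U′.Z? _) ×-dec Fin.all? (λ l → U.Z? _)
  extend : ∀ (S S′ : ChainGroup m) (sp : Spanned S) (ε : Fin m → Bool) →
    (∀ l → ChainGroup.Z S′ (λ k → sgn (ε k) * Spanned.U sp l k)) →
    ∀ z → ChainGroup.Z S z → ChainGroup.Z S′ (λ k → sgn (ε k) * z k)
  extend S S′ sp ε good z Zz = Z-resp
    (λ k → sym (trans (cong (sgn (ε k) *_) (U-span z Zz k))
      (trans (sym (sum-*ˡ (sgn (ε k)) (λ l → z l * U l k))) (sum-cong (λ l → swap (sgn (ε k)) (z l) (U l k))))))
    (Z-sum z (λ l k → sgn (ε k) * U l k) good)
    where
    open ChainGroup S′
    open Spanned sp
    swap : ∀ s z u → s * (z * u) ≡ z * (s * u)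
    swap = solve-∀ ringℚ

module Pullback {m m′} (σ : Fin m ↔ Fin m′) (S : ChainGroup m′) where
  open Inverse σ using (to; from; strictlyInverseˡ; strictlyInverseʳ)
  open ChainGroup S

  lift : ∀ {y} → Z y → Z (λ l → y (to (from l)))
  lift {y} = Z-resp (λ l → cong y (sym (strictlyInverseˡ l)))

  pullback : ChainGroup m
  pullback = record
    { Z          = λ z → Z (z ∘ from)
    ; Z-resp     = λ u≋v → Z-resp (u≋v ∘ from)
    ; Z-zero     = Z-zero
    ; Z-linear   = Z-linear
    ; elementary = λ {z} Zz (k , zk≢0) →
        let open Elementary (elementary Zz (to k , λ eq → zk≢0 (trans (cong z (sym (strictlyInverseʳ k))) eq)))
            l , yl≢0 = nonzero
        in record
          { y       = y ∘ to
          ; y∈Z     = lift y∈Z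
          ; ternary = ternary ∘ to
          ; nonzero = from l , λ eq → yl≢0 (trans (cong y (sym (strictlyInverseˡ l))) eq)
          ; support = λ k zk≡0 → support (to k) (trans (cong z (strictlyInverseʳ k)) zk≡0)
          }
    }

  pullback-spanned : Spanned S → Spanned pullback
  pullback-spanned sp = record
    { Z?     = λ z → Z? (z ∘ from)
    ; U      = λ l k → U (to l) (to k)
    ; U∈Z    = λ l → lift (U∈Z (to l))
    ; U-span = λ z Zz k → trans (cong z (sym (strictlyInverseʳ k)))
        (trans (U-span (z ∘ from) Zz (to k))
        (trans (sum-reindex σ (λ l → z (from l) * U l (to k)))
               (sum-cong (λ l → cong (λ x → z x * U (to l) (to k)) (strictlyInverseʳ l)))))
    }
    where open Spanned sp

-- Matroid isomorphisms induce unimodular equivalences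

gen-false : ∀ G k i → gen G (k , false) i ≡ - edge G k i
gen-false G k i = flip (unit (src G k) i) (unit (tgt G k) i)
  where
  flip : ∀ x y → y - x ≡ - (x - y)
  flip = solve-∀ ringℚ

net : ∀ {m} → (Fin m × Bool → ℚ) → Fin m → ℚ
net c k = c (k , true) - c (k , false)

comb-net : ∀ G c i → comb G c i ≡ sumF (λ k → net c k * edge G k i)
comb-net G c i = sum-cong (λ k → trans
  (cong (λ t → c (k , true) * edge G k i + c (k , false) * t) (gen-false G k i))
  (collect (c (k , true)) (c (k , false)) (edge G k i)))
  where
  collect : ∀ x y g → x * g + y * - g ≡ (x - y) * g
  collect = solve-∀ ringℚ

comb-cong : ∀ G {c c′} → (∀ g → c g ≡ c′ g) → comb G c ≋ comb G c′
comb-cong G c≗c′ i = sum-cong (λ k → cong₂ (λ x y → x * gen G (k , true) i + y * gen G (k , false) i)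
                                           (c≗c′ (k , true)) (c≗c′ (k , false)))

module SignedMap (G H : Graph) (σ : Fin (e G) ↔ Fin (e H)) (ε : Fin (e G) → Bool)
  (signed : ∀ z → Flow G z → Flow H (λ l → sgn (ε (Inverse.from σ l)) * z (Inverse.from σ l))) where

  open Inverse σ using (to; from; strictlyInverseʳ)
  open Potential G

  image : Fin (e G) → Vecℚ (n H)
  image k i = sgn (ε k) * edge H (to k) i

  f : Vecℚ (n G) → Vecℚ (n H)
  f x i = sumF (λ k → φ k x * image k i)

  -- Two expansions of x in edges differ by a flow of G, which `signed` turns into a flow of H; so
  -- `f` may be computed from any expansion.
  f-span : ∀ (a : Fin (e G) → ℚ) x → (∀ i → x i ≡ sumF (λ l → a l * edge G l i)) →
           ∀ i → f x i ≡ sumF (λ k → a k * image k i)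
  f-span a x x≡ i = sym (p-q≡0⇒p≡q (begin
    sumF (λ k → a k * image k i) - sumF (λ k → φ k x * image k i)
      ≡⟨ sum-- (λ k → a k * image k i) (λ k → φ k x * image k i) ⟨
    sumF (λ k → a k * image k i - φ k x * image k i)
      ≡⟨ sum-cong (λ k → collect (a k) (φ k x) (sgn (ε k)) (edge H (to k) i)) ⟩
    sumF (λ k → sgn (ε k) * z k * edge H (to k) i)
      ≡⟨ sum-cong (λ k → cong (λ j → sgn (ε j) * z j * edge H (to k) i) (strictlyInverseʳ k)) ⟨
    sumF (λ k → sgn (ε (from (to k))) * z (from (to k)) * edge H (to k) i)
      ≡⟨ sum-reindex σ (λ l → sgn (ε (from l)) * z (from l) * edge H l i) ⟨
    sumF (λ l → sgn (ε (from l)) * z (from l) * edge H l i)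
      ≡⟨ signed z flow i ⟩
    0ℚ ∎))
    where
    open ≡-Reasoning
    z : Fin (e G) → ℚ
    z k = a k - φ k x
    collect : ∀ a p s g → a * (s * g) - p * (s * g) ≡ s * (a - p) * g
    collect = solve-∀ ringℚ
    distribute : ∀ a p g → (a - p) * g ≡ a * g - p * g
    distribute = solve-∀ ringℚ
    flow : Flow G z
    flow j = trans (sum-cong (λ k → distribute (a k) (φ k x) (edge G k j)))
      (trans (sum-- (λ k → a k * edge G k j) (λ k → φ k x * edge G k j))
             (p≡q⇒p-q≡0 (trans (sym (x≡ j)) (sym (φ-reconstruct a x x≡ j)))))

  -- Reversing an edge exchanges its two generators and changes the sign of no weight, so convex
  -- combinations stay convex.
  push : (Gen G → ℚ) → Gen H → ℚ
  push c (l , b) = c (from l , ε (from l) ⊙ b)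

  push-sum : ∀ c → sumGen H (push c) ≡ sumGen G c
  push-sum c = trans (sum-reindex σ (λ l → push c (l , true) + push c (l , false)))
    (sum-cong (λ k → trans (cong (λ j → c (j , ε j ⊙ true) + c (j , ε j ⊙ false)) (strictlyInverseʳ k)) (either k)))
    where
    either : ∀ k → c (k , ε k ⊙ true) + c (k , ε k ⊙ false) ≡ c (k , true) + c (k , false)
    either k with ε k
    ... | true  = refl
    ... | false = ℚ.+-comm (c (k , false)) (c (k , true))

  f-comb : ∀ c x → x ≋ comb G c → f x ≋ comb H (push c)
  f-comb c x x≋ i = begin
    f x i
      ≡⟨ f-span (net c) x (λ j → trans (x≋ j) (comb-net G c j)) i ⟩
    sumF (λ k → net c k * image k i)
      ≡⟨ sum-cong (λ k → trans (either k) (cong (λ j → (c (j , ε j ⊙ true) - c (j , ε j ⊙ false)) * edge H (to k) i)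
                                                (sym (strictlyInverseʳ k)))) ⟩
    sumF (λ k → net (push c) (to k) * edge H (to k) i)
      ≡⟨ sum-reindex σ (λ l → net (push c) l * edge H l i) ⟨
    sumF (λ l → net (push c) l * edge H l i)
      ≡⟨ comb-net H (push c) i ⟨
    comb H (push c) i ∎
    where
    open ≡-Reasoning
    flip : ∀ x y g → (x - y) * (- 1ℚ * g) ≡ (y - x) * g
    flip = solve-∀ ringℚ
    either : ∀ k → net c k * image k i ≡ (c (k , ε k ⊙ true) - c (k , ε k ⊙ false)) * edge H (to k) i
    either k with ε k
    ... | true  = cong (net c k *_) (ℚ.*-identityˡ (edge H (to k) i))
    ... | false = flip (c (k , true)) (c (k , false)) (edge H (to k) i)

  f-aff : ∀ x → InAff G x → InAff H (f x)
  f-aff x (c , sum≡1 , x≋) = push c , trans (push-sum c) sum≡1 , f-comb c x x≋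

  f-polytope : ∀ x → InP G x → InP H (f x)
  f-polytope x (c , c≥0 , sum≡1 , x≋) =
    push c , (λ { (l , b) → c≥0 (from l , ε (from l) ⊙ b) }) , trans (push-sum c) sum≡1 , f-comb c x x≋

  f-cong : ∀ {x y} → x ≋ y → f x ≋ f y
  f-cong x≋y i = sum-cong (λ k → cong (_* image k i) (sum-cong (λ v → cong (P k v *_) (x≋y v))))

  f-affine : ∀ x y t → f (affComb t x y) ≋ affComb t (f x) (f y)
  f-affine x y t i = begin
    sumF (λ k → φ k (affComb t x y) * image k i)
      ≡⟨ sum-cong (λ k → trans (cong (_* image k i) (φ-affine k)) (distribute t (1ℚ - t) (φ k x) (φ k y) (image k i))) ⟩
    sumF (λ k → t * (φ k x * image k i) + (1ℚ - t) * (φ k y * image k i))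
      ≡⟨ sum-+ (λ k → t * (φ k x * image k i)) (λ k → (1ℚ - t) * (φ k y * image k i)) ⟩
    sumF (λ k → t * (φ k x * image k i)) + sumF (λ k → (1ℚ - t) * (φ k y * image k i))
      ≡⟨ cong₂ _+_ (sum-*ˡ t (λ k → φ k x * image k i)) (sum-*ˡ (1ℚ - t) (λ k → φ k y * image k i)) ⟩
    t * f x i + (1ℚ - t) * f y i ∎
    where
    open ≡-Reasoning
    distribute : ∀ t s a b g → (t * a + s * b) * g ≡ t * (a * g) + s * (b * g)
    distribute = solve-∀ ringℚ
    distribute′ : ∀ p t s a b → p * (t * a + s * b) ≡ t * (p * a) + s * (p * b)
    distribute′ = solve-∀ ringℚ
    φ-affine : ∀ k → φ k (affComb t x y) ≡ t * φ k x + (1ℚ - t) * φ k y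
    φ-affine k = trans (sum-cong (λ v → distribute′ (P k v) t (1ℚ - t) (x v) (y v)))
      (trans (sum-+ (λ v → t * (P k v * x v)) (λ v → (1ℚ - t) * (P k v * y v)))
             (cong₂ _+_ (sum-*ˡ t (λ v → P k v * x v)) (sum-*ˡ (1ℚ - t) (λ v → P k v * y v))))

  f-lattice : ∀ x → IsLattice x → IsLattice (f x)
  f-lattice x int i = isInt-sum (λ k → φ k x * image k i) (λ k → isInt-* (φ k x) (image k i)
    (isInt-sum (λ v → P k v * x v) (λ v → isInt-* (P k v) (x v) (integral k v) (int v)))
    (isInt-ternary (ternary-* (sgn-ternary (ε k)) (edge-ternary H (to k) i))))

⊙-cancel : ∀ x b → x ⊙ (x ⊙ b) ≡ b
⊙-cancel true  b     = refl
⊙-cancel false true  = refl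
⊙-cancel false false = refl

module _ (G H : Graph) (σ : Fin (e G) ↔ Fin (e H)) (ε : Fin (e G) → Bool)
  (signed  : ∀ z → Flow G z → Flow H (λ l → sgn (ε (Inverse.from σ l)) * z (Inverse.from σ l)))
  (signed′ : ∀ z → Flow H z → Flow G (λ k → sgn (ε (Inverse.from σ (Inverse.to σ k))) * z (Inverse.to σ k))) where

  open Inverse σ using (to; from; strictlyInverseˡ; strictlyInverseʳ)
  private
    module M  = SignedMap G H σ ε signed
    module M′ = SignedMap H G (↔-sym σ) (ε ∘ from) signed′

    back-forth : ∀ x → InAff G x → M′.f (M.f x) ≋ x
    back-forth x (c , _ , x≋) i = trans (M′.f-comb (M.push c) (M.f x) (M.f-comb c x x≋) i)
      (trans (comb-cong G {M′.push (M.push c)} {c} pushed i) (sym (x≋ i)))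
      where
      pushed : ∀ g → M′.push (M.push c) g ≡ c g
      pushed (k , b) rewrite strictlyInverseʳ k = cong (λ b → c (k , b)) (⊙-cancel (ε k) b)

    forth-back : ∀ y → InAff H y → M.f (M′.f y) ≋ y
    forth-back y (c , _ , y≋) i = trans (M.f-comb (M′.push c) (M′.f y) (M′.f-comb c y y≋) i)
      (trans (comb-cong H {M.push (M′.push c)} {c} pushed i) (sym (y≋ i)))
      where
      pushed : ∀ g → M.push (M′.push c) g ≡ c g
      pushed (l , b) rewrite strictlyInverseˡ l = cong (λ b → c (l , b)) (⊙-cancel (ε (from l)) b)

    InP⇒InAff : ∀ {G x} → InP G x → InAff G x
    InP⇒InAff (c , _ , sum≡1 , x≋) = c , sum≡1 , x≋

    lattice-cong : ∀ {m} {x y : Vecℚ m} → x ≋ y → IsLattice x → IsLattice y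
    lattice-cong x≋y int i = subst IsInt (x≋y i) (int i)

  signed⇒unimodular : UnimodEquiv G H
  signed⇒unimodular =
      M.f
    , M.f-aff
    , (λ x y t _ _ → M.f-affine x y t)
    , (λ x y x∈ y∈ fx≋fy i → trans (sym (back-forth x x∈ i)) (trans (M′.f-cong fx≋fy i) (back-forth y y∈ i)))
    , (λ y y∈ → M′.f y , M′.f-aff y y∈ , forth-back y y∈)
    , (λ x x∈ → mk⇔ (M.f-lattice x) (λ int → lattice-cong (back-forth x x∈) (M′.f-lattice (M.f x) int)))
    , M.f-polytope
    , (λ y y∈ → M′.f y , M′.f-polytope y y∈ , forth-back y (InP⇒InAff {H} y∈))

module _ (G H : Graph) (iso : MatroidIso G H) where
  private
    σ = proj₁ iso
    S = cycleSpace G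
    module PB = Pullback σ (cycleSpace H)
    S′ = PB.pullback
  open Inverse σ using (to; from; strictlyInverseˡ; strictlyInverseʳ)

  -- A cycle in the support of z refutes independence in G, hence in H, which yields a cycle of H up
  -- to double negation; the flow around it is the required chain.
  G⊆H : Dependents⊆ S S′
  G⊆H z flow nonzero k = (λ indep → Equivalence.from (proj₂ iso (supp z)) indep (Walk.cycle G flow (supp z) (∈supp z) nonzero))
    λ C → let open FromCycle H C using (y; y-flow; y-nonzero; y-support) in
      k (y ∘ to , PB.lift {y} y-flow
        , (from (proj₁ y-nonzero) , λ eq → proj₂ y-nonzero (trans (cong y (sym (strictlyInverseˡ _))) eq))
        , off-supp z (y ∘ to) (λ j ≢0 → ∈transported⁻¹ σ (supp z) j (y-support (to j) ≢0)))

  H⊆G : Dependents⊆ S′ S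
  H⊆G z flow (j , zj≢0) k = (λ indep → Equivalence.to (proj₂ iso (supp z)) indep
      (Walk.cycle H flow (transported σ (supp z)) (λ l ≢0 → ∈transported σ (supp z) l (∈supp z (from l) ≢0))
        (to j , λ eq → zj≢0 (trans (cong z (sym (strictlyInverseʳ j))) eq))))
    λ C → let open FromCycle G C using (y; y-flow; y-nonzero; y-support) in k (y , y-flow , y-nonzero , off-supp z y y-support)

  matroid⇒unimodular : UnimodEquiv G H
  matroid⇒unimodular =
    let ε , good , good′ = signing S S′ (cycleSpace-spanned G) (PB.pullback-spanned (cycleSpace-spanned H)) G⊆H H⊆G
        lift′ : ∀ z → Flow H z → Flow G (λ k → sgn (ε (from (to k))) * z (to k))
        lift′ z flow = ChainGroup.Z-resp S (λ k → cong (λ j → sgn (ε j) * z (to k)) (sym (strictlyInverseʳ k)))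
                         (good′ (z ∘ to) (PB.lift {z} flow))
    in signed⇒unimodular G H σ ε good lift′

-- The generators are the vertices of the polytope

sum-mono : ∀ {m} {f g : Fin m → ℚ} → (∀ i → f i ≤ g i) → sumF f ≤ sumF g
sum-mono {zero}  f≤g = ℚ.≤-refl
sum-mono {suc m} f≤g = ℚ.+-mono-≤ (f≤g zero) (sum-mono (f≤g ∘ suc))

+-zero-≥0 : ∀ {p q} → 0ℚ ≤ p → 0ℚ ≤ q → p + q ≡ 0ℚ → p ≡ 0ℚ × q ≡ 0ℚ
+-zero-≥0 {p} {q} 0≤p 0≤q eq =
    ℚ.≤-antisym (subst₂ _≤_ (ℚ.+-identityʳ p) eq (ℚ.+-monoʳ-≤ p 0≤q)) 0≤p
  , ℚ.≤-antisym (subst₂ _≤_ (ℚ.+-identityˡ q) eq (ℚ.+-monoˡ-≤ q 0≤p)) 0≤q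

sum-≥0 : ∀ {m} {f : Fin m → ℚ} → (∀ i → 0ℚ ≤ f i) → 0ℚ ≤ sumF f
sum-≥0 {m} {f} 0≤f = subst (_≤ sumF f) (sum-zero {m} {λ _ → 0ℚ} (λ _ → refl)) (sum-mono 0≤f)

sum-zero-≥0 : ∀ {m} {f : Fin m → ℚ} → (∀ i → 0ℚ ≤ f i) → sumF f ≡ 0ℚ → ∀ i → f i ≡ 0ℚ
sum-zero-≥0 0≤f eq zero    = proj₁ (+-zero-≥0 (0≤f zero) (sum-≥0 (0≤f ∘ suc)) eq)
sum-zero-≥0 0≤f eq (suc i) = sum-zero-≥0 (0≤f ∘ suc) (proj₂ (+-zero-≥0 (0≤f zero) (sum-≥0 (0≤f ∘ suc)) eq)) i

+-≥0 : ∀ {p q} → 0ℚ ≤ p → 0ℚ ≤ q → 0ℚ ≤ p + q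
+-≥0 {p} {q} 0≤p 0≤q = subst (_≤ p + q) (ℚ.+-identityˡ 0ℚ) (ℚ.+-mono-≤ 0≤p 0≤q)

*-≥0 : ∀ {p q} → 0ℚ ≤ p → 0ℚ ≤ q → 0ℚ ≤ p * q
*-≥0 {p} {q} 0≤p 0≤q = subst (_≤ p * q) (ℚ.*-zeroʳ p) (ℚ.*-monoˡ-≤-nonNeg p {{nonNegative 0≤p}} 0≤q)

sumGen-zero-≥0 : ∀ G {f : Gen G → ℚ} → (∀ g → 0ℚ ≤ f g) → sumGen G f ≡ 0ℚ → ∀ g → f g ≡ 0ℚ
sumGen-zero-≥0 G {f} 0≤f eq (k , b) = pick b (+-zero-≥0 (0≤f (k , true)) (0≤f (k , false))
  (sum-zero-≥0 (λ k → +-≥0 (0≤f (k , true)) (0≤f (k , false))) eq k))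
  where
  pick : ∀ b → f (k , true) ≡ 0ℚ × f (k , false) ≡ 0ℚ → f (k , b) ≡ 0ℚ
  pick true  = proj₁
  pick false = proj₂

sumGen-cong : ∀ G {f g : Gen G → ℚ} → (∀ x → f x ≡ g x) → sumGen G f ≡ sumGen G g
sumGen-cong G f≗g = sum-cong (λ k → cong₂ _+_ (f≗g (k , true)) (f≗g (k , false)))

sumGen-*ʳ : ∀ G (f : Gen G → ℚ) t → sumGen G (λ g → f g * t) ≡ sumGen G f * t
sumGen-*ʳ G f t = trans (sum-cong (λ k → sym (ℚ.*-distribʳ-+ t (f (k , true)) (f (k , false)))))
                        (sum-*ʳ t (λ k → f (k , true) + f (k , false)))

sumGen-- : ∀ G (f g : Gen G → ℚ) → sumGen G (λ x → f x - g x) ≡ sumGen G f - sumGen G g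
sumGen-- G f g = trans
  (sum-cong (λ k → interchange (f (k , true)) (g (k , true)) (f (k , false)) (g (k , false))))
  (sum-- (λ k → f (k , true) + f (k , false)) (λ k → g (k , true) + g (k , false)))
  where
  interchange : ∀ a b c d → (a - b) + (c - d) ≡ (a + c) - (b + d)
  interchange = solve-∀ ringℚ

module Vertices (G : Graph) where

  start end : Gen G → Fin (n G)
  start (k , true)  = src G k
  start (k , false) = tgt G k
  end   (k , true)  = tgt G k
  end   (k , false) = src G k

  gen-ends : ∀ g i → gen G g i ≡ unit (start g) i - unit (end g) i
  gen-ends (k , true)  i = refl
  gen-ends (k , false) i = refl

  ends-injective : ∀ g g′ → start g ≡ start g′ → end g ≡ end g′ → g ≡ g′
  ends-injective (k , true)  (k′ , true)  s t = cong (_, true)  (joins-unique G (inj₁ refl) (inj₁ (sym (cong₂ _,_ s t))))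
  ends-injective (k , false) (k′ , false) s t = cong (_, false) (joins-unique G (inj₁ refl) (inj₁ (sym (cong₂ _,_ t s))))
  ends-injective (k , true)  (k′ , false) s t with joins-unique G {k} {k′} (inj₁ refl) (inj₂ (sym (cong₂ _,_ t s)))
  ... | refl = contradiction s (src≢tgt G k)
  ends-injective (k , false) (k′ , true)  s t with joins-unique G {k} {k′} (inj₁ refl) (inj₂ (sym (cong₂ _,_ s t)))
  ... | refl = contradiction t (src≢tgt G k)

  -- The functional x ↦ x u - x v exposes the vertex unit u - unit v.
  height : Gen G → Vecℚ (n G) → ℚ
  height g x = x (start g) - x (end g)

  _≟g_ : (g g′ : Gen G) → Dec (g ≡ g′)
  _≟g_ = ≡-dec Fin._≟_ Bool._≟_

  private
    start≢end : ∀ g → start g ≢ end g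
    start≢end (k , true)  = src≢tgt G k
    start≢end (k , false) = src≢tgt G k ∘ sym

    bound : ∀ a b c d → ¬ (a ≡ true × d ≡ true) →
      let ι : Bool → ℚ
          ι x = if x then 1ℚ else 0ℚ
      in (ι a - ι b) - (ι c - ι d) ≤ 1ℚ
    bound true  b     c     true  ¬both = contradiction (refl , refl) ¬both
    bound true  true  true  false _ = ℚ.≤ᵇ⇒≤ tt
    bound true  true  false false _ = ℚ.≤ᵇ⇒≤ tt
    bound true  false true  false _ = ℚ.≤ᵇ⇒≤ tt
    bound true  false false false _ = ℚ.≤ᵇ⇒≤ tt
    bound false true  true  true  _ = ℚ.≤ᵇ⇒≤ tt
    bound false true  true  false _ = ℚ.≤ᵇ⇒≤ tt
    bound false true  false true  _ = ℚ.≤ᵇ⇒≤ tt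
    bound false true  false false _ = ℚ.≤ᵇ⇒≤ tt
    bound false false true  true  _ = ℚ.≤ᵇ⇒≤ tt
    bound false false true  false _ = ℚ.≤ᵇ⇒≤ tt
    bound false false false true  _ = ℚ.≤ᵇ⇒≤ tt
    bound false false false false _ = ℚ.≤ᵇ⇒≤ tt

    does-true : ∀ {A : Set} (d : Dec A) → does d ≡ true → A
    does-true (yes a) _ = a

  height-self : ∀ g → height g (gen G g) ≡ 2ℚ
  height-self g = cong₂ _-_
    (trans (gen-ends g (start g)) (cong₂ _-_ (unit-same (start g)) (unit-other (start≢end g ∘ sym))))
    (trans (gen-ends g (end g)) (cong₂ _-_ (unit-other (start≢end g)) (unit-same (end g))))

  height-other : ∀ g g′ → g′ ≢ g → height g (gen G g′) ≤ 1ℚ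
  height-other g g′ g′≢g = subst (_≤ 1ℚ) (sym (cong₂ _-_ (gen-ends g′ (start g)) (gen-ends g′ (end g))))
    (bound (does (start g′ Fin.≟ start g)) (does (end g′ Fin.≟ start g))
           (does (start g′ Fin.≟ end g)) (does (end g′ Fin.≟ end g))
           (λ (p , q) → g′≢g (ends-injective g′ g (does-true (start g′ Fin.≟ start g) p) (does-true (end g′ Fin.≟ end g) q))))

  gen-injective : ∀ g g′ → gen G g ≋ gen G g′ → g ≡ g′
  gen-injective g g′ eq with g′ ≟g g
  ... | yes g′≡g = sym g′≡g
  ... | no g′≢g  = contradiction
    (subst (_≤ 1ℚ) (trans (sym (cong₂ _-_ (eq (start g)) (eq (end g)))) (height-self g)) (height-other g g′ g′≢g))
    (from-no (2ℚ ℚ.≤? 1ℚ))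

  -- Nonnegative on the polytope and 0 only at the vertex g, since the height is 2 there and at most
  -- 1 at every other generator.
  slack : Gen G → Vecℚ (n G) → ℚ
  slack g x = 2ℚ - height g x

  private
    p≤q⇒0≤q-p : ∀ {p q} → p ≤ q → 0ℚ ≤ q - p
    p≤q⇒0≤q-p {p} {q} p≤q = subst (_≤ q - p) (ℚ.+-inverseʳ p) (ℚ.+-monoˡ-≤ (- p) p≤q)

    slack-gen : ∀ g g′ → 0ℚ ≤ slack g (gen G g′)
    slack-gen g g′ with g′ ≟g g
    ... | yes refl = subst (λ t → 0ℚ ≤ 2ℚ - t) (sym (height-self g)) ℚ.≤-refl
    ... | no g′≢g  = p≤q⇒0≤q-p (ℚ.≤-trans (height-other g g′ g′≢g) (from-yes (1ℚ ℚ.≤? 2ℚ)))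

    slack-gen≢0 : ∀ g g′ → g′ ≢ g → slack g (gen G g′) ≢ 0ℚ
    slack-gen≢0 g g′ g′≢g eq = contradiction
      (subst (_≤ 1ℚ) (sym (p-q≡0⇒p≡q eq)) (height-other g g′ g′≢g)) (from-no (2ℚ ℚ.≤? 1ℚ))

  slack-comb : ∀ (I : Graph) g (c : Gen I → ℚ) (y : Gen I → Vecℚ (n G)) x → sumGen I c ≡ 1ℚ →
    (∀ i → x i ≡ sumGen I (λ h → c h * y h i)) → slack g x ≡ sumGen I (λ h → c h * slack g (y h))
  slack-comb I g c y x sum≡1 x≡ = sym (begin
    sumGen I (λ h → c h * slack g (y h))
      ≡⟨ sumGen-cong I (λ h → distribute (c h) 2ℚ (y h (start g)) (y h (end g))) ⟩
    sumGen I (λ h → c h * 2ℚ - (c h * y h (start g) - c h * y h (end g)))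
      ≡⟨ sumGen-- I (λ h → c h * 2ℚ) (λ h → c h * y h (start g) - c h * y h (end g)) ⟩
    sumGen I (λ h → c h * 2ℚ) - sumGen I (λ h → c h * y h (start g) - c h * y h (end g))
      ≡⟨ cong₂ _-_ (trans (sumGen-*ʳ I c 2ℚ) (cong (_* 2ℚ) sum≡1))
                   (trans (sumGen-- I (λ h → c h * y h (start g)) (λ h → c h * y h (end g)))
                          (sym (cong₂ _-_ (x≡ (start g)) (x≡ (end g))))) ⟩
    slack g x ∎)
    where
    open ≡-Reasoning
    distribute : ∀ c t a b → c * (t - (a - b)) ≡ c * t - (c * a - c * b)
    distribute = solve-∀ ringℚ

  slack-InP : ∀ g x → InP G x → 0ℚ ≤ slack g x
  slack-InP g x (c , c≥0 , sum≡1 , x≋) = subst (0ℚ ≤_) (sym (slack-comb G g c (gen G) x sum≡1 x≋))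
    (sum-≥0 (λ k → +-≥0 (term (k , true)) (term (k , false))))
    where
    term : ∀ g′ → 0ℚ ≤ c g′ * slack g (gen G g′)
    term g′ = *-≥0 (c≥0 g′) (slack-gen g g′)

  slack-zero : ∀ g x → InP G x → slack g x ≡ 0ℚ → x ≋ gen G g
  slack-zero g x (c , c≥0 , sum≡1 , x≋) eq i = begin
    x i                                ≡⟨ x≋ i ⟩
    sumGen G (λ g′ → c g′ * gen G g′ i) ≡⟨ sumGen-cong G same ⟩
    sumGen G (λ g′ → c g′ * gen G g i)  ≡⟨ sumGen-*ʳ G c (gen G g i) ⟩
    sumGen G c * gen G g i             ≡⟨ cong (_* gen G g i) sum≡1 ⟩
    1ℚ * gen G g i                     ≡⟨ ℚ.*-identityˡ (gen G g i) ⟩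
    gen G g i                          ∎
    where
    open ≡-Reasoning
    vanish : ∀ g′ → c g′ * slack g (gen G g′) ≡ 0ℚ
    vanish = sumGen-zero-≥0 G (λ g′ → *-≥0 (c≥0 g′) (slack-gen g g′))
               (trans (sym (slack-comb G g c (gen G) x sum≡1 x≋)) eq)
    same : ∀ g′ → c g′ * gen G g′ i ≡ c g′ * gen G g i
    same g′ with g′ ≟g g
    ... | yes refl = refl
    ... | no g′≢g  = trans (cong (_* gen G g′ i) c≡0) (trans (ℚ.*-zeroˡ (gen G g′ i))
                       (sym (trans (cong (_* gen G g i) c≡0) (ℚ.*-zeroˡ (gen G g i)))))
      where
      c≡0 : c g′ ≡ 0ℚ
      c≡0 = *-cancel-0 (slack-gen≢0 g g′ g′≢g) (trans (ℚ.*-comm (slack g (gen G g′)) (c g′)) (vanish g′))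

  sumGen-nonzero : ∀ (I : Graph) (c : Gen I → ℚ) → sumGen I c ≡ 1ℚ → ∃ λ h → c h ≢ 0ℚ
  sumGen-nonzero I c sum≡1 with Fin.any? (λ k → ¬? (c (k , true) ℚ.≟ 0ℚ)) | Fin.any? (λ k → ¬? (c (k , false) ℚ.≟ 0ℚ))
  ... | yes (k , ≢0) | _            = (k , true) , ≢0
  ... | no _         | yes (k , ≢0) = (k , false) , ≢0
  ... | no none      | no none′     = contradiction (trans (sym zero-sum) sum≡1) 0≢1
    where
    stable : ∀ (b : Bool) → ¬ (∃ λ k → c (k , b) ≢ 0ℚ) → ∀ k → c (k , b) ≡ 0ℚ
    stable b none k with c (k , b) ℚ.≟ 0ℚ
    ... | yes eq = eq
    ... | no ≢0  = contradiction (k , ≢0) none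
    zero-sum : sumGen I c ≡ 0ℚ
    zero-sum = sum-zero (λ k → trans (cong₂ _+_ (stable true none k) (stable false none′ k)) refl)

  -- `slack g` is affine, nonnegative on the polytope and 0 at g, so every point of nonzero weight
  -- has slack 0. The weights are indexed by a graph I of their own because the generators of one
  -- graph will index points in the polytope of the other.
  extreme : ∀ (I : Graph) g (c : Gen I → ℚ) (y : Gen I → Vecℚ (n G)) → (∀ h → 0ℚ ≤ c h) → sumGen I c ≡ 1ℚ →
    (∀ h → InP G (y h)) → (∀ i → gen G g i ≡ sumGen I (λ h → c h * y h i)) → ∃ λ h → y h ≋ gen G g
  extreme I g c y c≥0 sum≡1 y∈ g≡ =
    let h , c≢0 = sumGen-nonzero I c sum≡1
    in h , slack-zero g (y h) (y∈ h) (*-cancel-0 c≢0 (sumGen-zero-≥0 I (λ h → *-≥0 (c≥0 h) (slack-InP g (y h) (y∈ h)))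
             (trans (sym (slack-comb I g c y (gen G g) sum≡1 g≡)) (p≡q⇒p-q≡0 (sym (height-self g)))) h))

  indicator : Gen G → Gen G → ℚ
  indicator (k , true)  (k′ , b) = if b then unit k k′ else 0ℚ
  indicator (k , false) (k′ , b) = if b then 0ℚ else unit k k′

  private
    unit-≥0 : ∀ {m} (u i : Fin m) → 0ℚ ≤ unit u i
    unit-≥0 u i with does (u Fin.≟ i)
    ... | true  = from-yes (0ℚ ℚ.≤? 1ℚ)
    ... | false = ℚ.≤-refl

    sum-unit : ∀ {m} (u : Fin m) → sumF (unit u) ≡ 1ℚ
    sum-unit u = trans (sum-cong (λ i → sym (ℚ.*-identityˡ (unit u i)))) (sum-unitʳ (λ _ → 1ℚ) u)

  gen∈P : ∀ g → InP G (gen G g)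
  gen∈P (k , true) = indicator (k , true) , ≥0
    , trans (sum-cong (λ k′ → ℚ.+-identityʳ (unit k k′))) (sum-unit k)
    , λ i → sym (trans (sum-cong (λ k′ → drop (unit k k′) (gen G (k′ , true) i) (gen G (k′ , false) i)))
                       (sum-unitʳ (λ k′ → gen G (k′ , true) i) k))
    where
    ≥0 : ∀ g → 0ℚ ≤ indicator (k , true) g
    ≥0 (k′ , true)  = unit-≥0 k k′
    ≥0 (k′ , false) = ℚ.≤-refl
    drop : ∀ u x y → u * x + 0ℚ * y ≡ x * u
    drop = solve-∀ ringℚ
  gen∈P (k , false) = indicator (k , false) , ≥0
    , trans (sum-cong (λ k′ → ℚ.+-identityˡ (unit k k′))) (sum-unit k)
    , λ i → sym (trans (sum-cong (λ k′ → drop (unit k k′) (gen G (k′ , true) i) (gen G (k′ , false) i)))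
                       (sum-unitʳ (λ k′ → gen G (k′ , false) i) k))
    where
    ≥0 : ∀ g → 0ℚ ≤ indicator (k , false) g
    ≥0 (k′ , true)  = ℚ.≤-refl
    ≥0 (k′ , false) = unit-≥0 k k′
    drop : ∀ u x y → 0ℚ * x + u * y ≡ y * u
    drop = solve-∀ ringℚ

  opp : Gen G → Gen G
  opp (k , b) = k , not b

  gen-opp : ∀ g i → gen G (opp g) i ≡ - gen G g i
  gen-opp (k , true)  i = gen-false G k i
  gen-opp (k , false) i = flip (unit (src G k) i) (unit (tgt G k) i)
    where
    flip : ∀ x y → x - y ≡ - (y - x)
    flip = solve-∀ ringℚ

  gen-ternary : ∀ g i → Ternary (gen G g i)
  gen-ternary (k , true)  i = edge-ternary G k i
  gen-ternary (k , false) i = subst Ternary (sym (gen-false G k i)) (ternary-neg (edge-ternary G k i))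

-- Unimodular equivalences induce matroid isomorphisms

isInt-affine⇒const : ∀ p q → (∀ t → IsInt (t * p + (1ℚ - t) * q)) → p ≡ q
isInt-affine⇒const p q int with (p - q) ℚ.≟ 0ℚ
... | yes eq = p-q≡0⇒p≡q eq
... | no d≢0 = contradiction (subst IsInt half (isInt-+ (t * p + (1ℚ - t) * q) (- (0ℚ * p + (1ℚ - 0ℚ) * q)) (int t)
                               (isInt-neg (0ℚ * p + (1ℚ - 0ℚ) * q) (int 0ℚ)))) λ ()
  where
  instance _ = ≢-nonZero d≢0
  t : ℚ
  -- At this t the value differs by ½ from the value at 0.
  t = ½ * 1/ (p - q)
  rearrange : ∀ t p q → (t * p + (1ℚ - t) * q) - (0ℚ * p + (1ℚ - 0ℚ) * q) ≡ t * (p - q)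
  rearrange = solve-∀ ringℚ
  half : (t * p + (1ℚ - t) * q) - (0ℚ * p + (1ℚ - 0ℚ) * q) ≡ ½
  half = trans (rearrange t p q) (trans (ℚ.*-assoc ½ (1/ (p - q)) (p - q))
    (trans (cong (½ *_) (ℚ.*-inverseˡ (p - q))) (ℚ.*-identityʳ ½)))

Span : (G : Graph) → Vecℚ (n G) → Set
Span G x = Σ (Fin (e G) → ℚ) λ a → ∀ i → x i ≡ sumF (λ k → a k * edge G k i)

aff⇒span : ∀ G {x} → InAff G x → Span G x
aff⇒span G (c , _ , x≋) = net c , λ i → trans (x≋ i) (comb-net G c i)

-- Equal weights on the two orientations of `k₀` cancel in the combination, so they can supply
-- whatever total weight is missing.
span⇒aff : ∀ G → Fin (e G) → ∀ {x} → Span G x → InAff G x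
span⇒aff G k₀ {x} (a , x≡) = c , sum≡1 , λ i → trans (x≡ i) (sym (trans (comb-net G c i)
    (sum-cong (λ k → cong (_* edge G k i) (cancel (a k) (t * unit k₀ k))))))
  where
  t : ℚ
  t = ½ * (1ℚ - sumF a)
  c : Gen G → ℚ
  c (k , true)  = a k + t * unit k₀ k
  c (k , false) = t * unit k₀ k
  cancel : ∀ a b → (a + b) - b ≡ a
  cancel = solve-∀ ringℚ
  double : ∀ a b → (a + b) + b ≡ a + (b + b)
  double = solve-∀ ringℚ
  halves : ∀ s → s + (½ * (1ℚ - s) + ½ * (1ℚ - s)) ≡ 1ℚ
  halves = solve-∀ ringℚ
  sum≡1 : sumGen G c ≡ 1ℚ
  sum≡1 = begin
    sumF (λ k → (a k + t * unit k₀ k) + t * unit k₀ k)   ≡⟨ sum-cong (λ k → double (a k) (t * unit k₀ k)) ⟩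
    sumF (λ k → a k + (t * unit k₀ k + t * unit k₀ k))   ≡⟨ sum-+ a (λ k → t * unit k₀ k + t * unit k₀ k) ⟩
    sumF a + sumF (λ k → t * unit k₀ k + t * unit k₀ k)  ≡⟨ cong (sumF a +_) (sum-+ (λ k → t * unit k₀ k) (λ k → t * unit k₀ k)) ⟩
    sumF a + (sumF (λ k → t * unit k₀ k) + sumF (λ k → t * unit k₀ k))
      ≡⟨ cong (λ s → sumF a + (s + s)) (sum-unitʳ (λ _ → t) k₀) ⟩
    sumF a + (t + t)                                     ≡⟨ halves (sumF a) ⟩
    1ℚ                                                   ∎
    where open ≡-Reasoning

span-zero : ∀ G → Span G (λ _ → 0ℚ)
span-zero G = (λ _ → 0ℚ) , λ i → sym (sum-zero (λ k → ℚ.*-zeroˡ (edge G k i)))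

span-resp : ∀ G {x y} → x ≋ y → Span G x → Span G y
span-resp G x≋y (a , x≡) = a , λ i → trans (sym (x≋y i)) (x≡ i)

span-linear : ∀ G {x y} t → Span G x → Span G y → Span G (λ i → x i + t * y i)
span-linear G {x} {y} t (a , x≡) (b , y≡) = (λ k → a k + t * b k) , λ i → begin
  x i + t * y i
    ≡⟨ cong₂ (λ x y → x + t * y) (x≡ i) (y≡ i) ⟩
  sumF (λ k → a k * edge G k i) + t * sumF (λ k → b k * edge G k i)
    ≡⟨ cong (sumF (λ k → a k * edge G k i) +_) (sum-*ˡ t (λ k → b k * edge G k i)) ⟨
  sumF (λ k → a k * edge G k i) + sumF (λ k → t * (b k * edge G k i))
    ≡⟨ sum-+ (λ k → a k * edge G k i) (λ k → t * (b k * edge G k i)) ⟨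
  sumF (λ k → a k * edge G k i + t * (b k * edge G k i))
    ≡⟨ sum-cong (λ k → collect (a k) (edge G k i) t (b k)) ⟩
  sumF (λ k → (a k + t * b k) * edge G k i) ∎
  where
  open ≡-Reasoning
  collect : ∀ a g t b → a * g + t * (b * g) ≡ (a + t * b) * g
  collect = solve-∀ ringℚ

span-scale : ∀ G {x} t → Span G x → Span G (λ i → t * x i)
span-scale G {x} t x∈ = span-resp G (λ i → ℚ.+-identityˡ (t * x i)) (span-linear G t (span-zero G) x∈)

span-affComb : ∀ G {x y} t → Span G x → Span G y → Span G (affComb t x y)
span-affComb G t x∈ y∈ = span-linear G (1ℚ - t) (span-scale G t x∈) y∈

span-sum : ∀ G {m} (a : Fin m → ℚ) (X : Fin m → Vecℚ (n G)) → (∀ k → Span G (X k)) →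
           Span G (λ i → sumF (λ k → a k * X k i))
span-sum G {zero}  a X X∈ = span-zero G
span-sum G {suc m} a X X∈ = span-resp G (λ i → ℚ.+-comm (sumF (λ k → a (suc k) * X (suc k) i)) (a zero * X zero i))
  (span-linear G (a zero) (span-sum G (a ∘ suc) (X ∘ suc) (X∈ ∘ suc)) (X∈ zero))

span-gen : ∀ G g → Span G (gen G g)
span-gen G g = let c , _ , sum≡1 , x≋ = Vertices.gen∈P G g in aff⇒span G (c , sum≡1 , x≋)

module FromUnimodular (G H : Graph) (k₀ : Fin (e G)) (eqv : UnimodEquiv G H) where
  private
    f         = proj₁ eqv
    affine    = proj₁ (proj₂ (proj₂ eqv))
    injective = proj₁ (proj₂ (proj₂ (proj₂ eqv)))
    lattice   = proj₁ (proj₂ (proj₂ (proj₂ (proj₂ (proj₂ eqv)))))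
    polytope  = proj₁ (proj₂ (proj₂ (proj₂ (proj₂ (proj₂ (proj₂ eqv))))))
    polytope⁻ = proj₂ (proj₂ (proj₂ (proj₂ (proj₂ (proj₂ (proj₂ eqv))))))

    module VG = Vertices G
    module VH = Vertices H

    aff : ∀ {x} → Span G x → InAff G x
    aff = span⇒aff G k₀

    f-affine : ∀ {x y} t → Span G x → Span G y → f (affComb t x y) ≋ affComb t (f x) (f y)
    f-affine {x} {y} t x∈ y∈ = affine x y t (aff x∈) (aff y∈)

  -- Not assumed of f.  Reflecting x in a lattice point o and averaging turns two names x, x′ of
  -- one point into two names of o; then the line between their images has only lattice points.
  f-cong : ∀ {x x′} → Span G x → x ≋ x′ → f x ≋ f x′
  f-cong {x} {x′} x∈ x≋x′ i = *-cancel-half {f x i} {f x′ i} {f u i} (begin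
    ½ * f x i + (1ℚ - ½) * f u i    ≡⟨ f-affine ½ x∈ u∈ i ⟨
    f p i                           ≡⟨ isInt-affine⇒const (f p i) (f p′ i) line ⟩
    f p′ i                          ≡⟨ f-affine ½ x′∈ u∈ i ⟩
    ½ * f x′ i + (1ℚ - ½) * f u i   ∎)
    where
    open ≡-Reasoning
    o u p p′ : Vecℚ (n G)
    o  = edge G k₀
    u  = affComb 2ℚ o x
    p  = affComb ½ x u
    p′ = affComb ½ x′ u
    o∈ = span-gen G (k₀ , true)
    x′∈ = span-resp G x≋x′ x∈
    u∈ = span-affComb G 2ℚ o∈ x∈
    p∈ = span-affComb G ½ x∈ u∈
    p′∈ = span-affComb G ½ x′∈ u∈
    reflect : ∀ o x → ½ * x + (1ℚ - ½) * (2ℚ * o + (1ℚ - 2ℚ) * x) ≡ o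
    reflect = solve-∀ ringℚ
    idem : ∀ t o → t * o + (1ℚ - t) * o ≡ o
    idem = solve-∀ ringℚ
    p≋o : p ≋ o
    p≋o j = reflect (o j) (x j)
    p′≋o : p′ ≋ o
    p′≋o j = trans (cong (λ y → ½ * y + (1ℚ - ½) * u j) (sym (x≋x′ j))) (p≋o j)
    line : ∀ t → IsInt (t * f p i + (1ℚ - t) * f p′ i)
    line t = subst IsInt (f-affine t p∈ p′∈ i) (Equivalence.to (lattice (affComb t p p′) (aff (span-affComb G t p∈ p′∈)))
      (λ j → subst IsInt (sym (trans (cong₂ (λ y z → t * y + (1ℚ - t) * z) (p≋o j) (p′≋o j)) (idem t (o j))))
                         (isInt-ternary (edge-ternary G k₀ j))) i)
    *-cancel-half : ∀ {a b c} → ½ * a + (1ℚ - ½) * c ≡ ½ * b + (1ℚ - ½) * c → a ≡ b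
    *-cancel-half {a} {b} {c} eq = trans (recover a c) (trans (cong (λ t → 2ℚ * (t - ½ * c)) eq) (sym (recover b c)))
      where
      recover : ∀ a c → a ≡ 2ℚ * ((½ * a + (1ℚ - ½) * c) - ½ * c)
      recover = solve-∀ ringℚ

  f₀ : Vecℚ (n H)
  f₀ = f (λ _ → 0ℚ)

  f-scale : ∀ {x} t → Span G x → ∀ i → f (λ i → t * x i) i ≡ t * f x i + (1ℚ - t) * f₀ i
  f-scale {x} t x∈ i = trans (f-cong (span-scale G t x∈) (λ j → sym (drop t (x j))) i) (f-affine t x∈ (span-zero G) i)
    where
    drop : ∀ t x → t * x + (1ℚ - t) * 0ℚ ≡ t * x
    drop = solve-∀ ringℚ

  -- The origin is not yet known to be fixed, hence the `f₀`. Affine combinations of two points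
  -- suffice: x + t y is the midpoint of 2 x and 2 t y.
  f-linear : ∀ {x y} t → Span G x → Span G y → ∀ i → f (λ i → x i + t * y i) i ≡ f x i + t * (f y i - f₀ i)
  f-linear {x} {y} t x∈ y∈ i = begin
    f (λ i → x i + t * y i) i
      ≡⟨ f-cong (span-linear G t x∈ y∈) (λ j → midpoint (x j) t (y j)) i ⟩
    f (affComb ½ (λ i → 2ℚ * x i) (λ i → 2ℚ * t * y i)) i
      ≡⟨ f-affine ½ (span-scale G 2ℚ x∈) (span-scale G (2ℚ * t) y∈) i ⟩
    ½ * f (λ i → 2ℚ * x i) i + (1ℚ - ½) * f (λ i → 2ℚ * t * y i) i
      ≡⟨ cong₂ (λ a b → ½ * a + (1ℚ - ½) * b) (f-scale 2ℚ x∈ i) (f-scale (2ℚ * t) y∈ i) ⟩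
    ½ * (2ℚ * f x i + (1ℚ - 2ℚ) * f₀ i) + (1ℚ - ½) * (2ℚ * t * f y i + (1ℚ - 2ℚ * t) * f₀ i)
      ≡⟨ simplify (f x i) t (f y i) (f₀ i) ⟩
    f x i + t * (f y i - f₀ i) ∎
    where
    open ≡-Reasoning
    midpoint : ∀ x t y → x + t * y ≡ ½ * (2ℚ * x) + (1ℚ - ½) * (2ℚ * t * y)
    midpoint = solve-∀ ringℚ
    simplify : ∀ a t b z → ½ * (2ℚ * a + (1ℚ - 2ℚ) * z) + (1ℚ - ½) * (2ℚ * t * b + (1ℚ - 2ℚ * t) * z) ≡ a + t * (b - z)
    simplify = solve-∀ ringℚ

  f-sum : ∀ {m} (a : Fin m → ℚ) (X : Fin m → Vecℚ (n G)) → (∀ k → Span G (X k)) → ∀ i →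
          f (λ i → sumF (λ k → a k * X k i)) i ≡ f₀ i + sumF (λ k → a k * (f (X k) i - f₀ i))
  f-sum {zero}  a X X∈ i = sym (ℚ.+-identityʳ (f₀ i))
  f-sum {suc m} a X X∈ i = begin
    f (λ i → a zero * X zero i + rest i) i
      ≡⟨ f-cong (span-sum G a X X∈) (λ j → ℚ.+-comm (a zero * X zero j) (rest j)) i ⟩
    f (λ i → rest i + a zero * X zero i) i
      ≡⟨ f-linear (a zero) (span-sum G (a ∘ suc) (X ∘ suc) (X∈ ∘ suc)) (X∈ zero) i ⟩
    f rest i + a zero * (f (X zero) i - f₀ i)
      ≡⟨ cong (_+ a zero * (f (X zero) i - f₀ i)) (f-sum (a ∘ suc) (X ∘ suc) (X∈ ∘ suc) i) ⟩
    (f₀ i + rest′) + a zero * (f (X zero) i - f₀ i)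
      ≡⟨ rotate (f₀ i) rest′ (a zero * (f (X zero) i - f₀ i)) ⟩
    f₀ i + (a zero * (f (X zero) i - f₀ i) + rest′) ∎
    where
    open ≡-Reasoning
    rest : Vecℚ (n G)
    rest i = sumF (λ k → a (suc k) * X (suc k) i)
    rest′ : ℚ
    rest′ = sumF (λ k → a (suc k) * (f (X (suc k)) i - f₀ i))
    rotate : ∀ a b c → (a + b) + c ≡ a + (c + b)
    rotate = solve-∀ ringℚ

  private
    split : ∀ (I : Graph) (c : Gen I → ℚ) (X : Gen I → Vecℚ (n G)) i → sumGen I (λ h → c h * X h i) ≡
            sumF (λ k → c (k , true) * X (k , true) i) + 1ℚ * sumF (λ k → c (k , false) * X (k , false) i)
    split I c X i = trans (sum-+ (λ k → c (k , true) * X (k , true) i) (λ k → c (k , false) * X (k , false) i))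
      (cong (sumF (λ k → c (k , true) * X (k , true) i) +_) (sym (ℚ.*-identityˡ (sumF (λ k → c (k , false) * X (k , false) i)))))

  span-comb : ∀ (I : Graph) (c : Gen I → ℚ) (X : Gen I → Vecℚ (n G)) → (∀ h → Span G (X h)) →
              Span G (λ i → sumGen I (λ h → c h * X h i))
  span-comb I c X X∈ = span-resp G (λ i → sym (split I c X i)) (span-linear G 1ℚ
    (span-sum G (λ k → c (k , true)) (λ k → X (k , true)) (λ k → X∈ (k , true)))
    (span-sum G (λ k → c (k , false)) (λ k → X (k , false)) (λ k → X∈ (k , false))))

  f-comb : ∀ (I : Graph) (c : Gen I → ℚ) (X : Gen I → Vecℚ (n G)) → (∀ h → Span G (X h)) → sumGen I c ≡ 1ℚ →
           ∀ i → f (λ i → sumGen I (λ h → c h * X h i)) i ≡ sumGen I (λ h → c h * f (X h) i)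
  f-comb I c X X∈ sum≡1 i = begin
    f (λ i → sumGen I (λ h → c h * X h i)) i
      ≡⟨ f-cong (span-comb I c X X∈) (split I c X) i ⟩
    f (λ i → A⁺ i + 1ℚ * A⁻ i) i
      ≡⟨ f-linear 1ℚ A⁺∈ A⁻∈ i ⟩
    f A⁺ i + 1ℚ * (f A⁻ i - f₀ i)
      ≡⟨ cong₂ (λ a b → a + 1ℚ * (b - f₀ i)) (f-sum (λ k → c (k , true)) (λ k → X (k , true)) (λ k → X∈ (k , true)) i)
                                              (f-sum (λ k → c (k , false)) (λ k → X (k , false)) (λ k → X∈ (k , false)) i) ⟩
    (f₀ i + B true) + 1ℚ * ((f₀ i + B false) - f₀ i)
      ≡⟨ simplify (f₀ i) (B true) (B false) ⟩
    f₀ i + (B true + B false)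
      ≡⟨ cong (f₀ i +_) (sum-+ (λ k → c (k , true) * (f (X (k , true)) i - f₀ i)) (λ k → c (k , false) * (f (X (k , false)) i - f₀ i))) ⟨
    f₀ i + sumGen I (λ h → c h * (f (X h) i - f₀ i))
      ≡⟨ cong (f₀ i +_) (trans (sumGen-cong I (λ h → distribute (c h) (f (X h) i) (f₀ i)))
                               (sumGen-- I (λ h → c h * f (X h) i) (λ h → c h * f₀ i))) ⟩
    f₀ i + (sumGen I (λ h → c h * f (X h) i) - sumGen I (λ h → c h * f₀ i))
      ≡⟨ cong (λ t → f₀ i + (sumGen I (λ h → c h * f (X h) i) - t)) (trans (sumGen-*ʳ I c (f₀ i)) (cong (_* f₀ i) sum≡1)) ⟩
    f₀ i + (sumGen I (λ h → c h * f (X h) i) - 1ℚ * f₀ i)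
      ≡⟨ cancel (f₀ i) (sumGen I (λ h → c h * f (X h) i)) ⟩
    sumGen I (λ h → c h * f (X h) i) ∎
    where
    open ≡-Reasoning
    A⁺ A⁻ : Vecℚ (n G)
    A⁺ i = sumF (λ k → c (k , true) * X (k , true) i)
    A⁻ i = sumF (λ k → c (k , false) * X (k , false) i)
    A⁺∈ = span-sum G (λ k → c (k , true)) (λ k → X (k , true)) (λ k → X∈ (k , true))
    A⁻∈ = span-sum G (λ k → c (k , false)) (λ k → X (k , false)) (λ k → X∈ (k , false))
    B : Bool → ℚ
    B b = sumF (λ k → c (k , b) * (f (X (k , b)) i - f₀ i))
    simplify : ∀ z p q → (z + p) + 1ℚ * ((z + q) - z) ≡ z + (p + q)
    simplify = solve-∀ ringℚ
    distribute : ∀ c x z → c * (x - z) ≡ c * x - c * z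
    distribute = solve-∀ ringℚ
    cancel : ∀ z s → z + (s - 1ℚ * z) ≡ s
    cancel = solve-∀ ringℚ

  f-injective : ∀ {x y} → Span G x → Span G y → f x ≋ f y → x ≋ y
  f-injective x∈ y∈ = injective _ _ (aff x∈) (aff y∈)

  abstract
    -- The preimage of a vertex of P_H is a convex combination of generators of G, so the vertex is
    -- the same combination of their images, and by extremality it is one of them.
    preimage : ∀ h → ∃ λ g → f (gen G g) ≋ gen H h
    preimage h =
      let x , (c , c≥0 , sum≡1 , x≋) , fx≋ = polytope⁻ (gen H h) (VH.gen∈P h)
          x∈ = aff⇒span G (c , sum≡1 , x≋)
      in VH.extreme G h c (λ g → f (gen G g)) c≥0 sum≡1 (λ g → polytope (gen G g) (VG.gen∈P g))
           (λ i → trans (sym (fx≋ i)) (trans (f-cong x∈ x≋ i) (f-comb G c (gen G) (span-gen G) sum≡1 i)))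

  α : Gen H → Gen G
  α h = proj₁ (preimage h)

  fα : ∀ h → f (gen G (α h)) ≋ gen H h
  fα h = proj₂ (preimage h)

  abstract
    -- The image of g is a convex combination of generators of H, each of which is the image of some
    -- `gen G (α h)`. By injectivity g is the same combination of these, and extremality applies in
    -- G.
    image : ∀ g → ∃ λ h → f (gen G g) ≋ gen H h
    image g =
      let c , c≥0 , sum≡1 , fg≋ = polytope (gen G g) (VG.gen∈P g)
          X = λ h → gen G (α h)
          X∈ = λ h → span-gen G (α h)
          g≋ : gen G g ≋ (λ i → sumGen H (λ h → c h * gen G (α h) i))
          g≋ = f-injective (span-gen G g) (span-comb H c X X∈) (λ i → trans (fg≋ i) (sym (trans (f-comb H c X X∈ sum≡1 i)
                 (sumGen-cong H (λ h → cong (c h *_) (fα h i))))))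
          h , αh≋ = VG.extreme H g c X c≥0 sum≡1 (λ h → VG.gen∈P (α h)) g≋
      in h , λ i → trans (f-cong (span-gen G g) (λ j → sym (αh≋ j)) i) (fα h i)

  β : Gen G → Gen H
  β g = proj₁ (image g)

  fβ : ∀ g → f (gen G g) ≋ gen H (β g)
  fβ g = proj₂ (image g)

  βα : ∀ h → β (α h) ≡ h
  βα h = VH.gen-injective (β (α h)) h (λ i → trans (sym (fβ (α h) i)) (fα h i))

  αβ : ∀ g → α (β g) ≡ g
  αβ g = VG.gen-injective (α (β g)) g (f-injective (span-gen G (α (β g))) (span-gen G g)
           (λ i → trans (fα (β g) i) (sym (fβ g i))))

  private
    centre : ∀ g i → f₀ i ≡ ½ * gen H (β g) i + (1ℚ - ½) * gen H (β (VG.opp g)) i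
    centre g i = begin
      f₀ i
        ≡⟨ f-cong (span-zero G) (λ j → trans (balance (gen G g j))
             (cong (λ t → ½ * gen G g j + (1ℚ - ½) * t) (sym (VG.gen-opp g j)))) i ⟩
      f (affComb ½ (gen G g) (gen G (VG.opp g))) i
        ≡⟨ f-affine ½ (span-gen G g) (span-gen G (VG.opp g)) i ⟩
      ½ * f (gen G g) i + (1ℚ - ½) * f (gen G (VG.opp g)) i
        ≡⟨ cong₂ (λ a b → ½ * a + (1ℚ - ½) * b) (fβ g i) (fβ (VG.opp g) i) ⟩
      ½ * gen H (β g) i + (1ℚ - ½) * gen H (β (VG.opp g)) i ∎
      where
      open ≡-Reasoning
      balance : ∀ x → 0ℚ ≡ ½ * x + (1ℚ - ½) * - x
      balance = solve-∀ ringℚ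

    partner : ∀ h → ∃ λ h′ → ∀ i → f₀ i + f₀ i ≡ gen H h i + gen H h′ i
    partner h = β (VG.opp (α h)) , λ i → trans (cong (λ t → t + t) (centre (α h) i))
      (trans (double (gen H (β (α h)) i) (gen H (β (VG.opp (α h))) i))
             (cong (λ h → gen H h i + gen H (β (VG.opp (α h₀))) i) (βα h₀)))
      where
      h₀ = h
      double : ∀ a b → (½ * a + (1ℚ - ½) * b) + (½ * a + (1ℚ - ½) * b) ≡ a + b
      double = solve-∀ ringℚ

    -- Twice a coordinate of `f₀` is p + q by a vertex and its partner, and - p + r by the opposite
    -- vertex and its partner. For p = 1 the first is at least 0 and the second at most 0; for p =
    -- -1 it is the other way round.
    pinch : ∀ {p q r} → Ternary p → Ternary q → Ternary r → p ≢ 0ℚ → p + q ≡ - p + r → p + q ≡ 0ℚ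
    pinch (inj₁ refl) _ _ p≢0 _ = contradiction refl p≢0
    pinch (inj₂ (inj₁ refl)) (inj₂ (inj₂ refl)) _ _ _ = refl
    pinch (inj₂ (inj₂ refl)) (inj₂ (inj₁ refl)) _ _ _ = refl
    pinch (inj₂ (inj₁ refl)) (inj₁ refl)        (inj₁ refl)        _ ()
    pinch (inj₂ (inj₁ refl)) (inj₁ refl)        (inj₂ (inj₁ refl)) _ ()
    pinch (inj₂ (inj₁ refl)) (inj₁ refl)        (inj₂ (inj₂ refl)) _ ()
    pinch (inj₂ (inj₁ refl)) (inj₂ (inj₁ refl)) (inj₁ refl)        _ ()
    pinch (inj₂ (inj₁ refl)) (inj₂ (inj₁ refl)) (inj₂ (inj₁ refl)) _ ()
    pinch (inj₂ (inj₁ refl)) (inj₂ (inj₁ refl)) (inj₂ (inj₂ refl)) _ ()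
    pinch (inj₂ (inj₂ refl)) (inj₁ refl)        (inj₁ refl)        _ ()
    pinch (inj₂ (inj₂ refl)) (inj₁ refl)        (inj₂ (inj₁ refl)) _ ()
    pinch (inj₂ (inj₂ refl)) (inj₁ refl)        (inj₂ (inj₂ refl)) _ ()
    pinch (inj₂ (inj₂ refl)) (inj₂ (inj₂ refl)) (inj₁ refl)        _ ()
    pinch (inj₂ (inj₂ refl)) (inj₂ (inj₂ refl)) (inj₂ (inj₁ refl)) _ ()
    pinch (inj₂ (inj₂ refl)) (inj₂ (inj₂ refl)) (inj₂ (inj₂ refl)) _ ()

    p+p≡0⇒p≡0 : ∀ {p} → p + p ≡ 0ℚ → p ≡ 0ℚ
    p+p≡0⇒p≡0 {p} eq = *-cancel-0 {2ℚ} (λ ()) (trans (double p) eq)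
      where
      double : ∀ p → 2ℚ * p ≡ p + p
      double = solve-∀ ringℚ

  -- Every vertex of P_H is paired with its reflection in f₀, and P_H lies in the cube [-1,1]ⁿ.
  f₀≡0 : ∀ i → f₀ i ≡ 0ℚ
  f₀≡0 i = go (gen H h i ℚ.≟ 0ℚ) (gen H h′ i ℚ.≟ 0ℚ)
    where
    h  = β (k₀ , true)
    h′ = proj₁ (partner h)
    pair : f₀ i + f₀ i ≡ gen H h i + gen H h′ i
    pair = proj₂ (partner h) i
    reflected : ∀ h → ∃ λ r → Ternary r × f₀ i + f₀ i ≡ - gen H h i + r
    reflected h = let r , eq = partner (VH.opp h) in
      gen H r i , VH.gen-ternary r i , trans (eq i) (cong (_+ gen H r i) (VH.gen-opp h i))
    at : ∀ h h′ → f₀ i + f₀ i ≡ gen H h i + gen H h′ i → gen H h i ≢ 0ℚ → f₀ i ≡ 0ℚ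
    at h h′ eq ≢0 = let r , ternary-r , eq′ = reflected h in
      p+p≡0⇒p≡0 (trans eq (pinch (VH.gen-ternary h i) (VH.gen-ternary h′ i) ternary-r ≢0 (trans (sym eq) eq′)))
    go : Dec (gen H h i ≡ 0ℚ) → Dec (gen H h′ i ≡ 0ℚ) → f₀ i ≡ 0ℚ
    go (no ≢0)  _         = at h h′ pair ≢0
    go (yes _)  (no ≢0)   = at h′ h (trans pair (ℚ.+-comm (gen H h i) (gen H h′ i))) ≢0
    go (yes eq) (yes eq′) = p+p≡0⇒p≡0 (trans pair (cong₂ _+_ eq eq′))

  f-span : ∀ (a : Fin (e G) → ℚ) i → f (λ i → sumF (λ k → a k * edge G k i)) i ≡ sumF (λ k → a k * gen H (β (k , true)) i)
  f-span a i = trans (f-sum a (edge G) (λ k → span-gen G (k , true)) i)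
    (trans (cong₂ _+_ (f₀≡0 i) (sum-cong (λ k → cong (a k *_) (trans (cong₂ _-_ (fβ (k , true) i) (f₀≡0 i)) (ℚ.+-identityʳ (gen H (β (k , true)) i))))))
           (ℚ.+-identityˡ (sumF (λ k → a k * gen H (β (k , true)) i))))

  β-opp : ∀ g → β (VG.opp g) ≡ VH.opp (β g)
  β-opp g = VH.gen-injective (β (VG.opp g)) (VH.opp (β g)) λ i → trans
    (solved (gen H (β g) i) (gen H (β (VG.opp g)) i) (trans (sym (centre g i)) (f₀≡0 i))) (sym (VH.gen-opp (β g) i))
    where
    isolate : ∀ a b → b ≡ 2ℚ * (½ * a + (1ℚ - ½) * b) - a
    isolate = solve-∀ ringℚ
    drop : ∀ a → 2ℚ * 0ℚ - a ≡ - a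
    drop = solve-∀ ringℚ
    solved : ∀ a b → ½ * a + (1ℚ - ½) * b ≡ 0ℚ → b ≡ - a
    solved a b eq = trans (isolate a b) (trans (cong (λ t → 2ℚ * t - a) eq) (drop a))

  to : Fin (e G) → Fin (e H)
  to k = proj₁ (β (k , true))

  sign : Fin (e G) → Bool
  sign k = proj₂ (β (k , true))

  from : Fin (e H) → Fin (e G)
  from l = proj₁ (α (l , true))

  to-any : ∀ k b → proj₁ (β (k , b)) ≡ to k
  to-any k true  = refl
  to-any k false = cong proj₁ (β-opp (k , true))

  to-from : ∀ l → to (from l) ≡ l
  to-from l = trans (sym (to-any (from l) (proj₂ (α (l , true))))) (cong proj₁ (βα (l , true)))

  from-to : ∀ k → from (to k) ≡ k
  from-to k = go (sign k) refl
    where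
    go : ∀ b → sign k ≡ b → from (to k) ≡ k
    go true  eq = cong proj₁ (trans (cong (λ b → α (to k , b)) (sym eq)) (αβ (k , true)))
    -- `from` looks at the positive orientation of `to k`; if `β` reverses the edge, that is the
    -- image of the opposite generator.
    go false eq = cong proj₁ (trans (cong α (trans (cong (λ b → to k , not b) (sym eq)) (sym (β-opp (k , true))))) (αβ (k , false)))

  σ : Fin (e G) ↔ Fin (e H)
  σ = mk↔ₛ′ to from to-from from-to

  gen-sign : ∀ g i → gen H g i ≡ sgn (proj₂ g) * edge H (proj₁ g) i
  gen-sign (l , true)  i = sym (ℚ.*-identityˡ (edge H l i))
  gen-sign (l , false) i = trans (gen-false H l i) (neg (edge H l i))
    where
    neg : ∀ x → - x ≡ - 1ℚ * x
    neg = solve-∀ ringℚ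

  private
    reindexed : ∀ (z : Fin (e G) → ℚ) i →
      sumF (λ l → sgn (sign (from l)) * z (from l) * edge H l i) ≡ sumF (λ k → z k * gen H (β (k , true)) i)
    reindexed z i = trans (sum-reindex σ (λ l → sgn (sign (from l)) * z (from l) * edge H l i)) (sum-cong (λ k →
      trans (cong (λ j → sgn (sign j) * z j * edge H (to k) i) (from-to k))
      (trans (swap (sgn (sign k)) (z k) (edge H (to k) i)) (cong (z k *_) (sym (gen-sign (β (k , true)) i))))))
      where
      swap : ∀ s z g → s * z * g ≡ z * (s * g)
      swap = solve-∀ ringℚ

  flow-to : ∀ z → Flow G z → Flow H (λ l → sgn (sign (from l)) * z (from l))
  flow-to z flow i = trans (reindexed z i) (trans (sym (f-span z i))
    (trans (f-cong (span-sum G z (edge G) (λ k → span-gen G (k , true))) flow i) (f₀≡0 i)))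

  -- f sends the signed combination of edges of G to the combination of edges of H with coefficients
  -- z, which is 0 and thus equal to `f₀`; f is injective on the span.
  flow-from : ∀ z → Flow H z → Flow G (λ k → sgn (sign k) * z (to k))
  flow-from z flow = f-injective (span-sum G a (edge G) (λ k → span-gen G (k , true))) (span-zero G) λ i →
    trans (f-span a i) (trans (sym (reindexed a i)) (trans (sum-cong (λ l → cong (_* edge H l i) (unsign l)))
      (trans (flow i) (sym (f₀≡0 i)))))
    where
    a : Fin (e G) → ℚ
    a k = sgn (sign k) * z (to k)
    unsign : ∀ l → sgn (sign (from l)) * a (from l) ≡ z l
    unsign l = trans (sgn-cancel (sign (from l)) (z (to (from l)))) (cong z (to-from l))

  private
    nonzero-sgn : ∀ b {q} → sgn b * q ≢ 0ℚ → q ≢ 0ℚ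
    nonzero-sgn b ≢0 refl = ≢0 (ℚ.*-zeroʳ (sgn b))

  cycle-to : ∀ F → CycleIn G F → CycleIn H (transported σ F)
  cycle-to F C = Walk.cycle H (flow-to y y-flow) (transported σ F)
    (λ l ≢0 → ∈transported σ F l (y-support (from l) (nonzero-sgn (sign (from l)) ≢0)))
    (let k , yk≢0 = y-nonzero
     in to k , λ eq → yk≢0 (trans (cong y (sym (from-to k))) (*-cancel-0 (sgn≢0 (sign (from (to k)))) eq)))
    where open FromCycle G C using (y; y-flow; y-support; y-nonzero)

  cycle-from : ∀ F → CycleIn H (transported σ F) → CycleIn G F
  cycle-from F C = Walk.cycle G (flow-from y y-flow) F
    (λ k ≢0 → ∈transported⁻¹ σ F k (y-support (to k) (nonzero-sgn (sign k) ≢0)))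
    (let l , yl≢0 = y-nonzero
     in from l , λ eq → yl≢0 (trans (cong y (sym (to-from l))) (*-cancel-0 (sgn≢0 (sign (from l))) eq)))
    where open FromCycle H C using (y; y-flow; y-support; y-nonzero)

  matroidIso : MatroidIso G H
  matroidIso = σ , λ F → mk⇔ (λ indep C → indep (cycle-from F C)) (λ indep C → indep (cycle-to F C))

-- Without edges no weights sum to 1, so the affine hull of P_G is empty; by surjectivity so is that
-- of P_H, and H has no edge.
edgeless⇒matroid : ∀ G H → ¬ Fin (e G) → UnimodEquiv G H → MatroidIso G H
edgeless⇒matroid G H ¬k eqv =
    mk↔ₛ′ (⊥-elim ∘ ¬k) (⊥-elim ∘ ¬l) (⊥-elim ∘ ¬l) (⊥-elim ∘ ¬k)
  , λ F → mk⇔ (λ _ C → ¬l (proj₁ (CycleIn.closing C))) (λ _ C → ¬k (proj₁ (CycleIn.closing C)))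
  where
  surjective = proj₁ (proj₂ (proj₂ (proj₂ (proj₂ eqv))))
  ¬l : ¬ Fin (e H)
  ¬l l = let c , _ , sum≡1 , x≋ = Vertices.gen∈P H (l , true)
             x , (c′ , sum≡1′ , _) , _ = surjective (gen H (l , true)) (c , sum≡1 , x≋)
         in 0≢1 (trans (sym (sum-zero (λ k → ⊥-elim (¬k k)))) sum≡1′)

unimodular⇒matroid : ∀ G H → UnimodEquiv G H → MatroidIso G H
unimodular⇒matroid G H eqv with Fin.any? {e G} {P = λ _ → ⊤} (λ _ → yes tt)
... | yes (k₀ , _) = FromUnimodular.matroidIso G H k₀ eqv
... | no none      = edgeless⇒matroid G H (λ k → none (k , tt)) eqv

theorem4p6 : (G H : Graph) → UnimodEquiv G H ⇔ MatroidIso G H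
theorem4p6 G H = mk⇔ (unimodular⇒matroid G H) (matroid⇒unimodular G H)
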